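{- Let $n\ge 1$ and let $D$ be an oriented graph of order $n$ belonging to $\mathcal{F}_n$. Then $D$ has at most $2^k-1$ generalized cospectral mates (counted up to isomorphism), where $k$ is the number of distinct odd prime factors of $\det W(D)$.
   Context: An oriented graph $D$ on vertices $v_1,\dots,v_n$ is a digraph obtained from a simple undirected graph by giving each edge one direction. Its skew-adjacency matrix $S(D)=(s_{ij})$ is the $n\times n$ matrix with $s_{ij}=1$ if $(v_i,v_j)$ is an arc, $s_{ij}=-1$ if $(v_j,v_i)$ is an arc, and $s_{ij}=0$ otherwise. Let $e$ be the all-ones column vector of length $n$ and $J$ the $n\times n$ all-ones matrix. The skew-walk matrix of $D$ is $W(D)=[e,\,S(D)e,\,S(D)^2e,\dots,S(D)^{n-1}e]$. The quantity $2^{ -\lfloor n/2\rfloor}\det W(D)$ is always an integer; $\mathcal{F}_n$ denotes the set of oriented graphs $D$ of order $n$ for which $2^{ -\lfloor n/2\rfloor}\det W(D)$ is an odd square-free integer. Two oriented graphs $D,C$ of order $n$ share the same generalized skew spectrum if $S(D)$ and $S(C)$ have the same eigenvalues (with multiplicities) and $J-S(D)$ and $J-S(C)$ have the same eigenvalues (with multiplicities). Two oriented graphs are isomorphic if there is a bijection of vertex sets mapping arcs to arcs (with direction) in both directions. A generalized cospectral mate of $D$ is an oriented graph not isomorphic to $D$ that shares the same generalized skew spectrum with $D$. -}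

module Defs where

open import Data.Nat as ℕ using (ℕ; zero; suc; _%_)
open import Data.Nat.Divisibility using (_∣_; _∣?_)
open import Data.Nat.Primality using (Prime; prime?)
open import Data.Integer as ℤ using (ℤ; +_; _-_; -_; ∣_∣)
open import Data.Fin using (Fin; zero; suc; punchIn; _≟_)
open import Data.Bool using (Bool; true; false; if_then_else_; _∧_)
open import Data.List using (List; []; _∷_; length; filter; upTo; reverse; dropWhile)
open import Data.Product using (Σ; _×_; _,_)
open import Relation.Nullary.Decidable using (_×-dec_; ⌊_⌋)
open import Relation.Binary.PropositionalEquality using (_≡_)
open import Relation.Nullary using (¬_)
open import Function.Bundles using (_↔_; Inverse)

record OrientedGraph (n : ℕ) : Set where
  field
    arc        : Fin n → Fin n → Bool
    loopless   : ∀ i → arc i i ≡ false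
    antisym    : ∀ i j → arc i j ≡ true → arc j i ≡ false
open OrientedGraph public

Isomorphic : ∀ {n} → OrientedGraph n → OrientedGraph n → Set
Isomorphic {n} D C =
  Σ (Fin n ↔ Fin n) λ σ →
    ∀ i j → arc D i j ≡ arc C (Inverse.to σ i) (Inverse.to σ j)

Matrix : Set → ℕ → Set
Matrix A n = Fin n → Fin n → A

record RingOps (A : Set) : Set where
  field
    0r 1r : A
    _+r_ _*r_ : A → A → A
    negr : A → A

module Det {A : Set} (R : RingOps A) where
  open RingOps R

  altSum : ∀ {n} → (Fin n → A) → A
  altSum {zero}  f = 0r
  altSum {suc n} f = f zero +r negr (altSum {n} (λ j → f (suc j)))

  minor : ∀ {n} → Matrix A (suc n) → Fin (suc n) → Matrix A n
  minor M j i k = M (suc i) (punchIn j k)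

  det : ∀ {n} → Matrix A n → A
  det {zero}  M = 1r
  det {suc n} M = altSum (λ j → M zero j *r det (minor M j))

ℤ-ops : RingOps ℤ
ℤ-ops = record { 0r = + 0 ; 1r = + 1 ; _+r_ = ℤ._+_ ; _*r_ = ℤ._*_ ; negr = -_ }

detℤ : ∀ {n} → Matrix ℤ n → ℤ
detℤ = Det.det ℤ-ops

-- Univariate integer polynomials as coefficient lists
-- (constant term first); equality up to trailing zeros.

Poly : Set
Poly = List ℤ

_+P_ : Poly → Poly → Poly
[]       +P q        = q
p        +P []       = p
(a ∷ p)  +P (b ∷ q)  = (a ℤ.+ b) ∷ (p +P q)

negP : Poly → Poly
negP []      = []
negP (a ∷ p) = (- a) ∷ negP p

scaleP : ℤ → Poly → Poly
scaleP c []      = []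
scaleP c (a ∷ p) = (c ℤ.* a) ∷ scaleP c p

_*P_ : Poly → Poly → Poly
[]      *P q = []
(a ∷ p) *P q = scaleP a q +P (+ 0 ∷ (p *P q))

Poly-ops : RingOps Poly
Poly-ops = record { 0r = [] ; 1r = + 1 ∷ [] ; _+r_ = _+P_ ; _*r_ = _*P_ ; negr = negP }

isZeroℤ : ℤ → Bool
isZeroℤ (+ 0) = true
isZeroℤ _     = false

normP : Poly → Poly
normP p = reverse (dropWhile (λ a → isZeroℤ a ≟b true) (reverse p))
  where
  open import Data.Bool.Properties renaming (_≟_ to _≟b_)

_≈P_ : Poly → Poly → Set
p ≈P q = normP p ≡ normP q

charPoly : ∀ {n} → Matrix ℤ n → Poly
charPoly {n} M = Det.det Poly-ops (λ i j →
  if ⌊ i ≟ j ⌋ then (- M i j) ∷ + 1 ∷ [] else (- M i j) ∷ [])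

-- Same eigenvalues with multiplicities = same characteristic polynomial.
Cospectral : ∀ {n} → Matrix ℤ n → Matrix ℤ n → Set
Cospectral M N = charPoly M ≈P charPoly N

S : ∀ {n} → OrientedGraph n → Matrix ℤ n
S D i j = if arc D i j then + 1 else (if arc D j i then - (+ 1) else + 0)

J-S : ∀ {n} → OrientedGraph n → Matrix ℤ n
J-S D i j = + 1 - S D i j

sumFin : ∀ {n} → (Fin n → ℤ) → ℤ
sumFin {zero}  f = + 0
sumFin {suc n} f = f zero ℤ.+ sumFin (λ j → f (suc j))

Spow-e : ∀ {n} → OrientedGraph n → ℕ → Fin n → ℤ
Spow-e D zero    i = + 1
Spow-e D (suc k) i = sumFin (λ j → S D i j ℤ.* Spow-e D k j)

W : ∀ {n} → OrientedGraph n → Matrix ℤ n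
W D i j = Spow-e D (Data.Fin.toℕ j) i

detW : ∀ {n} → OrientedGraph n → ℤ
detW D = detℤ (W D)

Odd : ℕ → Set
Odd m = m % 2 ≡ 1

SquareFree : ℕ → Set
SquareFree m = ∀ d → d ℕ.* d ∣ m → d ≡ 1

InF : ∀ {n} → OrientedGraph n → Set
InF {n} D = Σ ℤ λ m →
  (detW D ≡ + (2 ℕ.^ (n ℕ./ 2)) ℤ.* m) × Odd ∣ m ∣ × SquareFree ∣ m ∣

-- number of distinct odd primes p dividing N (all such p satisfy p ≤ N
-- when N ≠ 0)
oddPrimeFactorCount : ℕ → ℕ
oddPrimeFactorCount N =
  length (filter (λ p → prime? p ×-dec ((p % 2) ℕ.≟ 1 ×-dec (p ∣? N))) (upTo (suc N)))

GenCospectral : ∀ {n} → OrientedGraph n → OrientedGraph n → Set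
GenCospectral D C = Cospectral (S D) (S C) × Cospectral (J-S D) (J-S C)

Mate : ∀ {n} → OrientedGraph n → OrientedGraph n → Set
Mate D C = ¬ Isomorphic D C × GenCospectral D C

{-# OPTIONS --safe #-}

-- Let C be generalized cospectral to D, with skew-adjacency matrices T and S. Expanding
-- e·(I + yS)⁻¹e shows that S and T have the same numbers e·Sᵏe, so that the vectors Sᵏe and Tᵏe
-- have the same Gram matrix and a rational orthogonal matrix R carries Sᵏe to Tᵏe.
--
-- The characteristic polynomial of S is even or odd, hence essentially a square g² modulo 2, and
-- then g(S)e ≡ 0 (mod 2). Replacing Sᵏe by ½ Sʲg(S)e in the last ⌊n/2⌋ columns of W(D) divides the
-- determinant by 2^⌊n/2⌋ and leaves an odd square-free o, and N = oR is an integral matrix.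
--
-- For a prime p ∣ o, the walk matrix has rank n − 1 modulo p, so all rows of all these matrices N
-- are multiples of one vector modulo p. Since the rows of one N have products ≡ 0 (mod p²), so do
-- the rows of N with those of N′, provided that p divides both or neither of N and N′. If this
-- holds for all p, then N N′ᵀ / o² is an integral orthogonal matrix fixing e, a permutation matrix.
-- So the set of primes dividing N determines the graph up to isomorphism, and D itself takes one
-- of the 2ᵏ sets.
module Submission where

open import Defs
open import Data.Nat using (ℕ; _≤_; _∸_; _^_)
open import Data.Integer using (∣_∣)
open import Data.List using (List; length)
open import Data.List.Relation.Unary.All using (All; []; _∷_)
open import Data.List.Relation.Unary.AllPairs using (AllPairs; []; _∷_)
import Data.List.Relation.Unary.All.Properties as Allₚ
import Data.List.Relation.Unary.AllPairs.Properties as AllPairsₚ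
open import Data.List.Relation.Unary.Any using (here; there)
open import Data.List.Membership.Propositional using (_∈_)
open import Data.List.Membership.Propositional.Properties using (∈-filter⁺; ∈-upTo⁺)
open import Relation.Nullary using (¬_)

import Data.Nat as ℕ
import Data.Nat.Properties as ℕₚ
import Data.Nat.DivMod as ℕ/
import Data.Nat.Divisibility as ℕ∣
open import Data.Nat using (zero; suc; z≤n; s≤s)
open import Data.Nat.Primality using (Prime; prime?; euclidsLemma; prime⇒nonTrivial; prime⇒nonZero)
open import Data.Nat.Primality.Factorisation using (factorise; module PrimeFactorisation)
open import Data.Nat.Tactic.RingSolver using () renaming (solve-∀ to ℕ-solve-∀)
open import Data.Nat.ListAction using (product)
open import Data.Integer as ℤ using (ℤ; +_; -[1+_]; _+_; _*_; _-_; -_; +≤+)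
import Data.Integer.Properties as ℤₚ
open import Data.Integer.Divisibility.Signed
  using (_∣_; _∣?_; divides; ∣⇒∣ᵤ; ∣ᵤ⇒∣; ∣-refl; ∣-trans; ∣m∣n⇒∣m+n; ∣m∣n⇒∣m-n; ∣m⇒∣-m; ∣n⇒∣m*n; ∣m⇒∣m*n)
open import Data.Integer.Tactic.RingSolver using (solve-∀)
open import Data.Bool using (true; false; if_then_else_)
import Data.Bool.Properties as Boolₚ
open import Data.Fin as Fin using (Fin; zero; suc; punchIn; punchOut; toℕ; fromℕ<; _≟_)
import Data.Fin.Properties as Finₚ
open import Data.List using ([]; _∷_; filter; upTo; reverse; dropWhile; _++_)
import Data.List.Properties as Listₚ
open import Data.Product using (Σ; ∃; _×_; _,_; proj₁; proj₂)
open import Data.Sum using (_⊎_; inj₁; inj₂)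
open import Data.Unit using (⊤; tt)
open import Data.Empty using (⊥-elim)
open import Data.Vec.Functional using (updateAt) renaming (_∷_ to _◂_)
import Data.Vec.Functional.Properties as Vectorₚ
open import Relation.Binary.Definitions using (tri<; tri≈; tri>)
open import Function using (_∘_; const)
open import Function.Bundles using (_↔_; Inverse; mk↔ₛ′)
open import Relation.Nullary using (Dec; yes; no)
open import Relation.Nullary.Decidable using (⌊_⌋; ¬?; _×-dec_; decidable-stable)
open import Relation.Binary.PropositionalEquality
  using (_≡_; _≢_; _≗_; refl; sym; trans; cong; cong₂; subst; module ≡-Reasoning)
open ≡-Reasoning

-- Sums and inner products

-- All arithmetic stays in the integers: the rational matrix R occurs only as N = oR, built from
-- cofactors, and its orthogonality as NᵀN = o²I. Identities between polynomials or power series are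
-- read off from integer values, because a number divisible by arbitrarily large integers is zero.
--
-- Why one bit per prime suffices: if p divides all entries of N and of N′, the products of their
-- rows are visibly 0 modulo p². If it divides neither, take rows x of N and y of N′ that are
-- nonzero modulo p. Then αy ≡ βx (mod p) with units α and β, and expanding |αy - βx|² ≡ 0 (mod p²)
-- leaves 2αβ x·y ≡ 0 (mod p²). This is where p has to be odd, and why the power of 2 is removed
-- from the determinant beforehand. In the mixed case the products are only known to be 0 modulo p.
--
-- Square-freeness enters twice: p² ∤ o yields the rank n - 1 modulo p, and the congruences modulo
-- the single p² combine to one modulo o².

-‿cong : ∀ {a b : ℤ} → a ≡ b → - a ≡ - b
-‿cong = cong (λ a → - a)

V : ℕ → Set
V n = Fin n → ℤ

-- Opaque, so that the summation length can be inferred by unification.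
opaque
  sum : ∀ {n} → V n → ℤ
  sum = sumFin

  sum≡sumFin : ∀ {n} (f : V n) → sum f ≡ sumFin f
  sum≡sumFin f = refl

  sum-[] : (f : V 0) → sum f ≡ + 0
  sum-[] f = refl

  sum-∷ : ∀ {n} (f : V (suc n)) → sum f ≡ f zero + sum (f ∘ suc)
  sum-∷ f = refl

  sum-cong : ∀ {n} {f g : V n} → f ≗ g → sum f ≡ sum g
  sum-cong {zero}  h = refl
  sum-cong {suc n} h = cong₂ _+_ (h zero) (sum-cong {n} (h ∘ suc))

  sum-0 : ∀ {n} {f : V n} → (∀ i → f i ≡ + 0) → sum f ≡ + 0
  sum-0 {zero}  h = refl
  sum-0 {suc n} h = cong₂ _+_ (h zero) (sum-0 {n} (h ∘ suc))

  sum-+ : ∀ {n} (f g : V n) → sum (λ i → f i + g i) ≡ sum f + sum g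
  sum-+ {zero}  f g = refl
  sum-+ {suc n} f g = trans (cong (_+_ (f zero + g zero)) (sum-+ (f ∘ suc) (g ∘ suc)))
                            (lem (f zero) (g zero) (sum (f ∘ suc)) (sum (g ∘ suc)))
    where
    lem : ∀ a b c d → a + b + (c + d) ≡ a + c + (b + d)
    lem = solve-∀

  sum-* : ∀ {n} c (f : V n) → sum (λ i → c * f i) ≡ c * sum f
  sum-* {zero}  c f = sym (ℤₚ.*-zeroʳ c)
  sum-* {suc n} c f = trans (cong (_+_ (c * f zero)) (sum-* c (f ∘ suc)))
                            (sym (ℤₚ.*-distribˡ-+ c (f zero) (sum (f ∘ suc))))

  sum-swap : ∀ {m n} (f : Fin m → Fin n → ℤ) →
    sum (λ i → sum (f i)) ≡ sum (λ j → sum (λ i → f i j))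
  sum-swap {zero}  {n} f = sym (sum-0 {n} {f = λ _ → + 0} (λ _ → refl))
  sum-swap {suc m} f = trans (cong (_+_ (sum (f zero))) (sum-swap (f ∘ suc)))
                             (sym (sum-+ (f zero) (λ j → sum (λ i → f (suc i) j))))

  sum-punchIn : ∀ {n} (i : Fin (suc n)) (f : V (suc n)) → sum f ≡ f i + sum (f ∘ punchIn i)
  sum-punchIn         zero    f = refl
  sum-punchIn {suc n} (suc i) f = trans (cong (_+_ (f zero)) (sum-punchIn i (f ∘ suc)))
                                        (lem (f zero) (f (suc i)) (sum (f ∘ suc ∘ punchIn i)))
    where
    lem : ∀ a b c → a + (b + c) ≡ b + (a + c)
    lem = solve-∀

  sum-∣ : ∀ {n} {d} {f : V n} → (∀ i → d ∣ f i) → d ∣ sum f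
  sum-∣ {zero}  h = divides (+ 0) refl
  sum-∣ {suc n} h = ∣m∣n⇒∣m+n (h zero) (sum-∣ {n} (h ∘ suc))

sum-*ʳ : ∀ {n} (f : V n) c → sum (λ i → f i * c) ≡ sum f * c
sum-*ʳ f c = trans (sum-cong (λ i → ℤₚ.*-comm (f i) c)) (trans (sum-* c f) (ℤₚ.*-comm c (sum f)))

sum-single : ∀ {n} (i : Fin n) (f : V n) → (∀ j → j ≢ i → f j ≡ + 0) → sum f ≡ f i
sum-single {suc n} i f h = begin
  sum f                         ≡⟨ sum-punchIn i f ⟩
  f i + sum (f ∘ punchIn i)     ≡⟨ cong (_+_ (f i)) (sum-0 (λ j → h (punchIn i j) (Finₚ.punchInᵢ≢i i j))) ⟩
  f i + + 0                     ≡⟨ ℤₚ.+-identityʳ (f i) ⟩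
  f i                           ∎

δ : ∀ {n} → Fin n → Fin n → ℤ
δ i j = if ⌊ i ≟ j ⌋ then + 1 else + 0

δ-diag : ∀ {n} (i : Fin n) → δ i i ≡ + 1
δ-diag i with i ≟ i
... | yes _ = refl
... | no  h = ⊥-elim (h refl)

δ-off : ∀ {n} {i j : Fin n} → i ≢ j → δ i j ≡ + 0
δ-off {i = i} {j} h with i ≟ j
... | yes e = ⊥-elim (h e)
... | no  _ = refl

δ-sym : ∀ {n} (i j : Fin n) → δ i j ≡ δ j i
δ-sym i j with i ≟ j
... | yes refl = sym (δ-diag i)
... | no  h    = sym (δ-off (h ∘ sym))

infix 8 _∙_
opaque
  _∙_ : ∀ {n} → V n → V n → ℤ
  u ∙ v = sum (λ i → u i * v i)

  ∙-def : ∀ {n} (u v : V n) → u ∙ v ≡ sum (λ i → u i * v i)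
  ∙-def u v = refl

infixl 6 _⊕_
infixr 7 _⊛_
_⊕_ : ∀ {n} → V n → V n → V n
(u ⊕ v) i = u i + v i

_⊛_ : ∀ {n} → ℤ → V n → V n
(c ⊛ v) i = c * v i

mv : ∀ {m n} → (Fin m → Fin n → ℤ) → V n → V m
mv M v i = M i ∙ v

transpose : ∀ {m n} → (Fin m → Fin n → ℤ) → Fin n → Fin m → ℤ
transpose M i j = M j i

*-nonneg : ∀ a → + 0 ℤ.≤ a * a
*-nonneg (+ n)    = subst (+ 0 ℤ.≤_) (ℤₚ.pos-* n n) (+≤+ z≤n)
*-nonneg -[1+ n ] = +≤+ z≤n

nonneg-sum-0 : ∀ {a b} → + 0 ℤ.≤ a → + 0 ℤ.≤ b → a + b ≡ + 0 → a ≡ + 0 × b ≡ + 0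
nonneg-sum-0 {+ zero}  {+ b} (+≤+ _) (+≤+ _) e = refl , e
nonneg-sum-0 {+ suc a} {+ b} (+≤+ _) (+≤+ _) ()

square-0 : ∀ a → a * a ≡ + 0 → a ≡ + 0
square-0 a e with ℤₚ.i*j≡0⇒i≡0∨j≡0 a e
... | inj₁ h = h
... | inj₂ h = h

opaque
  unfolding _∙_ sum

  ∙-cong : ∀ {n} {u u′ v v′ : V n} → u ≗ u′ → v ≗ v′ → u ∙ v ≡ u′ ∙ v′
  ∙-cong p q = sum-cong (λ i → cong₂ _*_ (p i) (q i))

  ∙-comm : ∀ {n} (u v : V n) → u ∙ v ≡ v ∙ u
  ∙-comm {n} u v = sum-cong {n} (λ i → ℤₚ.*-comm (u i) (v i))

  ∙-⊕ : ∀ {n} (u v w : V n) → (u ⊕ v) ∙ w ≡ u ∙ w + v ∙ w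
  ∙-⊕ {n} u v w = trans (sum-cong {n} (λ i → ℤₚ.*-distribʳ-+ (w i) (u i) (v i)))
                        (sum-+ (λ i → u i * w i) (λ i → v i * w i))

  ∙-⊛ : ∀ {n} c (u w : V n) → (c ⊛ u) ∙ w ≡ c * (u ∙ w)
  ∙-⊛ {n} c u w = trans (sum-cong {n} (λ i → ℤₚ.*-assoc c (u i) (w i))) (sum-* c (λ i → u i * w i))

  mv-adjoint : ∀ {m n} (M : Fin m → Fin n → ℤ) u v → u ∙ mv M v ≡ mv (transpose M) u ∙ v
  mv-adjoint {m} {n} M u v = begin
    sum (λ i → u i * sum (λ j → M i j * v j))
      ≡⟨ sum-cong {m} (λ i → sym (sum-* (u i) (λ j → M i j * v j))) ⟩
    sum (λ i → sum (λ j → u i * (M i j * v j)))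
      ≡⟨ sum-swap (λ i j → u i * (M i j * v j)) ⟩
    sum (λ j → sum (λ i → u i * (M i j * v j)))
      ≡⟨ sum-cong {n} (λ j → trans (sum-cong {m} (λ i → lem (u i) (M i j) (v j))) (sum-*ʳ (λ i → M i j * u i) (v j))) ⟩
    sum (λ j → sum (λ i → M i j * u i) * v j)
      ∎
    where
    lem : ∀ a b c → a * (b * c) ≡ b * a * c
    lem = solve-∀

  ∙-nonneg : ∀ {n} (v : V n) → + 0 ℤ.≤ v ∙ v
  ∙-nonneg {zero}  v = +≤+ z≤n
  ∙-nonneg {suc n} v = ℤₚ.+-mono-≤ (*-nonneg (v zero)) (∙-nonneg (v ∘ suc))

  ∙-definite : ∀ {n} (v : V n) → v ∙ v ≡ + 0 → ∀ i → v i ≡ + 0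
  ∙-definite v e zero    = square-0 _ (proj₁ (nonneg-sum-0 (*-nonneg (v zero)) (∙-nonneg (v ∘ suc)) e))
  ∙-definite v e (suc i) = ∙-definite (v ∘ suc) (proj₂ (nonneg-sum-0 (*-nonneg (v zero)) (∙-nonneg (v ∘ suc)) e)) i

  ∙-zeroʳ : ∀ {n} {v : V n} (u : V n) → (∀ i → v i ≡ + 0) → u ∙ v ≡ + 0
  ∙-zeroʳ {n} u h = sum-0 {n} (λ i → trans (cong (u i *_) (h i)) (ℤₚ.*-zeroʳ (u i)))

  ∙-δ : ∀ {n} (v : V n) i → v ∙ δ i ≡ v i
  ∙-δ v i = trans (sum-single i (λ j → v j * δ i j) (λ j h → trans (cong (v j *_) (δ-off (h ∘ sym))) (ℤₚ.*-zeroʳ (v j))))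
                  (trans (cong (v i *_) (δ-diag i)) (ℤₚ.*-identityʳ (v i)))

  ∙-∣ʳ : ∀ {n d} (u : V n) {v : V n} → (∀ i → d ∣ v i) → d ∣ u ∙ v
  ∙-∣ʳ {n} u h = sum-∣ {n} (λ i → ∣n⇒∣m*n (u i) (h i))

∙-⊕ʳ : ∀ {n} (w u v : V n) → w ∙ (u ⊕ v) ≡ w ∙ u + w ∙ v
∙-⊕ʳ w u v = trans (∙-comm w (u ⊕ v)) (trans (∙-⊕ u v w) (cong₂ _+_ (∙-comm u w) (∙-comm v w)))

∙-⊛ʳ : ∀ {n} c (w u : V n) → w ∙ (c ⊛ u) ≡ c * (w ∙ u)
∙-⊛ʳ c w u = trans (∙-comm w (c ⊛ u)) (trans (∙-⊛ c u w) (cong (c *_) (∙-comm u w)))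

∙-congʳ : ∀ {n} (u : V n) {v v′ : V n} → v ≗ v′ → u ∙ v ≡ u ∙ v′
∙-congʳ u = ∙-cong {u = u} (λ _ → refl)

∙-congˡ : ∀ {n} {u u′ : V n} (v : V n) → u ≗ u′ → u ∙ v ≡ u′ ∙ v
∙-congˡ v h = ∙-cong {v = v} h (λ _ → refl)

mv-cong : ∀ {m n} (M : Fin m → Fin n → ℤ) {u v} → u ≗ v → mv M u ≗ mv M v
mv-cong M h i = ∙-congʳ (M i) h

mv-⊕ : ∀ {m n} (M : Fin m → Fin n → ℤ) u v → mv M (u ⊕ v) ≗ mv M u ⊕ mv M v
mv-⊕ M u v i = ∙-⊕ʳ (M i) u v

mv-⊛ : ∀ {m n} (M : Fin m → Fin n → ℤ) c v → mv M (c ⊛ v) ≗ c ⊛ mv M v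
mv-⊛ M c v i = ∙-⊛ʳ c (M i) v

-- Determinants

-- The determinant is computed by the ring operations alone, so a relation that they respect passes
-- from entries to determinants. It serves for equality, for congruence modulo d and for the
-- evaluation of polynomials at x.
module Parametricity {A B : Set} (R : RingOps A) (R′ : RingOps B) (_~_ : A → B → Set)
  (~-0 : RingOps.0r R ~ RingOps.0r R′) (~-1 : RingOps.1r R ~ RingOps.1r R′)
  (~-+ : ∀ {a a′ b b′} → a ~ a′ → b ~ b′ → RingOps._+r_ R a b ~ RingOps._+r_ R′ a′ b′)
  (~-* : ∀ {a a′ b b′} → a ~ a′ → b ~ b′ → RingOps._*r_ R a b ~ RingOps._*r_ R′ a′ b′)
  (~-neg : ∀ {a a′} → a ~ a′ → RingOps.negr R a ~ RingOps.negr R′ a′) where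

  altSum-~ : ∀ {n} {f : Fin n → A} {g : Fin n → B} → (∀ i → f i ~ g i) →
    Det.altSum R f ~ Det.altSum R′ g
  altSum-~ {zero}  h = ~-0
  altSum-~ {suc n} h = ~-+ (h zero) (~-neg (altSum-~ {n} (h ∘ suc)))

  det-~ : ∀ {n} {M : Matrix A n} {N : Matrix B n} → (∀ i j → M i j ~ N i j) →
    Det.det R M ~ Det.det R′ N
  det-~ {zero}  h = ~-1
  det-~ {suc n} h = altSum-~ {suc n} (λ j → ~-* (h zero j) (det-~ {n} (λ i k → h (suc i) (punchIn j k))))

sgn : ∀ {n} → Fin n → ℤ
sgn zero    = + 1
sgn (suc j) = - sgn j

cut : ∀ {m n} → (Fin m → V (suc n)) → Fin (suc n) → Fin m → V n
cut R j i k = R i (punchIn j k)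

opaque
  unfolding sum

  altSum≡sum : ∀ {n} (f : V n) → Det.altSum ℤ-ops f ≡ sum (λ j → sgn j * f j)
  altSum≡sum {zero}  f = refl
  altSum≡sum {suc n} f = cong₂ _+_ (sym (ℤₚ.*-identityˡ (f zero))) (begin
    - Det.altSum ℤ-ops (f ∘ suc)              ≡⟨ -‿cong (altSum≡sum (f ∘ suc)) ⟩
    - sum (λ j → sgn j * f (suc j))           ≡⟨ sym (ℤₚ.-1*i≡-i (sum (λ j → sgn j * f (suc j)))) ⟩
    - + 1 * sum (λ j → sgn j * f (suc j))     ≡⟨ sym (sum-* (- + 1) (λ j → sgn j * f (suc j))) ⟩
    sum (λ j → - + 1 * (sgn j * f (suc j)))   ≡⟨ sum-cong (λ j → lem (sgn j) (f (suc j))) ⟩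
    sum (λ j → - sgn j * f (suc j))           ∎)
    where
    lem : ∀ a b → - + 1 * (a * b) ≡ - a * b
    lem = solve-∀

opaque
  det : ∀ {n} → Matrix ℤ n → ℤ
  det = detℤ

  det≡detℤ : ∀ {n} (M : Matrix ℤ n) → det M ≡ detℤ M
  det≡detℤ M = refl

  det-[] : (M : Matrix ℤ 0) → det M ≡ + 1
  det-[] M = refl

  det-cong : ∀ {n} {M N : Matrix ℤ n} → (∀ i → M i ≗ N i) → det M ≡ det N
  det-cong {n} = Parametricity.det-~ ℤ-ops ℤ-ops _≡_ refl refl (cong₂ _+_) (cong₂ _*_) -‿cong {n}

  det-expand : ∀ {n} (M : Matrix ℤ (suc n)) →
    det M ≡ sum (λ j → sgn j * (M zero j * det (cut (M ∘ suc) j)))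
  det-expand M = altSum≡sum (λ j → M zero j * detℤ (Det.minor ℤ-ops M j))

module _ where
  private
    -- The sum over ordered pairs of distinct columns that arises when two rows are expanded.
    pairSum : ∀ {m} → V (suc m) → V (suc m) → (Fin (suc m) → Fin m → ℤ) → ℤ
    pairSum x y K = sum (λ j → sgn j * (x j * sum (λ k → sgn k * (y (punchIn j k) * K j k))))

    -- `K j k` belongs to column `j` and the `k`-th of the remaining columns; the condition is that
    -- it depends on the unordered pair of columns only. The recursion treats the pairs that contain
    -- column zero and then deletes that column.
    Symmetric : ∀ {m} → (Fin (suc m) → Fin m → ℤ) → Set
    Symmetric {zero}  K = ⊤
    Symmetric {suc m} K = (∀ k → K zero k ≡ K (suc k) zero) × Symmetric (λ j k → K (suc j) (suc k))

    -- The part of a double expansion in which one of the two columns is column zero.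
    edge : ∀ {m} → V (suc (suc m)) → (Fin (suc (suc m)) → Fin (suc m) → ℤ) → ℤ
    edge y K = sum (λ k → sgn k * (y (suc k) * K zero k))

    pairSum-split : ∀ {m} (x y : V (suc (suc m))) K → Symmetric K →
      pairSum x y K ≡ x zero * edge y K - y zero * edge x K
                      + pairSum (x ∘ suc) (y ∘ suc) (λ j k → K (suc j) (suc k))
    pairSum-split {m} x y K (s , _) = begin
      pairSum x y K
        ≡⟨ sum-∷ (λ j → sgn j * (x j * sum (λ k → sgn k * (y (punchIn j k) * K j k)))) ⟩
      + 1 * (x zero * edge y K) +
        sum (λ j → - sgn j * (x (suc j) * sum (λ k → sgn k * (y (punchIn (suc j) k) * K (suc j) k))))
        ≡⟨ cong₂ _+_ (ℤₚ.*-identityˡ (x zero * edge y K)) (sum-cong step) ⟩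
      x zero * edge y K + sum (λ j → - y zero * (sgn j * (x (suc j) * K zero j)) + rest j)
        ≡⟨ cong (_+_ (x zero * edge y K)) (sum-+ (λ j → - y zero * (sgn j * (x (suc j) * K zero j))) rest) ⟩
      x zero * edge y K + (sum (λ j → - y zero * (sgn j * (x (suc j) * K zero j))) + sum rest)
        ≡⟨ cong (λ t → x zero * edge y K + (t + sum rest)) (sum-* (- y zero) (λ j → sgn j * (x (suc j) * K zero j))) ⟩
      x zero * edge y K + (- y zero * edge x K + sum rest)
        ≡⟨ fin (x zero * edge y K) (y zero) (edge x K) (sum rest) ⟩
      x zero * edge y K - y zero * edge x K + sum rest
        ∎
      where
      rest : V (suc m)
      rest j = sgn j * (x (suc j) * sum (λ k → sgn k * (y (suc (punchIn j k)) * K (suc j) (suc k))))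
      fin : ∀ a b c d → a + (- b * c + d) ≡ a - b * c + d
      fin = solve-∀
      lem : ∀ s x y K t → - s * (x * (+ 1 * (y * K) + - + 1 * t)) ≡ - y * (s * (x * K)) + s * (x * t)
      lem = solve-∀
      lem₂ : ∀ a b → - a * b ≡ - + 1 * (a * b)
      lem₂ = solve-∀
      step : ∀ j → - sgn j * (x (suc j) * sum (λ k → sgn k * (y (punchIn (suc j) k) * K (suc j) k)))
                   ≡ - y zero * (sgn j * (x (suc j) * K zero j)) + rest j
      step j = begin
        - sgn j * (x (suc j) * sum (λ k → sgn k * (y (punchIn (suc j) k) * K (suc j) k)))
          ≡⟨ cong (λ t → - sgn j * (x (suc j) * t)) (begin
               sum (λ k → sgn k * (y (punchIn (suc j) k) * K (suc j) k))
                 ≡⟨ sum-∷ (λ k → sgn k * (y (punchIn (suc j) k) * K (suc j) k)) ⟩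
               + 1 * (y zero * K (suc j) zero) + sum (λ k → - sgn k * (y (suc (punchIn j k)) * K (suc j) (suc k)))
                 ≡⟨ cong₂ _+_ (cong (λ t → + 1 * (y zero * t)) (sym (s j)))
                      (trans (sum-cong (λ k → lem₂ (sgn k) (y (suc (punchIn j k)) * K (suc j) (suc k))))
                             (sum-* (- + 1) (λ k → sgn k * (y (suc (punchIn j k)) * K (suc j) (suc k))))) ⟩
               + 1 * (y zero * K zero j) + - + 1 * sum (λ k → sgn k * (y (suc (punchIn j k)) * K (suc j) (suc k)))
                 ∎) ⟩
        - sgn j * (x (suc j) * (+ 1 * (y zero * K zero j)
                                + - + 1 * sum (λ k → sgn k * (y (suc (punchIn j k)) * K (suc j) (suc k)))))
          ≡⟨ lem (sgn j) (x (suc j)) (y zero) (K zero j) (sum (λ k → sgn k * (y (suc (punchIn j k)) * K (suc j) (suc k)))) ⟩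
        - y zero * (sgn j * (x (suc j) * K zero j)) + rest j
          ∎

    pairSum-antisym : ∀ {m} (x y : V (suc m)) K → Symmetric K → pairSum x y K ≡ - pairSum y x K
    pairSum-antisym {zero} x y K _ = trans (vanish x y) (-‿cong (sym (vanish y x)))
      where
      vanish : ∀ x y → pairSum x y K ≡ + 0
      vanish x y = sum-0 (λ j → trans (cong (λ t → sgn j * (x j * t)) (sum-[] _)) (lem (sgn j) (x j)))
        where
        lem : ∀ a b → a * (b * + 0) ≡ + 0
        lem = solve-∀
    pairSum-antisym {suc m} x y K sy = begin
      pairSum x y K
        ≡⟨ pairSum-split x y K sy ⟩
      x zero * edge y K - y zero * edge x K + pairSum (x ∘ suc) (y ∘ suc) (λ j k → K (suc j) (suc k))
        ≡⟨ cong (_+_ (x zero * edge y K - y zero * edge x K)) (pairSum-antisym (x ∘ suc) (y ∘ suc) _ (proj₂ sy)) ⟩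
      x zero * edge y K - y zero * edge x K - pairSum (y ∘ suc) (x ∘ suc) (λ j k → K (suc j) (suc k))
        ≡⟨ lem (x zero * edge y K) (y zero * edge x K) _ ⟩
      - (y zero * edge x K - x zero * edge y K + pairSum (y ∘ suc) (x ∘ suc) (λ j k → K (suc j) (suc k)))
        ≡⟨ -‿cong (sym (pairSum-split y x K sy)) ⟩
      - pairSum y x K
        ∎
      where
      lem : ∀ a b c → a - b - c ≡ - (b - a + c)
      lem = solve-∀

    -- Deleting two columns leaves the same columns in either order; `H` stands for a function of
    -- the enumeration of what remains, here a minor.
    symmetric-punchIn : ∀ {m} (H : (Fin m → Fin (suc (suc m))) → ℤ) →
      (∀ {f g} → f ≗ g → H f ≡ H g) → Symmetric (λ j k → H (λ c → punchIn j (punchIn k c)))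
    symmetric-punchIn {zero}  H ext = (λ _ → ext (λ ())) , tt
    symmetric-punchIn {suc m} H ext = (λ _ → refl) , subst-sym (symmetric-punchIn H′ ext′)
      where
      H′ : (Fin m → Fin (suc (suc m))) → ℤ
      H′ f = H (Fin.lift 1 f)
      ext′ : ∀ {f g} → f ≗ g → H′ f ≡ H′ g
      ext′ h = ext (λ { zero → refl ; (suc c) → cong suc (h c) })
      symmetric-resp : ∀ {m} {K L : Fin (suc m) → Fin m → ℤ} → (∀ j k → K j k ≡ L j k) → Symmetric K → Symmetric L
      symmetric-resp {zero}  h s = tt
      symmetric-resp {suc m} h (s , t) =
        (λ k → trans (sym (h zero k)) (trans (s k) (h (suc k) zero))) ,
        symmetric-resp (λ j k → h (suc j) (suc k)) t
      subst-sym : Symmetric (λ j k → H′ (λ c → punchIn j (punchIn k c))) →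
                  Symmetric (λ j k → H (λ c → punchIn (suc j) (punchIn (suc k) c)))
      subst-sym = symmetric-resp (λ j k →
        ext {f = Fin.lift 1 (λ c → punchIn j (punchIn k c))} {g = λ c → punchIn (suc j) (punchIn (suc k) c)} (λ { zero → refl ; (suc c) → refl }))

  det-expand₂ : ∀ {n} x y (R : Fin n → V (suc (suc n))) →
    det (x ◂ y ◂ R) ≡ pairSum x y (λ j k → det (cut (cut R j) k))
  det-expand₂ x y R = trans (det-expand (x ◂ y ◂ R))
    (sum-cong (λ j → cong (λ t → sgn j * (x j * t)) (det-expand (cut (y ◂ R) j))))

  det-swap : ∀ {n} x y (R : Fin n → V (suc (suc n))) → det (x ◂ y ◂ R) ≡ - det (y ◂ x ◂ R)
  det-swap x y R = begin
    det (x ◂ y ◂ R)                                     ≡⟨ det-expand₂ x y R ⟩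
    pairSum x y (λ j k → det (cut (cut R j) k))         ≡⟨ pairSum-antisym x y _ (symmetric-punchIn H H-ext) ⟩
    - pairSum y x (λ j k → det (cut (cut R j) k))       ≡⟨ -‿cong (sym (det-expand₂ y x R)) ⟩
    - det (y ◂ x ◂ R)                                   ∎
    where
    H : (Fin _ → Fin _) → ℤ
    H f = det (λ i c → R i (f c))
    H-ext : ∀ {f g} → f ≗ g → H f ≡ H g
    H-ext h = det-cong (λ i c → cong (R i) (h c))

neg-self : ∀ a → a ≡ - a → a ≡ + 0
neg-self (+ zero) _ = refl
neg-self (+ suc n) ()
neg-self -[1+ n ] ()

-- By induction, row `k` moves to the top of every minor of the expansion along row zero; one swap
-- of the two top rows then brings it to the front and contributes the last sign.
det-toFront : ∀ {n} k (M : Matrix ℤ (suc n)) → det M ≡ sgn k * det (M k ◂ (M ∘ punchIn k))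
det-toFront zero M = trans (det-cong (λ { zero j → refl ; (suc i) j → refl })) (sym (ℤₚ.*-identityˡ _))
det-toFront {suc n} (suc k) M = begin
  det M
    ≡⟨ det-expand M ⟩
  sum (λ j → sgn j * (M zero j * det (cut (M ∘ suc) j)))
    ≡⟨ sum-cong (λ j → trans (cong (λ t → sgn j * (M zero j * t)) (front j)) (lem (sgn j) (M zero j) (sgn k) (minor j))) ⟩
  sum (λ j → sgn k * (sgn j * (M zero j * minor j)))
    ≡⟨ sum-* (sgn k) (λ j → sgn j * (M zero j * minor j)) ⟩
  sgn k * sum (λ j → sgn j * (M zero j * minor j))
    ≡⟨ cong (sgn k *_) (sym (det-expand (M zero ◂ rows))) ⟩
  sgn k * det (M zero ◂ rows)
    ≡⟨ cong (sgn k *_) (trans (det-cong (λ { zero j → refl ; (suc zero) j → refl ; (suc (suc i)) j → refl }))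
                              (det-swap (M zero) (M (suc k)) (λ i → M (suc (punchIn k i))))) ⟩
  sgn k * - det (M (suc k) ◂ M zero ◂ (λ i → M (suc (punchIn k i))))
    ≡⟨ lem₂ (sgn k) _ ⟩
  - sgn k * det (M (suc k) ◂ M zero ◂ (λ i → M (suc (punchIn k i))))
    ≡⟨ cong (- sgn k *_) (det-cong (λ { zero j → refl ; (suc zero) j → refl ; (suc (suc i)) j → refl })) ⟩
  - sgn k * det (M (suc k) ◂ (M ∘ punchIn (suc k)))
    ∎
  where
  rows : Fin (suc n) → V (suc (suc n))
  rows = M (suc k) ◂ (λ i → M (suc (punchIn k i)))
  minor : Fin (suc (suc n)) → ℤ
  minor j = det (cut rows j)
  front : ∀ j → det (cut (M ∘ suc) j) ≡ sgn k * minor j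
  front j = trans (det-toFront k (cut (M ∘ suc) j))
                  (cong (sgn k *_) (det-cong (λ { zero c → refl ; (suc i) c → refl })))
  lem : ∀ a b c d → a * (b * (c * d)) ≡ c * (a * (b * d))
  lem = solve-∀
  lem₂ : ∀ a b → a * - b ≡ - a * b
  lem₂ = solve-∀

-- Once the second copy is moved to the top of all minors, the two top rows agree, and swapping them
-- shows that the determinant is its own negative.
det-repeated : ∀ {n} (R : Fin n → V (suc n)) i → det (R i ◂ R) ≡ + 0
det-repeated {suc n} R i = begin
  det (R i ◂ R)
    ≡⟨ det-expand (R i ◂ R) ⟩
  sum (λ j → sgn j * (R i j * det (cut R j)))
    ≡⟨ sum-cong (λ j → trans (cong (λ t → sgn j * (R i j * t)) (front j)) (lem (sgn j) (R i j) (sgn i) (det (cut rows j)))) ⟩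
  sum (λ j → sgn i * (sgn j * (R i j * det (cut rows j))))
    ≡⟨ sum-* (sgn i) (λ j → sgn j * (R i j * det (cut rows j))) ⟩
  sgn i * sum (λ j → sgn j * (R i j * det (cut rows j)))
    ≡⟨ cong (sgn i *_) (trans (sym (det-expand (R i ◂ rows))) (neg-self _ (det-swap (R i) (R i) (R ∘ punchIn i)))) ⟩
  sgn i * + 0
    ≡⟨ ℤₚ.*-zeroʳ (sgn i) ⟩
  + 0
    ∎
  where
  rows : Fin (suc n) → V (suc (suc n))
  rows = R i ◂ (R ∘ punchIn i)
  front : ∀ j → det (cut R j) ≡ sgn i * det (cut rows j)
  front j = trans (det-toFront i (cut R j)) (cong (sgn i *_) (det-cong (λ { zero c → refl ; (suc i) c → refl })))
  lem : ∀ a b c d → a * (b * (c * d)) ≡ c * (a * (b * d))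
  lem = solve-∀

-- Cofactors, transposition and row replacement

cof : ∀ {n} → Matrix ℤ n → Fin n → V n
cof {suc n} M k j = sgn k * (sgn j * det (cut (M ∘ punchIn k) j))

cof-front : ∀ {n} (M : Matrix ℤ (suc n)) k v → v ∙ cof M k ≡ sgn k * det (v ◂ (M ∘ punchIn k))
cof-front M k v = begin
  v ∙ cof M k
    ≡⟨ ∙-def v (cof M k) ⟩
  sum (λ j → v j * (sgn k * (sgn j * det (cut (M ∘ punchIn k) j))))
    ≡⟨ sum-cong (λ j → lem (v j) (sgn k) (sgn j) (det (cut (M ∘ punchIn k) j))) ⟩
  sum (λ j → sgn k * (sgn j * (v j * det (cut (M ∘ punchIn k) j))))
    ≡⟨ sum-* (sgn k) (λ j → sgn j * (v j * det (cut (M ∘ punchIn k) j))) ⟩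
  sgn k * sum (λ j → sgn j * (v j * det (cut (M ∘ punchIn k) j)))
    ≡⟨ cong (sgn k *_) (sym (det-expand (v ◂ (M ∘ punchIn k)))) ⟩
  sgn k * det (v ◂ (M ∘ punchIn k))
    ∎
  where
  lem : ∀ a b c d → a * (b * (c * d)) ≡ b * (c * (a * d))
  lem = solve-∀

-- The cofactors of row `k` do not involve that row, so one vector serves all matrices that differ
-- from `M` only there.
det-cof : ∀ {n} (M N : Matrix ℤ n) k → (∀ i → i ≢ k → N i ≗ M i) → det N ≡ N k ∙ cof M k
det-cof {suc n} M N k h = begin
  det N                                      ≡⟨ det-toFront k N ⟩
  sgn k * det (N k ◂ (N ∘ punchIn k))        ≡⟨ cong (sgn k *_) (det-cong (λ { zero j → refl ; (suc i) → h (punchIn k i) (Finₚ.punchInᵢ≢i k i) })) ⟩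
  sgn k * det (N k ◂ (M ∘ punchIn k))        ≡⟨ sym (cof-front M k (N k)) ⟩
  N k ∙ cof M k                              ∎

cof-other : ∀ {n} (M : Matrix ℤ n) {i k} → i ≢ k → M i ∙ cof M k ≡ + 0
cof-other {suc n} M {i} {k} i≢k = begin
  M i ∙ cof M k                              ≡⟨ cof-front M k (M i) ⟩
  sgn k * det (M i ◂ (M ∘ punchIn k))        ≡⟨ cong (λ l → sgn k * det (M l ◂ (M ∘ punchIn k))) (sym (Finₚ.punchIn-punchOut k≢i)) ⟩
  sgn k * det (M (punchIn k (punchOut k≢i)) ◂ (M ∘ punchIn k))
                                             ≡⟨ cong (sgn k *_) (det-repeated (M ∘ punchIn k) (punchOut k≢i)) ⟩
  sgn k * + 0                                ≡⟨ ℤₚ.*-zeroʳ (sgn k) ⟩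
  + 0                                        ∎
  where
  k≢i : k ≢ i
  k≢i = i≢k ∘ sym

cof-δ : ∀ {n} (M : Matrix ℤ n) i k → M i ∙ cof M k ≡ det M * δ i k
cof-δ M i k with i ≟ k
... | yes refl = trans (sym (det-cof M M i (λ _ _ _ → refl))) (sym (ℤₚ.*-identityʳ (det M)))
... | no  i≢k  = trans (cof-other M i≢k) (sym (ℤₚ.*-zeroʳ (det M)))

private
  -- Expanding along row zero, and the resulting minors along column zero, gives a corner term and a
  -- double sum over entries of both. Transposition merely exchanges the two summations; the smaller
  -- determinants need the induction hypothesis at two sizes.
  module Transpose {n}
    (ih₁ : ∀ (M : Matrix ℤ (suc n)) → det (transpose M) ≡ det M)
    (ih₀ : ∀ (M : Matrix ℤ n) → det (transpose M) ≡ det M) where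
    inner : Matrix ℤ (suc (suc n)) → Fin (suc n) → Fin (suc n) → Matrix ℤ n
    inner M i j b a = M (suc (punchIn i b)) (suc (punchIn j a))
    corner : Matrix ℤ (suc (suc n)) → ℤ
    corner M = M zero zero * det (λ i j → M (suc i) (suc j))
    term : Matrix ℤ (suc (suc n)) → Fin (suc n) → Fin (suc n) → ℤ
    term M j i = - sgn j * (M zero (suc j) * (sgn i * (M (suc i) zero * det (inner M i j))))
    swapped : ∀ M i j → term (transpose M) i j ≡ term M j i
    swapped M i j = trans (cong (λ t → - sgn i * (M (suc i) zero * (sgn j * (M zero (suc j) * t)))) (ih₀ (inner M i j)))
                        (lem (sgn i) (M (suc i) zero) (sgn j) (M zero (suc j)) (det (inner M i j)))
      where
      lem : ∀ a b c d e → - a * (b * (c * (d * e))) ≡ - c * (d * (a * (b * e)))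
      lem = solve-∀
    minor : ∀ (M : Matrix ℤ (suc (suc n))) j →
      det (cut (M ∘ suc) (suc j)) ≡ sum (λ i → sgn i * (M (suc i) zero * det (inner M i j)))
    minor M j = begin
      det (cut (M ∘ suc) (suc j))              ≡⟨ sym (ih₁ (cut (M ∘ suc) (suc j))) ⟩
      det (transpose (cut (M ∘ suc) (suc j)))  ≡⟨ det-expand (transpose (cut (M ∘ suc) (suc j))) ⟩
      sum (λ i → sgn i * (M (suc i) zero * det (transpose (inner M i j))))
        ≡⟨ sum-cong (λ i → cong (λ t → sgn i * (M (suc i) zero * t)) (ih₀ (inner M i j))) ⟩
      sum (λ i → sgn i * (M (suc i) zero * det (inner M i j))) ∎
    expand : ∀ (M : Matrix ℤ (suc (suc n))) → det M ≡ corner M + sum (λ j → sum (term M j))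
    expand M = begin
      det M
        ≡⟨ trans (det-expand M) (sum-∷ (λ j → sgn j * (M zero j * det (cut (M ∘ suc) j)))) ⟩
      + 1 * corner M + sum (λ j → - sgn j * (M zero (suc j) * det (cut (M ∘ suc) (suc j))))
        ≡⟨ cong₂ _+_ (ℤₚ.*-identityˡ (corner M)) (sum-cong (λ j → begin
             - sgn j * (M zero (suc j) * det (cut (M ∘ suc) (suc j)))
               ≡⟨ cong (λ t → - sgn j * (M zero (suc j) * t)) (minor M j) ⟩
             - sgn j * (M zero (suc j) * sum (λ i → sgn i * (M (suc i) zero * det (inner M i j))))
               ≡⟨ cong (- sgn j *_) (sym (sum-* (M zero (suc j)) (λ i → sgn i * (M (suc i) zero * det (inner M i j))))) ⟩
             - sgn j * sum (λ i → M zero (suc j) * (sgn i * (M (suc i) zero * det (inner M i j))))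
               ≡⟨ sym (sum-* (- sgn j) (λ i → M zero (suc j) * (sgn i * (M (suc i) zero * det (inner M i j))))) ⟩
             sum (term M j) ∎)) ⟩
      corner M + sum (λ j → sum (term M j)) ∎

    step : ∀ M → det (transpose M) ≡ det M
    step M = begin
      det (transpose M)      ≡⟨ expand (transpose M) ⟩
      corner (transpose M) + sum (λ i → sum (λ j → term (transpose M) i j))
        ≡⟨ cong₂ _+_ (cong (M zero zero *_) (ih₁ (λ i j → M (suc i) (suc j))))
                     (trans (sum-swap (term (transpose M))) (sum-cong (λ j → sum-cong (λ i → swapped M i j)))) ⟩
      corner M + sum (λ j → sum (λ i → term M j i))
                             ≡⟨ sym (expand M) ⟩
      det M                  ∎

det-transpose : ∀ {n} (M : Matrix ℤ n) → det (transpose M) ≡ det M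
det-transpose {zero} M = trans (det-[] (transpose M)) (sym (det-[] M))
det-transpose {suc zero} M = det-cong (λ { zero zero → refl })
det-transpose {suc (suc n)} M = Transpose.step (det-transpose {suc n}) (det-transpose {n}) M

hybrid : ∀ {n} → Matrix ℤ n → Matrix ℤ n → ℕ → Matrix ℤ n
hybrid R R′ s i = if ⌊ toℕ i ℕ.<? s ⌋ then R i else R′ i

hybrid-< : ∀ {n} (R R′ : Matrix ℤ n) {s i} → toℕ i ℕ.< s → hybrid R R′ s i ≡ R i
hybrid-< R R′ {s} {i} h with toℕ i ℕ.<? s
... | yes _ = refl
... | no ¬h = ⊥-elim (¬h h)

hybrid-≥ : ∀ {n} (R R′ : Matrix ℤ n) {s i} → s ≤ toℕ i → hybrid R R′ s i ≡ R′ i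
hybrid-≥ R R′ {s} {i} h with toℕ i ℕ.<? s
... | yes h′ = ⊥-elim (ℕₚ.<-irrefl refl (ℕₚ.<-≤-trans h′ h))
... | no  _  = refl

-- Rows of `R′` are exchanged for rows of `R` one at a time, each exchange contributing a factor
-- `c`. The vector `γ` stands for the cofactors of the exchanged row, which annihilate all earlier
-- rows of `R`; so `c * R′ k` and `R k` have to agree only modulo those earlier rows.
det-hybrid : ∀ {n} (R R′ : Matrix ℤ n) c q →
  (∀ k γ → q ≤ toℕ k → (∀ i → toℕ i ℕ.< toℕ k → R i ∙ γ ≡ + 0) → c * (R′ k ∙ γ) ≡ R k ∙ γ) →
  ∀ h → h ℕ.+ q ≤ n → det (hybrid R R′ (h ℕ.+ q)) ≡ c ℤ.^ h * det (hybrid R R′ q)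
det-hybrid R R′ c q step zero le = sym (ℤₚ.*-identityˡ (det (hybrid R R′ q)))
det-hybrid {n} R R′ c q step (suc h) le = begin
  det N                                 ≡⟨ det-cof M N k off ⟩
  N k ∙ γ                               ≡⟨ cong (_∙ γ) (hybrid-< R R′ (ℕₚ.≤-reflexive (cong suc k≡s))) ⟩
  R k ∙ γ                               ≡⟨ sym (step k γ (subst (q ≤_) (sym k≡s) (ℕₚ.m≤n+m q h)) kills) ⟩
  c * (R′ k ∙ γ)                        ≡⟨ cong (λ v → c * (v ∙ γ)) (sym (hybrid-≥ R R′ (ℕₚ.≤-reflexive (sym k≡s)))) ⟩
  c * (M k ∙ γ)                         ≡⟨ cong (c *_) (sym (det-cof M M k (λ _ _ _ → refl))) ⟩
  c * det M                             ≡⟨ cong (c *_) (det-hybrid R R′ c q step h (ℕₚ.<⇒≤ le)) ⟩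
  c * (c ℤ.^ h * det (hybrid R R′ q))   ≡⟨ sym (ℤₚ.*-assoc c (c ℤ.^ h) (det (hybrid R R′ q))) ⟩
  c * c ℤ.^ h * det (hybrid R R′ q)     ∎
  where
  s = h ℕ.+ q
  M = hybrid R R′ s
  N = hybrid R R′ (suc s)
  k : Fin n
  k = fromℕ< le
  k≡s : toℕ k ≡ s
  k≡s = Finₚ.toℕ-fromℕ< le
  γ = cof M k
  off : ∀ i → i ≢ k → N i ≗ M i
  off i i≢k j with ℕₚ.<-cmp (toℕ i) s
  ... | tri< lt _ _ = cong (λ v → v j) (trans (hybrid-< R R′ (ℕₚ.<-trans lt (ℕₚ.n<1+n s))) (sym (hybrid-< R R′ lt)))
  ... | tri≈ _ eq _ = ⊥-elim (i≢k (Finₚ.toℕ-injective (trans eq (sym k≡s))))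
  ... | tri> _ _ gt = cong (λ v → v j) (trans (hybrid-≥ R R′ gt) (sym (hybrid-≥ R R′ (ℕₚ.<⇒≤ gt))))
  kills : ∀ i → toℕ i ℕ.< toℕ k → R i ∙ γ ≡ + 0
  kills i lt = trans (cong (_∙ γ) (sym (hybrid-< R R′ (subst (toℕ i ℕ.<_) k≡s lt))))
                     (cof-other M (λ { refl → ℕₚ.<-irrefl refl lt }))

opaque
  unfolding det
  det-mod : ∀ {n d} {M N : Matrix ℤ n} → (∀ i j → d ∣ M i j - N i j) → d ∣ det M - det N
  det-mod {n} {d} = Parametricity.det-~ ℤ-ops ℤ-ops (λ a b → d ∣ a - b)
    (divides (+ 0) refl) (divides (+ 0) refl)
    (λ {a} {a′} {b} {b′} p q → subst (d ∣_) (lem₁ a a′ b b′) (∣m∣n⇒∣m+n p q))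
    (λ {a} {a′} {b} {b′} p q → subst (d ∣_) (lem₂ a a′ b b′) (∣m∣n⇒∣m+n (∣n⇒∣m*n b p) (∣n⇒∣m*n a′ q)))
    (λ {a} {a′} p → subst (d ∣_) (lem₃ a a′) (∣m⇒∣-m p)) {n}
    where
    lem₁ : ∀ a a′ b b′ → a - a′ + (b - b′) ≡ a + b - (a′ + b′)
    lem₁ = solve-∀
    lem₂ : ∀ a a′ b b′ → b * (a - a′) + a′ * (b - b′) ≡ a * b - a′ * b′
    lem₂ = solve-∀
    lem₃ : ∀ a a′ → - (a - a′) ≡ - a - - a′
    lem₃ = solve-∀

det-scale : ∀ {n} c (M : Matrix ℤ n) → det (λ i j → c * M i j) ≡ c ℤ.^ n * det M
det-scale {zero} c M = trans (det-[] (λ i j → c * M i j)) (sym (trans (ℤₚ.*-identityˡ (det M)) (det-[] M)))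
det-scale {suc n} c M = begin
  det (λ i j → c * M i j)
    ≡⟨ det-expand (λ i j → c * M i j) ⟩
  sum (λ j → sgn j * (c * M zero j * det (λ i k → c * cut (M ∘ suc) j i k)))
    ≡⟨ sum-cong (λ j → trans (cong (λ t → sgn j * (c * M zero j * t)) (det-scale c (cut (M ∘ suc) j)))
                             (lem (sgn j) c (M zero j) (c ℤ.^ n) (det (cut (M ∘ suc) j)))) ⟩
  sum (λ j → c * c ℤ.^ n * (sgn j * (M zero j * det (cut (M ∘ suc) j))))
    ≡⟨ sum-* (c * c ℤ.^ n) (λ j → sgn j * (M zero j * det (cut (M ∘ suc) j))) ⟩
  c * c ℤ.^ n * sum (λ j → sgn j * (M zero j * det (cut (M ∘ suc) j)))
    ≡⟨ cong (c * c ℤ.^ n *_) (sym (det-expand M)) ⟩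
  c * c ℤ.^ n * det M
    ∎
  where
  lem : ∀ s c m p d → s * (c * m * (p * d)) ≡ c * p * (s * (m * d))
  lem = solve-∀

det-corner : ∀ {n} (M : Matrix ℤ (suc n)) → M zero zero ≡ + 1 → (∀ j → M zero (suc j) ≡ + 0) →
  det M ≡ det (λ i j → M (suc i) (suc j))
det-corner M h₁ h₀ = begin
  det M
    ≡⟨ det-expand M ⟩
  sum (λ j → sgn j * (M zero j * det (cut (M ∘ suc) j)))
    ≡⟨ sum-single zero (λ j → sgn j * (M zero j * det (cut (M ∘ suc) j))) vanish ⟩
  + 1 * (M zero zero * det (cut (M ∘ suc) zero))
    ≡⟨ cong (λ t → + 1 * (t * det (cut (M ∘ suc) zero))) h₁ ⟩
  + 1 * (+ 1 * det (cut (M ∘ suc) zero))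
    ≡⟨ lem₁ (det (cut (M ∘ suc) zero)) ⟩
  det (λ i j → M (suc i) (suc j))
    ∎
  where
  lem₁ : ∀ a → + 1 * (+ 1 * a) ≡ a
  lem₁ = solve-∀
  lem₀ : ∀ a b → a * (+ 0 * b) ≡ + 0
  lem₀ = solve-∀
  vanish : ∀ j → j ≢ zero → sgn j * (M zero j * det (cut (M ∘ suc) j)) ≡ + 0
  vanish zero    h = ⊥-elim (h refl)
  vanish (suc j) h = trans (cong (λ t → sgn (suc j) * (t * det (cut (M ∘ suc) (suc j)))) (h₀ j))
                           (lem₀ (sgn (suc j)) (det (cut (M ∘ suc) (suc j))))

δ-suc : ∀ {n} (i j : Fin n) → δ (suc i) (suc j) ≡ δ i j
δ-suc i j with i ≟ j
... | yes _ = refl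
... | no  _ = refl

det-δ : ∀ n → det (δ {n}) ≡ + 1
det-δ zero    = det-[] δ
det-δ (suc n) = trans (det-corner δ refl (λ _ → refl)) (trans (det-cong δ-suc) (det-δ n))

-- `u` is adj(A) b, and the two claims are Cramer's rule and the matrix determinant lemma. Both come
-- from the bordered matrix with a free top row `v` above (b | A), whose determinant is v₀ det A -
-- v·u: a repeated row gives the first, the top row (1, r) the second.
rank-one : ∀ {n} (A : Matrix ℤ n) b → Σ (V n) λ u →
  mv A u ≗ det A ⊛ b × (∀ r → det (λ i j → A i j - b i * r j) ≡ det A - r ∙ u)
rank-one {n} A b = u , solution , update
  where
  R : Fin n → V (suc n)
  R i = b i ◂ A i
  u : V n
  u j = sgn j * det (cut R (suc j))
  bordered : ∀ v → det (v ◂ R) ≡ v zero * det A - (v ∘ suc) ∙ u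
  bordered v = begin
    det (v ◂ R)
      ≡⟨ trans (det-expand (v ◂ R)) (sum-∷ (λ j → sgn j * (v j * det (cut R j)))) ⟩
    + 1 * (v zero * det A) + sum (λ j → - sgn j * (v (suc j) * det (cut R (suc j))))
      ≡⟨ cong₂ _+_ (ℤₚ.*-identityˡ (v zero * det A)) (sum-cong (λ j → lem (sgn j) (v (suc j)) (det (cut R (suc j))))) ⟩
    v zero * det A + sum (λ j → - + 1 * (v (suc j) * u j))
      ≡⟨ cong (_+_ (v zero * det A)) (trans (sum-* (- + 1) (λ j → v (suc j) * u j)) (ℤₚ.-1*i≡-i (sum (λ j → v (suc j) * u j)))) ⟩
    v zero * det A - sum (λ j → v (suc j) * u j)
      ≡⟨ cong (λ t → v zero * det A - t) (sym (∙-def (v ∘ suc) u)) ⟩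
    v zero * det A - (v ∘ suc) ∙ u
      ∎
    where
    lem : ∀ a b c → - a * (b * c) ≡ - + 1 * (b * (a * c))
    lem = solve-∀
  solution : mv A u ≗ det A ⊛ b
  solution i = begin
    A i ∙ u                          ≡⟨ lem (b i * det A) (A i ∙ u) ⟩
    b i * det A - (b i * det A - A i ∙ u)
                                     ≡⟨ cong (λ t → b i * det A - t) (sym (bordered (R i))) ⟩
    b i * det A - det (R i ◂ R)      ≡⟨ cong (λ t → b i * det A - t) (det-repeated R i) ⟩
    b i * det A - + 0                ≡⟨ lem₂ (b i) (det A) ⟩
    det A * b i                      ∎
    where
    lem : ∀ a b → b ≡ a - (a - b)
    lem = solve-∀
    lem₂ : ∀ a b → a * b - + 0 ≡ b * a
    lem₂ = solve-∀
  module _ (r : V n) where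
    B : Matrix ℤ n
    B i j = A i j - b i * r j
    N L : Matrix ℤ (suc n)
    N = (+ 1 ◂ r) ◂ R
    L = (+ 1 ◂ r) ◂ (λ i → + 0 ◂ B i)
    -- Clearing column zero below the row (1, r) turns the block A into A - b rᵀ; the factor of each
    -- replacement is 1.
    rowop : ∀ k γ → 0 ≤ toℕ k → (∀ i → toℕ i ℕ.< toℕ k → N i ∙ γ ≡ + 0) → + 1 * (L k ∙ γ) ≡ N k ∙ γ
    rowop zero    γ _ _ = ℤₚ.*-identityˡ (N zero ∙ γ)
    rowop (suc k) γ _ h = begin
      + 1 * (L (suc k) ∙ γ)
        ≡⟨ ℤₚ.*-identityˡ (L (suc k) ∙ γ) ⟩
      L (suc k) ∙ γ
        ≡⟨ ∙-congˡ γ (λ { zero → lem₀ (b k) ; (suc j) → lem₁ (A k j) (b k) (r j) }) ⟩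
      (N (suc k) ⊕ (- b k) ⊛ N zero) ∙ γ
        ≡⟨ trans (∙-⊕ (N (suc k)) ((- b k) ⊛ N zero) γ) (cong (_+_ (N (suc k) ∙ γ)) (∙-⊛ (- b k) (N zero) γ)) ⟩
      N (suc k) ∙ γ + - b k * (N zero ∙ γ)
        ≡⟨ cong (λ t → N (suc k) ∙ γ + - b k * t) (h zero (s≤s z≤n)) ⟩
      N (suc k) ∙ γ + - b k * + 0
        ≡⟨ lem₂ (N (suc k) ∙ γ) (b k) ⟩
      N (suc k) ∙ γ
        ∎
      where
      lem₀ : ∀ b → + 0 ≡ b + - b * + 1
      lem₀ = solve-∀
      lem₁ : ∀ a b r → a - b * r ≡ a + - b * r
      lem₁ = solve-∀
      lem₂ : ∀ a b → a + - b * + 0 ≡ a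
      lem₂ = solve-∀
    update : det B ≡ det A - r ∙ u
    update = begin
      det B                       ≡⟨ sym (det-transpose B) ⟩
      det (transpose B)           ≡⟨ sym (det-corner (transpose L) refl (λ _ → refl)) ⟩
      det (transpose L)           ≡⟨ det-transpose L ⟩
      det L                       ≡⟨ det-cong (λ i j → cong (λ v → v j) (sym (hybrid-≥ N L {0} {i} z≤n))) ⟩
      det (hybrid N L 0)          ≡⟨ sym (ℤₚ.*-identityˡ (det (hybrid N L 0))) ⟩
      + 1 * det (hybrid N L 0)    ≡⟨ cong (_* det (hybrid N L 0)) (sym (ℤₚ.^-zeroˡ (suc n))) ⟩
      (+ 1) ℤ.^ suc n * det (hybrid N L 0)
                                  ≡⟨ sym (det-hybrid N L (+ 1) 0 rowop (suc n) (ℕₚ.≤-reflexive (ℕₚ.+-identityʳ (suc n)))) ⟩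
      det (hybrid N L (suc n ℕ.+ 0))
                                  ≡⟨ det-cong (λ i j → cong (λ v → v j) (hybrid-< N L {suc n ℕ.+ 0} {i}
                                       (ℕₚ.<-≤-trans (Finₚ.toℕ<n i) (ℕₚ.m≤m+n (suc n) 0)))) ⟩
      det N                       ≡⟨ bordered (+ 1 ◂ r) ⟩
      + 1 * det A - r ∙ u         ≡⟨ cong (λ t → t - r ∙ u) (ℤₚ.*-identityˡ (det A)) ⟩
      det A - r ∙ u               ∎

-- Characteristic polynomials and walk counts

eval : Poly → ℤ → ℤ
eval []      x = + 0
eval (a ∷ p) x = a + x * eval p x

eval-+ : ∀ p q x → eval (p +P q) x ≡ eval p x + eval q x
eval-+ []      q       x = sym (ℤₚ.+-identityˡ (eval q x))
eval-+ (a ∷ p) []      x = sym (ℤₚ.+-identityʳ (eval (a ∷ p) x))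
eval-+ (a ∷ p) (b ∷ q) x = trans (cong (λ t → a + b + x * t) (eval-+ p q x)) (lem a b x (eval p x) (eval q x))
  where
  lem : ∀ a b x p q → a + b + x * (p + q) ≡ a + x * p + (b + x * q)
  lem = solve-∀

eval-neg : ∀ p x → eval (negP p) x ≡ - eval p x
eval-neg []      x = refl
eval-neg (a ∷ p) x = trans (cong (λ t → - a + x * t) (eval-neg p x)) (lem a x (eval p x))
  where
  lem : ∀ a x p → - a + x * - p ≡ - (a + x * p)
  lem = solve-∀

eval-scale : ∀ c p x → eval (scaleP c p) x ≡ c * eval p x
eval-scale c []      x = sym (ℤₚ.*-zeroʳ c)
eval-scale c (a ∷ p) x = trans (cong (λ t → c * a + x * t) (eval-scale c p x)) (lem c a x (eval p x))
  where
  lem : ∀ c a x p → c * a + x * (c * p) ≡ c * (a + x * p)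
  lem = solve-∀

eval-* : ∀ p q x → eval (p *P q) x ≡ eval p x * eval q x
eval-* []      q x = refl
eval-* (a ∷ p) q x = begin
  eval (scaleP a q +P (+ 0 ∷ (p *P q))) x
    ≡⟨ eval-+ (scaleP a q) (+ 0 ∷ (p *P q)) x ⟩
  eval (scaleP a q) x + (+ 0 + x * eval (p *P q) x)
    ≡⟨ cong₂ (λ s t → s + (+ 0 + x * t)) (eval-scale a q x) (eval-* p q x) ⟩
  a * eval q x + (+ 0 + x * (eval p x * eval q x))
    ≡⟨ lem a x (eval p x) (eval q x) ⟩
  (a + x * eval p x) * eval q x
    ∎
  where
  lem : ∀ a x p q → a * q + (+ 0 + x * (p * q)) ≡ (a + x * p) * q
  lem = solve-∀

eval-++-0 : ∀ p x → eval (p ++ + 0 ∷ []) x ≡ eval p x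
eval-++-0 []      x = trans (ℤₚ.+-identityˡ (x * + 0)) (ℤₚ.*-zeroʳ x)
eval-++-0 (a ∷ p) x = cong (λ t → a + x * t) (eval-++-0 p x)

eval-dropWhile : ∀ {P : ℤ → Set} (P? : ∀ a → Dec (P a)) → (∀ {a} → P a → a ≡ + 0) →
  ∀ p x → eval (reverse (dropWhile P? p)) x ≡ eval (reverse p) x
eval-dropWhile P? z []      x = refl
eval-dropWhile P? z (a ∷ p) x with P? a
... | no  _  = refl
... | yes Pa = begin
  eval (reverse (dropWhile P? p)) x ≡⟨ eval-dropWhile P? z p x ⟩
  eval (reverse p) x                ≡⟨ sym (eval-++-0 (reverse p) x) ⟩
  eval (reverse p ++ + 0 ∷ []) x    ≡⟨ cong (λ t → eval (reverse p ++ t ∷ []) x) (sym (z Pa)) ⟩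
  eval (reverse p ++ a ∷ []) x      ≡⟨ cong (λ q → eval q x) (sym (Listₚ.unfold-reverse a p)) ⟩
  eval (reverse (a ∷ p)) x          ∎

eval-norm : ∀ p x → eval (normP p) x ≡ eval p x
eval-norm p x = trans (eval-dropWhile (λ a → isZeroℤ a Boolₚ.≟ true) isZero (reverse p) x)
                      (cong (λ q → eval q x) (Listₚ.reverse-involutive p))
  where
  isZero : ∀ {a} → isZeroℤ a ≡ true → a ≡ + 0
  isZero {+ zero} _ = refl

eval-≈ : ∀ {p q} → p ≈P q → ∀ x → eval p x ≡ eval q x
eval-≈ {p} {q} h x = trans (sym (eval-norm p x)) (trans (cong (λ r → eval r x) h) (eval-norm q x))

charMatrix : ∀ {n} → ℤ → Matrix ℤ n → Matrix ℤ n
charMatrix x M i j = x * δ i j - M i j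

opaque
  unfolding det
  eval-charPoly : ∀ {n} (M : Matrix ℤ n) x → eval (charPoly M) x ≡ det (charMatrix x M)
  eval-charPoly {n} M x = Parametricity.det-~ Poly-ops ℤ-ops (λ p a → eval p x ≡ a) refl one
    (λ {p} {_} {q} e f → trans (eval-+ p q x) (cong₂ _+_ e f))
    (λ {p} {_} {q} e f → trans (eval-* p q x) (cong₂ _*_ e f))
    (λ {p} e → trans (eval-neg p x) (-‿cong e)) {n} entry
    where
    one : + 1 + x * + 0 ≡ + 1
    one = trans (cong (_+_ (+ 1)) (ℤₚ.*-zeroʳ x)) refl
    lem₁ : ∀ m x → - m + x * (+ 1 + x * + 0) ≡ x * + 1 - m
    lem₁ = solve-∀
    lem₀ : ∀ m x → - m + x * + 0 ≡ x * + 0 - m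
    lem₀ = solve-∀
    entry : ∀ i j → eval (if ⌊ i ≟ j ⌋ then (- M i j) ∷ + 1 ∷ [] else (- M i j) ∷ []) x ≡ charMatrix x M i j
    entry i j with i ≟ j
    ... | yes _ = lem₁ (M i j) x
    ... | no  _ = lem₀ (M i j) x

det-charMatrix : ∀ {n} {M N : Matrix ℤ n} → Cospectral M N →
  ∀ x → det (charMatrix x M) ≡ det (charMatrix x N)
det-charMatrix {M = M} {N} h x =
  trans (sym (eval-charPoly M x)) (trans (eval-≈ {charPoly M} {charPoly N} h x) (eval-charPoly N x))

∣-small : ∀ {a b} → a ∣ b → ∣ b ∣ ℕ.< ∣ a ∣ → b ≡ + 0
∣-small {a} {b} h lt with ∣ b ∣ in eq
... | zero  = ℤₚ.∣i∣≡0⇒i≡0 eq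
... | suc m = ⊥-elim (ℕₚ.<-irrefl refl (ℕₚ.<-≤-trans lt (ℕ∣.∣⇒≤ (subst (∣ a ∣ ℕ∣.∣_) eq (∣⇒∣ᵤ h)))))

∣-all⇒0 : ∀ a → (∀ m → + suc m ∣ a) → a ≡ + 0
∣-all⇒0 a h = ∣-small (h ∣ a ∣) (ℕₚ.n<1+n ∣ a ∣)

-- If x has the sign of z and absolute value |a| + 2, then zx - 1 is larger than |a|, and its only
-- multiple of absolute value |a| or less is zero.
∣-affine⇒0 : ∀ z a → z ≢ + 0 → (∀ x → z * x - + 1 ∣ a) → a ≡ + 0
∣-affine⇒0 (+ zero)  a h _ = ⊥-elim (h refl)
∣-affine⇒0 (+ suc k) a _ h = ∣-small (h (+ (2 ℕ.+ ∣ a ∣))) (s≤s (ℕₚ.m≤m+n ∣ a ∣ (k ℕ.* (2 ℕ.+ ∣ a ∣))))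
∣-affine⇒0 -[1+ k ]  a _ h = ∣-small (h (- (+ (2 ℕ.+ ∣ a ∣)))) (s≤s (ℕₚ.m≤m+n ∣ a ∣ (k ℕ.* (2 ℕ.+ ∣ a ∣))))

-- For zx ≡ 1 the reversed polynomial det (I − zM) is zⁿ det (xI − M), so modulo zx − 1 it is
-- determined by the characteristic polynomial; and zx − 1 is unbounded.
det-reversed : ∀ {n} {M N : Matrix ℤ n} → Cospectral M N → ∀ z → z ≢ + 0 →
  det (λ i j → δ i j - z * M i j) ≡ det (λ i j → δ i j - z * N i j)
det-reversed {n} {M} {N} cosp z z≢0 = ℤₚ.i-j≡0⇒i≡j (rev M) (rev N) (∣-affine⇒0 z (rev M - rev N) z≢0 (λ x →
  subst (z * x - + 1 ∣_) (trans (cong (λ t → rev M - z ℤ.^ n * t - (rev N - z ℤ.^ n * det (charMatrix x N)))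
                                       (det-charMatrix {M = M} {N} cosp x))
                                (lem (rev M) (z ℤ.^ n * det (charMatrix x N)) (rev N)))
        (∣m∣n⇒∣m-n (close M x) (close N x))))
  where
  rev : Matrix ℤ n → ℤ
  rev M = det (λ i j → δ i j - z * M i j)
  lem : ∀ a b c → a - b - (c - b) ≡ a - c
  lem = solve-∀
  entry : ∀ d z m x → d - z * m - z * (x * d - m) ≡ - d * (z * x - + 1)
  entry = solve-∀
  close : ∀ M x → z * x - + 1 ∣ rev M - z ℤ.^ n * det (charMatrix x M)
  close M x = subst (λ t → z * x - + 1 ∣ rev M - t) (det-scale z (charMatrix x M))
    (det-mod (λ i j → divides (- δ i j) (entry (δ i j) z (M i j) x)))

-- Walk counts from determinants

pw : ∀ {n} → Matrix ℤ n → ℕ → V n → V n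
pw S zero    v = v
pw S (suc k) v = mv S (pw S k v)

𝟙 : ∀ {n} → V n
𝟙 _ = + 1

-- Put y = m + 1 and χ = det (I + yS), and let u solve (I + yS)u = χe. The numbers qₖ = e·Sᵏu
-- satisfy qₖ = χaₖ - y qₖ₊₁ with aₖ = e·Sᵏe, and y q₀ is the difference of the two given
-- determinants. If the qₖ of S and T agree for all y, then χ ≡ 1 (mod y) makes every y divide the
-- difference of the aₖ, which is therefore zero; the recursion then gives agreement of the qₖ₊₁.
walks-agree : ∀ {n} (S T : Matrix ℤ n) →
  (∀ m → det (λ i j → δ i j + + suc m * S i j) ≡ det (λ i j → δ i j + + suc m * T i j)) →
  (∀ m → det (λ i j → δ i j + + suc m * S i j - + 1 * + suc m) ≡ det (λ i j → δ i j + + suc m * T i j - + 1 * + suc m)) →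
  ∀ k → 𝟙 ∙ pw S k 𝟙 ≡ 𝟙 ∙ pw T k 𝟙
walks-agree {n} S T h₁ h₂ k = ℤₚ.i-j≡0⇒i≡j (a S k) (a T k) (diff k (claim k))
  where
  A : Matrix ℤ n → ℕ → Matrix ℤ n
  A S m i j = δ i j + + suc m * S i j
  u : Matrix ℤ n → ℕ → V n
  u S m = proj₁ (rank-one (A S m) 𝟙)
  a : Matrix ℤ n → ℕ → ℤ
  a S k = 𝟙 ∙ pw S k 𝟙
  q : Matrix ℤ n → ℕ → ℕ → ℤ
  q S k m = 𝟙 ∙ pw S k (u S m)
  χ : Matrix ℤ n → ℕ → ℤ
  χ S m = det (A S m)
  mv-A : ∀ S m v → mv (A S m) v ≗ v ⊕ + suc m ⊛ mv S v
  mv-A S m v i = trans (∙-⊕ (δ i) (+ suc m ⊛ S i) v) (cong₂ _+_ (trans (∙-comm (δ i) v) (∙-δ v i)) (∙-⊛ (+ suc m) (S i) v))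
  u-eq : ∀ S m k → pw S k (u S m) ≗ χ S m ⊛ pw S k 𝟙 ⊕ (- + suc m) ⊛ pw S (suc k) (u S m)
  u-eq S m zero i = begin
    u S m i                                               ≡⟨ lem (u S m i) (+ suc m) (mv S (u S m) i) ⟩
    u S m i + + suc m * mv S (u S m) i + - + suc m * mv S (u S m) i
                                                          ≡⟨ cong (λ t → t + - + suc m * mv S (u S m) i) (trans (sym (mv-A S m (u S m) i)) (proj₁ (proj₂ (rank-one (A S m) 𝟙)) i)) ⟩
    χ S m * + 1 + - + suc m * mv S (u S m) i              ∎
    where
    lem : ∀ a b c → a ≡ a + b * c + - b * c
    lem = solve-∀
  u-eq S m (suc k) i = begin
    mv S (pw S k (u S m)) i
      ≡⟨ mv-cong S (u-eq S m k) i ⟩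
    mv S (χ S m ⊛ pw S k 𝟙 ⊕ (- + suc m) ⊛ pw S (suc k) (u S m)) i
      ≡⟨ mv-⊕ S (χ S m ⊛ pw S k 𝟙) ((- + suc m) ⊛ pw S (suc k) (u S m)) i ⟩
    mv S (χ S m ⊛ pw S k 𝟙) i + mv S ((- + suc m) ⊛ pw S (suc k) (u S m)) i
      ≡⟨ cong₂ _+_ (mv-⊛ S (χ S m) (pw S k 𝟙) i) (mv-⊛ S (- + suc m) (pw S (suc k) (u S m)) i) ⟩
    χ S m * pw S (suc k) 𝟙 i + - + suc m * pw S (suc (suc k)) (u S m) i
      ∎
  q-rec : ∀ S k m → q S k m ≡ χ S m * a S k - + suc m * q S (suc k) m
  q-rec S k m = begin
    q S k m
      ≡⟨ ∙-congʳ 𝟙 (u-eq S m k) ⟩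
    𝟙 ∙ (χ S m ⊛ pw S k 𝟙 ⊕ (- + suc m) ⊛ pw S (suc k) (u S m))
      ≡⟨ ∙-⊕ʳ 𝟙 (χ S m ⊛ pw S k 𝟙) ((- + suc m) ⊛ pw S (suc k) (u S m)) ⟩
    𝟙 ∙ (χ S m ⊛ pw S k 𝟙) + 𝟙 ∙ ((- + suc m) ⊛ pw S (suc k) (u S m))
      ≡⟨ cong₂ _+_ (∙-⊛ʳ (χ S m) 𝟙 (pw S k 𝟙)) (∙-⊛ʳ (- + suc m) 𝟙 (pw S (suc k) (u S m))) ⟩
    χ S m * a S k + - + suc m * q S (suc k) m
      ≡⟨ lem (χ S m * a S k) (+ suc m) (q S (suc k) m) ⟩
    χ S m * a S k - + suc m * q S (suc k) m
      ∎
    where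
    lem : ∀ a b c → a + - b * c ≡ a - b * c
    lem = solve-∀
  q-zero : ∀ S m → + suc m * q S 0 m ≡ χ S m - det (λ i j → A S m i j - + 1 * + suc m)
  q-zero S m = begin
    + suc m * q S 0 m                   ≡⟨ cong (+ suc m *_) (∙-comm 𝟙 (u S m)) ⟩
    + suc m * (u S m ∙ 𝟙)               ≡⟨ sym (∙-⊛ʳ (+ suc m) (u S m) 𝟙) ⟩
    u S m ∙ (+ suc m ⊛ 𝟙)               ≡⟨ ∙-comm (u S m) (+ suc m ⊛ 𝟙) ⟩
    (+ suc m ⊛ 𝟙) ∙ u S m               ≡⟨ ∙-congˡ (u S m) (λ _ → ℤₚ.*-identityʳ (+ suc m)) ⟩
    (λ _ → + suc m) ∙ u S m             ≡⟨ lem (χ S m) ((λ _ → + suc m) ∙ u S m) ⟩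
    χ S m - (χ S m - (λ _ → + suc m) ∙ u S m)
                                        ≡⟨ cong (λ t → χ S m - t) (sym (proj₂ (proj₂ (rank-one (A S m) 𝟙)) (λ _ → + suc m))) ⟩
    χ S m - det (λ i j → A S m i j - + 1 * + suc m) ∎
    where
    lem : ∀ a b → b ≡ a - (a - b)
    lem = solve-∀
  χ≡1 : ∀ m → + suc m ∣ χ S m - + 1
  χ≡1 m = subst (λ t → + suc m ∣ χ S m - t) (det-δ n)
    (det-mod (λ i j → divides (S i j) (lem (δ i j) (+ suc m) (S i j))))
    where
    lem : ∀ d y s → d + y * s - d ≡ s * y
    lem = solve-∀
  diff : ∀ k → (∀ m → q S k m ≡ q T k m) → a S k - a T k ≡ + 0
  diff k e = ∣-all⇒0 (a S k - a T k) (λ m → subst (+ suc m ∣_)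
    (identity (χ S m) (a S k) (a T k) (+ suc m) (q S (suc k) m) (q T (suc k) m)
      (trans (sym (q-rec S k m)) (trans (e m) (trans (q-rec T k m) (cong (λ t → t * a T k - + suc m * q T (suc k) m) (sym (h₁ m)))))))
    (∣m∣n⇒∣m-n (divides (q S (suc k) m - q T (suc k) m) refl) (∣m⇒∣m*n (a S k - a T k) (χ≡1 m))))
    where
    identity : ∀ c a b y p q → c * a - y * p ≡ c * b - y * q → (p - q) * y - (c - + 1) * (a - b) ≡ a - b
    identity c a b y p q e = begin
      (p - q) * y - (c - + 1) * (a - b)                              ≡⟨ lem c a b y p q ⟩
      a - b - ((c * a - y * p) - (c * b - y * q))                    ≡⟨ cong (λ t → a - b - (t - (c * b - y * q))) e ⟩
      a - b - ((c * b - y * q) - (c * b - y * q))                    ≡⟨ lem₂ (a - b) (c * b - y * q) ⟩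
      a - b                                                          ∎
      where
      lem : ∀ c a b y p q → (p - q) * y - (c - + 1) * (a - b) ≡ a - b - ((c * a - y * p) - (c * b - y * q))
      lem = solve-∀
      lem₂ : ∀ a b → a - (b - b) ≡ a
      lem₂ = solve-∀
  claim : ∀ k m → q S k m ≡ q T k m
  claim zero m = ℤₚ.*-cancelˡ-≡ (+ suc m) (q S 0 m) (q T 0 m)
    (trans (q-zero S m) (trans (cong₂ _-_ (h₁ m) (h₂ m)) (sym (q-zero T m))))
  claim (suc k) m = ℤₚ.*-cancelˡ-≡ (+ suc m) (q S (suc k) m) (q T (suc k) m) (begin
    + suc m * q S (suc k) m
      ≡⟨ lem (χ S m * a S k) (+ suc m * q S (suc k) m) ⟩
    χ S m * a S k - (χ S m * a S k - + suc m * q S (suc k) m)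
      ≡⟨ cong₂ _-_ (cong₂ _*_ (h₁ m) (ℤₚ.i-j≡0⇒i≡j (a S k) (a T k) (diff k (claim k))))
                   (trans (sym (q-rec S k m)) (trans (claim k m) (q-rec T k m))) ⟩
    χ T m * a T k - (χ T m * a T k - + suc m * q T (suc k) m)
      ≡⟨ sym (lem (χ T m * a T k) (+ suc m * q T (suc k) m)) ⟩
    + suc m * q T (suc k) m
      ∎)
    where
    lem : ∀ a b → b ≡ a - (a - b)
    lem = solve-∀

-- The Cayley–Hamilton theorem for skew matrices

-- Polynomial functions of degree at most `n`, where `l` is the coefficient of xⁿ and may be zero.
-- Working with functions lets determinants with entries linear in x be treated without a polynomial
-- ring.
IsPoly : ℕ → ℤ → (ℤ → ℤ) → Set
IsPoly zero    l f = ∀ x → f x ≡ l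
IsPoly (suc n) l f = Σ ℤ λ c → Σ (ℤ → ℤ) λ g → IsPoly n l g × (∀ x → f x ≡ c + x * g x)

isPoly-resp : ∀ {n l l′ f f′} → l ≡ l′ → f ≗ f′ → IsPoly n l f → IsPoly n l′ f′
isPoly-resp {zero}  refl h p           = λ x → trans (sym (h x)) (p x)
isPoly-resp {suc n} refl h (c , g , p , e) = c , g , p , λ x → trans (sym (h x)) (e x)

isPoly-+ : ∀ {n l l′ f f′} → IsPoly n l f → IsPoly n l′ f′ → IsPoly n (l + l′) (λ x → f x + f′ x)
isPoly-+ {zero}  p p′ = λ x → cong₂ _+_ (p x) (p′ x)
isPoly-+ {suc n} (c , g , p , e) (c′ , g′ , p′ , e′) =
  c + c′ , (λ x → g x + g′ x) , isPoly-+ {n} p p′ ,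
  λ x → trans (cong₂ _+_ (e x) (e′ x)) (lem c c′ x (g x) (g′ x))
  where
  lem : ∀ c c′ x g g′ → c + x * g + (c′ + x * g′) ≡ c + c′ + x * (g + g′)
  lem = solve-∀

isPoly-0 : ∀ n → IsPoly n (+ 0) (λ _ → + 0)
isPoly-0 zero    = λ _ → refl
isPoly-0 (suc n) = + 0 , (λ _ → + 0) , isPoly-0 n , λ x → sym (trans (ℤₚ.+-identityˡ (x * + 0)) (ℤₚ.*-zeroʳ x))

isPoly-* : ∀ {n l f} a → IsPoly n l f → IsPoly n (a * l) (λ x → a * f x)
isPoly-* {zero}  a p = λ x → cong (a *_) (p x)
isPoly-* {suc n} a (c , g , p , e) = a * c , (λ x → a * g x) , isPoly-* {n} a p ,
  λ x → trans (cong (a *_) (e x)) (lem a c x (g x))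
  where
  lem : ∀ a c x g → a * (c + x * g) ≡ a * c + x * (a * g)
  lem = solve-∀

isPoly-linear : ∀ {n l f} a b → IsPoly n l f → IsPoly (suc n) (b * l) (λ x → (a + x * b) * f x)
isPoly-linear {zero} {l} a b p = a * l , (λ _ → b * l) , (λ _ → refl) ,
  λ x → trans (cong ((a + x * b) *_) (p x)) (lem a b l x)
  where
  lem : ∀ a b l x → (a + x * b) * l ≡ a * l + x * (b * l)
  lem = solve-∀
isPoly-linear {suc n} {l} a b (c , g , p , e) with isPoly-linear {n} a b p
... | c′ , g′ , p′ , e′ =
  a * c , (λ x → b * c + (a + x * b) * g x) ,
  (b * c + c′ , g′ , p′ , λ x → trans (cong (_+_ (b * c)) (e′ x)) (sym (ℤₚ.+-assoc (b * c) c′ (x * g′ x)))) ,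
  λ x → trans (cong ((a + x * b) *_) (e x)) (lem a b c x (g x))
  where
  lem : ∀ a b c x g → (a + x * b) * (c + x * g) ≡ a * c + x * (b * c + (a + x * b) * g)
  lem = solve-∀

isPoly-sum : ∀ {m n} {l : V m} {f : Fin m → ℤ → ℤ} → (∀ j → IsPoly n (l j) (f j)) →
  IsPoly n (sum l) (λ x → sum (λ j → f j x))
isPoly-sum {zero}  {n} {l} {f} h = isPoly-resp {n} (sym (sum-[] l)) (λ x → sym (sum-[] (λ j → f j x))) (isPoly-0 n)
isPoly-sum {suc m} {n} {l} {f} h = isPoly-resp {n} (sym (sum-∷ l)) (λ x → sym (sum-∷ (λ j → f j x)))
  (isPoly-+ {n} (h zero) (isPoly-sum {m} {n} (h ∘ suc)))

det-isPoly : ∀ n (A B : Matrix ℤ n) → IsPoly n (det B) (λ x → det (λ i j → A i j + x * B i j))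
det-isPoly zero    A B x = trans (det-[] (λ i j → A i j + x * B i j)) (sym (det-[] B))
det-isPoly (suc n) A B = isPoly-resp {suc n} (sym (det-expand B)) (λ x → sym (det-expand (λ i j → A i j + x * B i j)))
  (isPoly-sum {suc n} {suc n} (λ j → isPoly-* {suc n} (sgn j)
    (isPoly-linear {n} (A zero j) (B zero j) (det-isPoly n (cut (A ∘ suc) j) (cut (B ∘ suc) j)))))

horner : ℕ → (ℕ → ℤ) → ℤ → ℤ
horner zero    c x = + 0
horner (suc n) c x = c 0 + x * horner n (c ∘ suc) x

isPoly-horner : ∀ n {l f} → IsPoly n l f → Σ (ℕ → ℤ) λ c → c n ≡ l × (∀ x → f x ≡ horner (suc n) c x)
isPoly-horner zero {l} p = (λ _ → l) , refl , λ x → trans (p x) (lem l x)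
  where
  lem : ∀ l x → l ≡ l + x * + 0
  lem = solve-∀
isPoly-horner (suc n) (a , g , p , e) with isPoly-horner n p
... | c , l , e′ = (λ { zero → a ; (suc i) → c i }) , l , λ x → trans (e x) (cong (λ t → a + x * t) (e′ x))

charMatrix-monic : ∀ {n} (S : Matrix ℤ n) → Σ (ℕ → ℤ) λ c → c n ≡ + 1 × (∀ x → det (charMatrix x S) ≡ horner (suc n) c x)
charMatrix-monic {n} S = isPoly-horner n (isPoly-resp {n} (det-δ n)
  (λ x → det-cong (λ i j → lem (S i j) (x * δ i j))) (det-isPoly n (λ i j → - S i j) δ))
  where
  lem : ∀ s d → - s + d ≡ d - s
  lem = solve-∀

𝟘 : ∀ {n} → V n
𝟘 _ = + 0

mv-𝟘 : ∀ {m n} (S : Fin m → Fin n → ℤ) {v} → v ≗ 𝟘 → mv S v ≗ 𝟘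
mv-𝟘 S h i = ∙-zeroʳ (S i) h

-- Horner's scheme for p(S)v. The first argument counts coefficients, so a polynomial of degree d is
-- given by `suc d`, as in `horner`.
act : ∀ {n} → Matrix ℤ n → ℕ → (ℕ → ℤ) → V n → V n
act S zero    c v = 𝟘
act S (suc n) c v = c 0 ⊛ v ⊕ mv S (act S n (c ∘ suc) v)

record Linear {n} (F : V n → V n) : Set where
  field
    resp  : ∀ {u v} → u ≗ v → F u ≗ F v
    add   : ∀ u v → F (u ⊕ v) ≗ F u ⊕ F v
    scale : ∀ c v → F (c ⊛ v) ≗ c ⊛ F v

  zeroˡ : F 𝟘 ≗ 𝟘
  zeroˡ i = trans (resp {v = + 0 ⊛ 𝟘} (λ _ → refl) i) (scale (+ 0) 𝟘 i)

mv-linear : ∀ {n} (S : Matrix ℤ n) → Linear (mv S)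
mv-linear S = record { resp = mv-cong S ; add = mv-⊕ S ; scale = mv-⊛ S }

act-linear : ∀ {n} (S : Matrix ℤ n) m c → Linear (act S m c)
act-linear S zero c = record { resp = λ _ _ → refl ; add = λ _ _ _ → refl ; scale = λ c _ _ → sym (ℤₚ.*-zeroʳ c) }
act-linear {n} S (suc m) c = record
  { resp  = λ h i → cong₂ _+_ (cong (c 0 *_) (h i)) (mv-cong S (IH.resp h) i)
  ; add   = λ u v i → trans (cong (_+_ (c 0 * (u i + v i))) (trans (mv-cong S (IH.add u v) i) (mv-⊕ S (A u) (A v) i)))
                            (lem₁ (c 0) (u i) (v i) (mv S (A u) i) (mv S (A v) i))
  ; scale = λ a v i → trans (cong (_+_ (c 0 * (a * v i))) (trans (mv-cong S (IH.scale a v) i) (mv-⊛ S a (A v) i)))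
                            (lem₂ (c 0) a (v i) (mv S (A v) i))
  }
  where
  A : V n → V n
  A = act S m (c ∘ suc)
  module IH = Linear (act-linear S m (c ∘ suc))
  lem₁ : ∀ c u v a b → c * (u + v) + (a + b) ≡ c * u + a + (c * v + b)
  lem₁ = solve-∀
  lem₂ : ∀ c a v s → c * (a * v) + a * s ≡ a * (c * v + s)
  lem₂ = solve-∀

Commute : ∀ {n} → (V n → V n) → (V n → V n) → Set
Commute F G = ∀ v → F (G v) ≗ G (F v)

act-commute : ∀ {n} {F : V n → V n} (S : Matrix ℤ n) → Linear F → Commute F (mv S) → ∀ m c → Commute F (act S m c)
act-commute S L h zero c v = Linear.zeroˡ L
act-commute {F = F} S L h (suc m) c v i = begin
  F (c 0 ⊛ v ⊕ mv S A) i                      ≡⟨ Linear.add L (c 0 ⊛ v) (mv S A) i ⟩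
  F (c 0 ⊛ v) i + F (mv S A) i                ≡⟨ cong₂ _+_ (Linear.scale L (c 0) v i) (trans (h A i) (mv-cong S (act-commute S L h m (c ∘ suc) v) i)) ⟩
  c 0 * F v i + mv S (act S m (c ∘ suc) (F v)) i ∎
  where
  A = act S m (c ∘ suc) v

sq : ∀ {n} → Matrix ℤ n → Matrix ℤ n
sq S i j = S i ∙ (λ k → S k j)

mv-sq : ∀ {n} (S : Matrix ℤ n) v → mv (sq S) v ≗ mv S (mv S v)
mv-sq S v i = sym (begin
  S i ∙ mv S v               ≡⟨ mv-adjoint S (S i) v ⟩
  mv (transpose S) (S i) ∙ v ≡⟨ ∙-congˡ v (λ j → ∙-comm (transpose S j) (S i)) ⟩
  sq S i ∙ v                 ∎)

sq-commute : ∀ {n} (S : Matrix ℤ n) → Commute (mv S) (mv (sq S))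
sq-commute S v i = trans (mv-cong S (mv-sq S v) i) (sym (mv-sq S (mv S v) i))

Skew : ∀ {n} → Matrix ℤ n → Set
Skew S = ∀ i j → S i j ≡ - S j i

mv-skew : ∀ {n} {S : Matrix ℤ n} → Skew S → ∀ u v → mv S u ∙ v ≡ - (u ∙ mv S v)
mv-skew {S = S} sk u v = begin
  mv S u ∙ v                        ≡⟨ lem (mv S u ∙ v) ⟩
  - (- + 1 * (mv S u ∙ v))          ≡⟨ -‿cong (sym (∙-⊛ (- + 1) (mv S u) v)) ⟩
  - ((- + 1 ⊛ mv S u) ∙ v)          ≡⟨ -‿cong (∙-congˡ v (λ j → trans (sym (∙-⊛ (- + 1) (S j) u))
                                          (∙-congˡ u (λ i → trans (ℤₚ.-1*i≡-i (S j i)) (sym (sk i j)))))) ⟩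
  - (mv (transpose S) u ∙ v)        ≡⟨ -‿cong (sym (mv-adjoint S u v)) ⟩
  - (u ∙ mv S v)                    ∎
  where
  lem : ∀ a → a ≡ - (- + 1 * a)
  lem = solve-∀

sq-self-adjoint : ∀ {n} {S : Matrix ℤ n} → Skew S → ∀ u v → mv (sq S) u ∙ v ≡ u ∙ mv (sq S) v
sq-self-adjoint {S = S} sk u v = begin
  mv (sq S) u ∙ v            ≡⟨ ∙-congˡ v (mv-sq S u) ⟩
  mv S (mv S u) ∙ v          ≡⟨ mv-skew sk (mv S u) v ⟩
  - (mv S u ∙ mv S v)        ≡⟨ -‿cong (mv-skew sk u (mv S v)) ⟩
  - - (u ∙ mv S (mv S v))    ≡⟨ ℤₚ.neg-involutive (u ∙ mv S (mv S v)) ⟩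
  u ∙ mv S (mv S v)          ≡⟨ ∙-congʳ u (λ i → sym (mv-sq S v i)) ⟩
  u ∙ mv (sq S) v            ∎

act-self-adjoint : ∀ {n} (T : Matrix ℤ n) → (∀ u v → mv T u ∙ v ≡ u ∙ mv T v) →
  ∀ m c u v → act T m c u ∙ v ≡ u ∙ act T m c v
act-self-adjoint T h zero c u v = trans (trans (∙-comm 𝟘 v) (∙-zeroʳ v (λ _ → refl))) (sym (∙-zeroʳ u (λ _ → refl)))
act-self-adjoint T h (suc m) c u v = begin
  (c 0 ⊛ u ⊕ mv T (A u)) ∙ v         ≡⟨ ∙-⊕ (c 0 ⊛ u) (mv T (A u)) v ⟩
  (c 0 ⊛ u) ∙ v + mv T (A u) ∙ v     ≡⟨ cong₂ _+_ (∙-⊛ (c 0) u v) (trans (h (A u) v) (act-self-adjoint T h m (c ∘ suc) u (mv T v))) ⟩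
  c 0 * (u ∙ v) + u ∙ A (mv T v)     ≡⟨ cong₂ _+_ (sym (∙-⊛ʳ (c 0) u v)) (∙-congʳ u (λ i → sym (act-commute T (mv-linear T) (λ _ _ → refl) m (c ∘ suc) v i))) ⟩
  u ∙ (c 0 ⊛ v) + u ∙ mv T (A v)     ≡⟨ sym (∙-⊕ʳ u (c 0 ⊛ v) (mv T (A v))) ⟩
  u ∙ (c 0 ⊛ v ⊕ mv T (A v))         ∎
  where
  A = act T m (c ∘ suc)

nonneg⇒+ : ∀ {a} → + 0 ℤ.≤ a → Σ ℕ λ k → a ≡ + k
nonneg⇒+ {+ k} _ = k , refl

-- p(S)b lies in the image of xI − S for every integer x, say p(S)b = (xI − S)z; as S is skew,
-- |p(S)b|² = x²|z|² + |Sz|², which forces z = 0 for large x.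
cayley-hamilton : ∀ {n} (S : Matrix ℤ n) → Skew S → ∀ m c → (∀ x → det (charMatrix x S) ≡ horner m c x) →
  ∀ b → act S m c b ≗ 𝟘
cayley-hamilton {n} S sk m c h b = image
  where
  -- Synthetic division: p(x)b - p(S)b = (xI - S)w for some integral w.
  remainder : ∀ m c x → Σ (V n) λ w → ∀ i → horner m c x * b i ≡ act S m c b i + (x * w i - mv S w i)
  remainder zero c x = 𝟘 , λ i → sym (trans (cong (λ t → + 0 + (x * + 0 - t)) (mv-𝟘 S (λ _ → refl) i)) (lem x))
    where
    lem : ∀ x → + 0 + (x * + 0 - + 0) ≡ + 0
    lem = solve-∀
  remainder (suc m) c x with remainder m (c ∘ suc) x
  ... | w , e = A ⊕ x ⊛ w , λ i → begin
    (c 0 + x * H) * b i                                  ≡⟨ lem₁ (c 0) x H (b i) ⟩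
    c 0 * b i + x * (H * b i)                            ≡⟨ cong (λ t → c 0 * b i + x * t) (e i) ⟩
    c 0 * b i + x * (A i + (x * w i - mv S w i))         ≡⟨ lem₂ (c 0 * b i) x (A i) (w i) (mv S w i) (mv S A i) ⟩
    c 0 * b i + mv S A i + (x * (A i + x * w i) - (mv S A i + x * mv S w i))
      ≡⟨ cong (λ t → c 0 * b i + mv S A i + (x * (A i + x * w i) - t))
              (sym (trans (mv-⊕ S A (x ⊛ w) i) (cong (_+_ (mv S A i)) (mv-⊛ S x w i)))) ⟩
    c 0 * b i + mv S A i + (x * (A i + x * w i) - mv S (A ⊕ x ⊛ w) i) ∎
    where
    A = act S m (c ∘ suc) b
    H = horner m (c ∘ suc) x
    lem₁ : ∀ c x H b → (c + x * H) * b ≡ c * b + x * (H * b)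
    lem₁ = solve-∀
    lem₂ : ∀ cb x a w s t → cb + x * (a + (x * w - s)) ≡ cb + t + (x * (a + x * w) - (t + x * s))
    lem₂ = solve-∀
  v : V n
  v = act S m c b
  -- The choice x = |v|² + 1 is large enough: a nonzero z would give |v|² ≥ x² ≥ x > |v|².
  d : ℕ
  d = proj₁ (nonneg⇒+ (∙-nonneg v))
  x : ℤ
  x = + suc d
  u w z : V n
  u = proj₁ (rank-one (charMatrix x S) b)
  w = proj₁ (remainder m c x)
  -- By Cramer's rule p(x)b = (xI - S)u; subtracting the remainder identity gives v = (xI - S)(u -
  -- w).
  z = u ⊕ (- + 1) ⊛ w
  v≗ : ∀ i → v i ≡ x * z i + - + 1 * mv S z i
  v≗ i = begin
    v i
      ≡⟨ lem (v i) (x * w i - mv S w i) ⟩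
    v i + (x * w i - mv S w i) - (x * w i - mv S w i)
      ≡⟨ cong (λ t → t - (x * w i - mv S w i)) (begin
           v i + (x * w i - mv S w i)               ≡⟨ sym (proj₂ (remainder m c x) i) ⟩
           horner m c x * b i                       ≡⟨ cong (_* b i) (sym (h x)) ⟩
           det (charMatrix x S) * b i               ≡⟨ sym (proj₁ (proj₂ (rank-one (charMatrix x S) b)) i) ⟩
           (λ j → x * δ i j - S i j) ∙ u            ≡⟨ ∙-congˡ u (λ j → lem₃ (x * δ i j) (S i j)) ⟩
           (x ⊛ δ i ⊕ (- + 1) ⊛ S i) ∙ u            ≡⟨ trans (∙-⊕ (x ⊛ δ i) ((- + 1) ⊛ S i) u)
                                                        (cong₂ _+_ (trans (∙-⊛ x (δ i) u) (cong (x *_) (trans (∙-comm (δ i) u) (∙-δ u i)))) (∙-⊛ (- + 1) (S i) u)) ⟩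
           x * u i + - + 1 * mv S u i               ∎) ⟩
    x * u i + - + 1 * mv S u i - (x * w i - mv S w i)
      ≡⟨ lem₄ x (u i) (mv S u i) (w i) (mv S w i) ⟩
    x * z i + - + 1 * (mv S u i + - + 1 * mv S w i)
      ≡⟨ cong (λ t → x * z i + - + 1 * t) (sym (trans (mv-⊕ S u ((- + 1) ⊛ w) i) (cong (_+_ (mv S u i)) (mv-⊛ S (- + 1) w i)))) ⟩
    x * z i + - + 1 * mv S z i
      ∎
    where
    lem : ∀ a b → a ≡ a + b - b
    lem = solve-∀
    lem₃ : ∀ a b → a - b ≡ a + - + 1 * b
    lem₃ = solve-∀
    lem₄ : ∀ x u s w t → x * u + - + 1 * s - (x * w - t) ≡ x * (u + - + 1 * w) + - + 1 * (s + - + 1 * t)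
    lem₄ = solve-∀
  norm : v ∙ v ≡ x * x * (z ∙ z) + mv S z ∙ mv S z
  norm = begin
    v ∙ v
      ≡⟨ ∙-cong v≗ v≗ ⟩
    (x ⊛ z ⊕ (- + 1) ⊛ mv S z) ∙ (x ⊛ z ⊕ (- + 1) ⊛ mv S z)
      ≡⟨ ∙-⊕ (x ⊛ z) ((- + 1) ⊛ mv S z) (x ⊛ z ⊕ (- + 1) ⊛ mv S z) ⟩
    (x ⊛ z) ∙ (x ⊛ z ⊕ (- + 1) ⊛ mv S z) + ((- + 1) ⊛ mv S z) ∙ (x ⊛ z ⊕ (- + 1) ⊛ mv S z)
      ≡⟨ cong₂ _+_ (trans (∙-⊛ x z (x ⊛ z ⊕ (- + 1) ⊛ mv S z)) (cong (x *_) (expandʳ z)))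
                   (trans (∙-⊛ (- + 1) (mv S z) (x ⊛ z ⊕ (- + 1) ⊛ mv S z)) (cong (- + 1 *_) (expandʳ (mv S z)))) ⟩
    x * (x * (z ∙ z) + - + 1 * (z ∙ mv S z)) + - + 1 * (x * (mv S z ∙ z) + - + 1 * (mv S z ∙ mv S z))
      ≡⟨ cong (λ t → x * (x * (z ∙ z) + - + 1 * (z ∙ mv S z)) + - + 1 * (x * t + - + 1 * (mv S z ∙ mv S z))) (∙-comm (mv S z) z) ⟩
    x * (x * (z ∙ z) + - + 1 * (z ∙ mv S z)) + - + 1 * (x * (z ∙ mv S z) + - + 1 * (mv S z ∙ mv S z))
      ≡⟨ cong (λ t → x * (x * (z ∙ z) + - + 1 * t) + - + 1 * (x * t + - + 1 * (mv S z ∙ mv S z))) skew0 ⟩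
    x * (x * (z ∙ z) + - + 1 * + 0) + - + 1 * (x * + 0 + - + 1 * (mv S z ∙ mv S z))
      ≡⟨ lem x (z ∙ z) (mv S z ∙ mv S z) ⟩
    x * x * (z ∙ z) + mv S z ∙ mv S z
      ∎
    where
    expandʳ : ∀ y → y ∙ (x ⊛ z ⊕ (- + 1) ⊛ mv S z) ≡ x * (y ∙ z) + - + 1 * (y ∙ mv S z)
    expandʳ y = trans (∙-⊕ʳ y (x ⊛ z) ((- + 1) ⊛ mv S z)) (cong₂ _+_ (∙-⊛ʳ x y z) (∙-⊛ʳ (- + 1) y (mv S z)))
    skew0 : z ∙ mv S z ≡ + 0
    skew0 = neg-self (z ∙ mv S z) (trans (∙-comm z (mv S z)) (mv-skew sk z z))
    lem : ∀ x a b → x * (x * a + - + 1 * + 0) + - + 1 * (x * + 0 + - + 1 * b) ≡ x * x * a + b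
    lem = solve-∀
  zz=0 : z ∙ z ≡ + 0
  zz=0 with nonneg⇒+ (∙-nonneg z) | nonneg⇒+ (∙-nonneg (mv S z))
  ... | zero  , e | _ , _  = e
  ... | suc k , e | l , e′ = ⊥-elim (ℕₚ.<-irrefl refl (ℕₚ.<-≤-trans (ℕₚ.n<1+n d) (subst (suc d ≤_) (sym d≡) big)))
    where
    d≡ : d ≡ suc d ℕ.* suc d ℕ.* suc k ℕ.+ l
    d≡ = ℤₚ.+-injective (begin
      + d                                   ≡⟨ sym (proj₂ (nonneg⇒+ (∙-nonneg v))) ⟩
      v ∙ v                                 ≡⟨ norm ⟩
      x * x * (z ∙ z) + mv S z ∙ mv S z     ≡⟨ cong₂ (λ s t → x * x * s + t) e e′ ⟩
      x * x * + suc k + + l                 ∎)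
    big : suc d ≤ suc d ℕ.* suc d ℕ.* suc k ℕ.+ l
    big = ℕₚ.≤-trans (ℕₚ.≤-trans (ℕₚ.m≤m*n (suc d) (suc d)) (ℕₚ.m≤m*n (suc d ℕ.* suc d) (suc k))) (ℕₚ.m≤m+n (suc d ℕ.* suc d ℕ.* suc k) l)
  image : v ≗ 𝟘
  image i = trans (v≗ i) (trans (cong₂ (λ s t → x * s + - + 1 * t) (∙-definite z zz=0 i) (mv-𝟘 S (∙-definite z zz=0) i)) (lem x))
    where
    lem : ∀ x → x * + 0 + - + 1 * + 0 ≡ + 0
    lem = solve-∀

-- The prime 2

private
  split-step : ∀ {n} (S : Matrix ℤ n) a b v {X E O} → X ≗ E ⊕ mv S O →
    a ⊛ v ⊕ mv S (b ⊛ v ⊕ mv S X) ≗ (a ⊛ v ⊕ mv (sq S) E) ⊕ mv S (b ⊛ v ⊕ mv (sq S) O)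
  split-step S a b v {X} {E} {O} h i = begin
    a * v i + mv S (b ⊛ v ⊕ mv S X) i
      ≡⟨ cong (_+_ (a * v i)) (trans (mv-⊕ S (b ⊛ v) (mv S X) i) (cong (_+_ (mv S (b ⊛ v) i)) (begin
           mv S (mv S X) i                        ≡⟨ sym (mv-sq S X i) ⟩
           mv (sq S) X i                          ≡⟨ mv-cong (sq S) h i ⟩
           mv (sq S) (E ⊕ mv S O) i               ≡⟨ mv-⊕ (sq S) E (mv S O) i ⟩
           mv (sq S) E i + mv (sq S) (mv S O) i   ≡⟨ cong (_+_ (mv (sq S) E i)) (sym (sq-commute S O i)) ⟩
           mv (sq S) E i + mv S (mv (sq S) O) i   ∎))) ⟩
    a * v i + (mv S (b ⊛ v) i + (mv (sq S) E i + mv S (mv (sq S) O) i))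
      ≡⟨ lem (a * v i) (mv S (b ⊛ v) i) (mv (sq S) E i) (mv S (mv (sq S) O) i) ⟩
    a * v i + mv (sq S) E i + (mv S (b ⊛ v) i + mv S (mv (sq S) O) i)
      ≡⟨ cong (_+_ (a * v i + mv (sq S) E i)) (sym (mv-⊕ S (b ⊛ v) (mv (sq S) O) i)) ⟩
    a * v i + mv (sq S) E i + mv S (b ⊛ v ⊕ mv (sq S) O) i
      ∎
    where
    lem : ∀ a b c d → a + (b + (c + d)) ≡ a + c + (b + d)
    lem = solve-∀

evens odds : (ℕ → ℤ) → ℕ → ℤ
evens c i = c (i ℕ.* 2)
odds  c i = c (suc (i ℕ.* 2))

act-split : ∀ {n} (S : Matrix ℤ n) h c v →
  act S (h ℕ.* 2) c v ≗ act (sq S) h (evens c) v ⊕ mv S (act (sq S) h (odds c) v)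
act-split S zero    c v i = sym (trans (ℤₚ.+-identityˡ (mv S 𝟘 i)) (mv-𝟘 S (λ _ → refl) i))
act-split S (suc h) c v = split-step S (c 0) (c 1) v (act-split S h (λ i → c (suc (suc i))) v)

act-split₁ : ∀ {n} (S : Matrix ℤ n) h c v →
  act S (suc (h ℕ.* 2)) c v ≗ act (sq S) (suc h) (evens c) v ⊕ mv S (act (sq S) h (odds c) v)
act-split₁ S zero c v i = sym (begin
  c 0 * v i + mv (sq S) 𝟘 i + mv S 𝟘 i  ≡⟨ cong (λ t → c 0 * v i + t + mv S 𝟘 i) (mv-𝟘 (sq S) (λ _ → refl) i) ⟩
  c 0 * v i + + 0 + mv S 𝟘 i            ≡⟨ cong (_+ mv S 𝟘 i) (ℤₚ.+-identityʳ (c 0 * v i)) ⟩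
  c 0 * v i + mv S 𝟘 i                  ∎)
act-split₁ S (suc h) c v = split-step S (c 0) (c 1) v (act-split₁ S h (λ i → c (suc (suc i))) v)

-- The even and the odd part of p(S)v are orthogonal when S is skew.
parity-kill : ∀ {n} {S : Matrix ℤ n} → Skew S → ∀ m c m′ c′ v →
  act (sq S) m c v ⊕ mv S (act (sq S) m′ c′ v) ≗ 𝟘 →
  act (sq S) m c v ≗ 𝟘 × mv S (act (sq S) m′ c′ v) ≗ 𝟘
parity-kill {n} {S} sk m c m′ c′ v h = E≗𝟘 , λ i → begin
    mv S (O v) i          ≡⟨ sym (ℤₚ.+-identityˡ (mv S (O v) i)) ⟩
    + 0 + mv S (O v) i    ≡⟨ cong (_+ mv S (O v) i) (sym (E≗𝟘 i)) ⟩
    E v i + mv S (O v) i  ≡⟨ h i ⟩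
    + 0                   ∎
  where
  T = sq S
  E O : V n → V n
  E = act T m c
  O = act T m′ c′
  self : ∀ m c u w → act T m c u ∙ w ≡ u ∙ act T m c w
  self = act-self-adjoint T (sq-self-adjoint sk)
  S-comm : ∀ m c → Commute (mv S) (act T m c)
  S-comm = act-commute T (mv-linear S) (sq-commute S)
  OE-comm : Commute O E
  OE-comm = act-commute T (act-linear T m′ c′)
    (λ u i → sym (act-commute T (mv-linear T) (λ _ _ → refl) m′ c′ u i)) m c
  -- `E` and `O` are polynomials in S², hence self-adjoint, and commute with each other and with S.
  -- Moving them across the product in two ways, once with the skew S, shows that it equals its own
  -- negative.
  ortho : E v ∙ mv S (O v) ≡ + 0
  ortho = neg-self (E v ∙ mv S (O v)) (trans one (trans (lem (v ∙ mv S (E (O v)))) (-‿cong (sym two))))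
    where
    lem : ∀ a → a ≡ - - a
    lem = solve-∀
    one : E v ∙ mv S (O v) ≡ v ∙ mv S (E (O v))
    one = trans (self m c v (mv S (O v))) (∙-congʳ v (λ i → sym (S-comm m c (O v) i)))
    two : E v ∙ mv S (O v) ≡ - (v ∙ mv S (E (O v)))
    two = begin
      E v ∙ mv S (O v)          ≡⟨ trans (sym (ℤₚ.neg-involutive _)) (-‿cong (sym (mv-skew sk (E v) (O v)))) ⟩
      - (mv S (E v) ∙ O v)      ≡⟨ -‿cong (trans (∙-comm (mv S (E v)) (O v)) (self m′ c′ v (mv S (E v)))) ⟩
      - (v ∙ O (mv S (E v)))    ≡⟨ -‿cong (∙-congʳ v (λ i → sym (S-comm m′ c′ (E v) i))) ⟩
      - (v ∙ mv S (O (E v)))    ≡⟨ -‿cong (∙-congʳ v (mv-cong S (OE-comm v))) ⟩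
      - (v ∙ mv S (E (O v)))    ∎
  E≗𝟘 : E v ≗ 𝟘
  E≗𝟘 = ∙-definite (E v) (begin
    E v ∙ E v                        ≡⟨ sym (ℤₚ.+-identityʳ (E v ∙ E v)) ⟩
    E v ∙ E v + + 0                  ≡⟨ cong (_+_ (E v ∙ E v)) (sym ortho) ⟩
    E v ∙ E v + E v ∙ mv S (O v)     ≡⟨ sym (∙-⊕ʳ (E v) (E v) (mv S (O v))) ⟩
    E v ∙ (E v ⊕ mv S (O v))         ≡⟨ ∙-zeroʳ (E v) h ⟩
    + 0                              ∎)

even-pronic : ∀ a → + 2 ∣ a * a - a
even-pronic (+ n) = nat n
  where
  lem₂ : ∀ a → (+ 1 + a) * (+ 1 + a) - (+ 1 + a) ≡ a * a - a + a * + 2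
  lem₂ = solve-∀
  nat : ∀ n → + 2 ∣ + n * + n - + n
  nat zero    = divides (+ 0) refl
  nat (suc n) = subst (+ 2 ∣_) (sym (lem₂ (+ n))) (∣m∣n⇒∣m+n (nat n) (divides (+ n) refl))
even-pronic -[1+ n ] = subst (+ 2 ∣_) (lem (+ suc n)) (∣m∣n⇒∣m+n (even-pronic (+ suc n)) (divides (+ suc n) refl))
  where
  lem : ∀ a → a * a - a + a * + 2 ≡ - a * - a - - a
  lem = solve-∀

-- Modulo 2 the cross terms of a square cancel and a² ≡ a for the coefficients, so p(x)² ≡ p(x²).
frobenius : ∀ {n} (S : Matrix ℤ n) m c v i → + 2 ∣ act S m c (act S m c v) i - act (sq S) m c v i
frobenius S zero    c v i = divides (+ 0) refl
frobenius {n} S (suc m) c v i = subst (+ 2 ∣_) (sym identity)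
  (∣m∣n⇒∣m+n (∣m∣n⇒∣m+n (∣m⇒∣m*n (v i) (even-pronic (c 0)))
                         (∣n⇒∣m*n (c 0 * mv S (A v) i) ∣-refl))
             (∙-∣ʳ (sq S i) (frobenius S m (c ∘ suc) v)))
  where
  A : V n → V n
  A = act S m (c ∘ suc)
  L = act-linear S m (c ∘ suc)
  B = act (sq S) m (c ∘ suc) v
  expanded : mv S (A (c 0 ⊛ v ⊕ mv S (A v))) i ≡ c 0 * mv S (A v) i + mv (sq S) (A (A v)) i
  expanded = begin
    mv S (A (c 0 ⊛ v ⊕ mv S (A v))) i
      ≡⟨ mv-cong S (λ j → trans (Linear.add L (c 0 ⊛ v) (mv S (A v)) j)
           (cong₂ _+_ (Linear.scale L (c 0) v j) (sym (act-commute S (mv-linear S) (λ _ _ → refl) m (c ∘ suc) (A v) j)))) i ⟩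
    mv S (c 0 ⊛ A v ⊕ mv S (A (A v))) i
      ≡⟨ trans (mv-⊕ S (c 0 ⊛ A v) (mv S (A (A v))) i) (cong₂ _+_ (mv-⊛ S (c 0) (A v) i) (sym (mv-sq S (A (A v)) i))) ⟩
    c 0 * mv S (A v) i + mv (sq S) (A (A v)) i
      ∎
  identity : act S (suc m) c (act S (suc m) c v) i - act (sq S) (suc m) c v i ≡
    (c 0 * c 0 - c 0) * v i + c 0 * mv S (A v) i * + 2 + sq S i ∙ (λ j → A (A v) j - B j)
  identity = begin
    c 0 * (c 0 * v i + mv S (A v) i) + mv S (A (c 0 ⊛ v ⊕ mv S (A v))) i - (c 0 * v i + mv (sq S) B i)
      ≡⟨ cong (λ t → c 0 * (c 0 * v i + mv S (A v) i) + t - (c 0 * v i + mv (sq S) B i)) expanded ⟩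
    c 0 * (c 0 * v i + mv S (A v) i) + (c 0 * mv S (A v) i + mv (sq S) (A (A v)) i) - (c 0 * v i + mv (sq S) B i)
      ≡⟨ lem (c 0) (v i) (mv S (A v) i) (mv (sq S) (A (A v)) i) (mv (sq S) B i) ⟩
    (c 0 * c 0 - c 0) * v i + c 0 * mv S (A v) i * + 2 + (mv (sq S) (A (A v)) i + - + 1 * mv (sq S) B i)
      ≡⟨ cong (_+_ ((c 0 * c 0 - c 0) * v i + c 0 * mv S (A v) i * + 2)) (begin
           mv (sq S) (A (A v)) i + - + 1 * mv (sq S) B i
             ≡⟨ sym (trans (mv-⊕ (sq S) (A (A v)) ((- + 1) ⊛ B) i) (cong (_+_ (mv (sq S) (A (A v)) i)) (mv-⊛ (sq S) (- + 1) B i))) ⟩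
           sq S i ∙ (A (A v) ⊕ (- + 1) ⊛ B)
             ≡⟨ ∙-congʳ (sq S i) (λ j → lem₂ (A (A v) j) (B j)) ⟩
           sq S i ∙ (λ j → A (A v) j - B j)
             ∎) ⟩
    (c 0 * c 0 - c 0) * v i + c 0 * mv S (A v) i * + 2 + sq S i ∙ (λ j → A (A v) j - B j)
      ∎
    where
    lem : ∀ c v s t b → c * (c * v + s) + (c * s + t) - (c * v + b) ≡ (c * c - c) * v + c * s * + 2 + (t + - + 1 * b)
    lem = solve-∀
    lem₂ : ∀ a b → a + - + 1 * b ≡ a - b
    lem₂ = solve-∀

-- Modulo 2 a skew matrix is symmetric, and so is every polynomial in it.
act-adjoint-mod2 : ∀ {n} {S : Matrix ℤ n} → Skew S → ∀ m c u v → + 2 ∣ act S m c u ∙ v - u ∙ act S m c v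
act-adjoint-mod2 sk zero c u v = subst (+ 2 ∣_)
  (sym (cong₂ _-_ (trans (∙-comm 𝟘 v) (∙-zeroʳ v (λ _ → refl))) (∙-zeroʳ u (λ _ → refl)))) (divides (+ 0) refl)
act-adjoint-mod2 {n} {S} sk (suc m) c u v = subst (+ 2 ∣_) (sym identity)
  (∣m∣n⇒∣m+n (∣m⇒∣-m (act-adjoint-mod2 sk m (c ∘ suc) u (mv S v))) (∣n⇒∣m*n (- (u ∙ A (mv S v))) ∣-refl))
  where
  A : V n → V n
  A = act S m (c ∘ suc)
  identity : act S (suc m) c u ∙ v - u ∙ act S (suc m) c v ≡
    - (A u ∙ mv S v - u ∙ A (mv S v)) + - (u ∙ A (mv S v)) * + 2
  identity = begin
    (c 0 ⊛ u ⊕ mv S (A u)) ∙ v - u ∙ (c 0 ⊛ v ⊕ mv S (A v))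
      ≡⟨ cong₂ _-_ (trans (∙-⊕ (c 0 ⊛ u) (mv S (A u)) v) (cong₂ _+_ (∙-⊛ (c 0) u v) (mv-skew sk (A u) v)))
                   (trans (∙-⊕ʳ u (c 0 ⊛ v) (mv S (A v))) (cong₂ _+_ (∙-⊛ʳ (c 0) u v)
                     (∙-congʳ u (act-commute S (mv-linear S) (λ _ _ → refl) m (c ∘ suc) v)))) ⟩
    c 0 * (u ∙ v) + - (A u ∙ mv S v) - (c 0 * (u ∙ v) + u ∙ A (mv S v))
      ≡⟨ lem (c 0 * (u ∙ v)) (A u ∙ mv S v) (u ∙ A (mv S v)) ⟩
    - (A u ∙ mv S v - u ∙ A (mv S v)) + - (u ∙ A (mv S v)) * + 2
      ∎
    where
    lem : ∀ a b c → a + - b - (a + c) ≡ - (b - c) + - c * + 2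
    lem = solve-∀

-- Modulo 2, (g(S)𝟙)ᵢ = 𝟙·g(S)eᵢ = |g(S)eᵢ|² = eᵢ·g(S)²eᵢ.
even-row-sums : ∀ {n} {S : Matrix ℤ n} → Skew S → ∀ m c →
  (∀ b i → + 2 ∣ act S m c (act S m c b) i) → ∀ i → + 2 ∣ act S m c 𝟙 i
even-row-sums {n} {S} sk m c h i = subst (+ 2 ∣_)
  (lem (act S m c 𝟙 i) (𝟙 ∙ r) (r ∙ r) (act S m c r i))
  (∣m∣n⇒∣m+n (∣m∣n⇒∣m-n (∣m∣n⇒∣m+n one three) two) (h (δ i) i))
  where
  r : V n
  r = act S m c (δ i)
  one : + 2 ∣ act S m c 𝟙 i - 𝟙 ∙ r
  one = subst (λ t → + 2 ∣ t - 𝟙 ∙ r) (∙-δ (act S m c 𝟙) i) (act-adjoint-mod2 sk m c 𝟙 (δ i))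
  two : + 2 ∣ r ∙ r - 𝟙 ∙ r
  two = subst (+ 2 ∣_) (begin
      sum (λ j → r j * r j - r j)                             ≡⟨ sum-cong (λ j → lem₂ (r j)) ⟩
      sum (λ j → (r j + - + 1 * + 1) * r j)                   ≡⟨ sym (∙-def (r ⊕ (- + 1) ⊛ 𝟙) r) ⟩
      (r ⊕ (- + 1) ⊛ 𝟙) ∙ r                                   ≡⟨ trans (∙-⊕ r ((- + 1) ⊛ 𝟙) r) (cong (_+_ (r ∙ r)) (∙-⊛ (- + 1) 𝟙 r)) ⟩
      r ∙ r + - + 1 * (𝟙 ∙ r)                                 ≡⟨ cong (_+_ (r ∙ r)) (ℤₚ.-1*i≡-i (𝟙 ∙ r)) ⟩
      r ∙ r - 𝟙 ∙ r                                           ∎)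
    (sum-∣ (λ j → even-pronic (r j)))
    where
    lem₂ : ∀ a → a * a - a ≡ (a + - + 1 * + 1) * a
    lem₂ = solve-∀
  three : + 2 ∣ r ∙ r - act S m c r i
  three = subst (λ t → + 2 ∣ r ∙ r - t) (trans (∙-comm (δ i) (act S m c r)) (∙-δ (act S m c r) i))
    (act-adjoint-mod2 sk m c (δ i) r)
  lem : ∀ a o r s → a - o + (r - s) - (r - o) + s ≡ a
  lem = solve-∀

parity : ∀ n → Σ ℕ λ h → n ≡ h ℕ.* 2 ⊎ n ≡ suc (h ℕ.* 2)
parity zero = 0 , inj₁ refl
parity (suc n) with parity n
... | h , inj₁ e = h , inj₂ (cong suc e)
... | h , inj₂ e = suc h , inj₁ (cong suc e)

-- As χ is even or odd, χ(x) = c(x²) or x c(x²), and modulo 2 the square of g = c, respectively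
-- g = x c, is χ, respectively x χ.
halfPoly : ∀ n χ → χ n ≡ + 1 → Σ ℕ λ q → Σ (ℕ → ℤ) λ g →
  n ℕ./ 2 ℕ.+ q ≡ n × g q ≡ + 1 ×
  (∀ (S : Matrix ℤ n) → Skew S → (∀ x → det (charMatrix x S) ≡ horner (suc n) χ x) →
     ∀ i → + 2 ∣ act S (suc q) g 𝟙 i)
halfPoly n χ monic with parity n
... | h , inj₁ refl = h , evens χ , trans (cong (ℕ._+ h) (ℕ/.m*n/n≡m h 2)) (lem h) , monic ,
  λ S sk char → even-row-sums sk (suc h) (evens χ) (λ b i →
    subst (+ 2 ∣_) (trans (cong (λ t → act S (suc h) (evens χ) (act S (suc h) (evens χ) b) i - t) (evens-kill S sk char b i)) (ℤₚ.+-identityʳ _))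
      (frobenius S (suc h) (evens χ) b i))
  where
  lem : ∀ h → h ℕ.+ h ≡ h ℕ.* 2
  lem h = trans (cong (h ℕ.+_) (sym (ℕₚ.+-identityʳ h))) (ℕₚ.*-comm 2 h)
  -- Rather than showing that the odd coefficients of χ are zero, the even and the odd part of χ(S)b
  -- = 0 are shown to vanish separately.
  evens-kill : ∀ (S : Matrix ℤ (h ℕ.* 2)) → Skew S → (∀ x → det (charMatrix x S) ≡ horner (suc (h ℕ.* 2)) χ x) →
    ∀ b → act (sq S) (suc h) (evens χ) b ≗ 𝟘
  evens-kill S sk char b = proj₁ (parity-kill sk (suc h) (evens χ) h (odds χ) b
    (λ i → trans (sym (act-split₁ S h χ b i)) (cayley-hamilton S sk (suc (h ℕ.* 2)) χ char b i)))
... | h , inj₂ refl = suc h , g , trans (cong (ℕ._+ suc h) half) (lem h) , monic ,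
  λ S sk char → even-row-sums sk (suc (suc h)) g (λ b i →
    subst (+ 2 ∣_) (trans (cong (λ t → act S (suc (suc h)) g (act S (suc (suc h)) g b) i - t) (kill S sk char b i)) (ℤₚ.+-identityʳ _))
      (frobenius S (suc (suc h)) g b i))
  where
  -- For odd n the vanishing odd part of χ(S)b is S c(S²)b, with c(S²) itself out of reach; the
  -- extra factor x makes g(S)² ≡ S² c(S²) a multiple of it.
  g : ℕ → ℤ
  g zero    = + 0
  g (suc i) = odds χ i
  lem : ∀ h → h ℕ.+ suc h ≡ suc (h ℕ.* 2)
  lem h = trans (ℕₚ.+-suc h h) (cong suc (trans (cong (h ℕ.+_) (sym (ℕₚ.+-identityʳ h))) (ℕₚ.*-comm 2 h)))
  half : suc (h ℕ.* 2) ℕ./ 2 ≡ h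
  half = trans (ℕ/.+-distrib-/-∣ʳ 1 {d = 2} (ℕ∣.divides h refl)) (ℕ/.m*n/n≡m h 2)
  kill : ∀ (S : Matrix ℤ (suc (h ℕ.* 2))) → Skew S → (∀ x → det (charMatrix x S) ≡ horner (suc (suc (h ℕ.* 2))) χ x) →
    ∀ b → act (sq S) (suc (suc h)) g b ≗ 𝟘
  kill S sk char b i = begin
    + 0 * b i + mv (sq S) O i     ≡⟨ ℤₚ.+-identityˡ (mv (sq S) O i) ⟩
    mv (sq S) O i                 ≡⟨ mv-sq S O i ⟩
    mv S (mv S O) i               ≡⟨ mv-𝟘 S (proj₂ (parity-kill sk (suc h) (evens χ) (suc h) (odds χ) b
                                       (λ j → trans (sym (act-split S (suc h) χ b j)) (cayley-hamilton S sk (suc h ℕ.* 2) χ char b j)))) i ⟩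
    + 0                           ∎
    where
    O = act (sq S) (suc h) (odds χ) b

-- The orthogonal matrix relating two cospectral graphs

pw-+ : ∀ {n} (S : Matrix ℤ n) i j v → pw S (i ℕ.+ j) v ≡ pw S i (pw S j v)
pw-+ S zero    j v = refl
pw-+ S (suc i) j v = cong (mv S) (pw-+ S i j v)

pw-suc : ∀ {n} (S : Matrix ℤ n) i v → pw S i (mv S v) ≡ mv S (pw S i v)
pw-suc S zero    v = refl
pw-suc S (suc i) v = cong (mv S) (pw-suc S i v)

pw-cong : ∀ {n} (S : Matrix ℤ n) j {u v} → u ≗ v → pw S j u ≗ pw S j v
pw-cong S zero    h = h
pw-cong S (suc j) h = mv-cong S (pw-cong S j h)

pw-⊛ : ∀ {n} (S : Matrix ℤ n) j c v → pw S j (c ⊛ v) ≗ c ⊛ pw S j v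
pw-⊛ S zero    c v i = refl
pw-⊛ S (suc j) c v i = trans (mv-cong S (pw-⊛ S j c v) i) (mv-⊛ S c (pw S j v) i)

pw-act : ∀ {n} (S : Matrix ℤ n) j m c v → pw S j (act S m c v) ≗ act S m c (pw S j v)
pw-act S zero    m c v i = refl
pw-act S (suc j) m c v i = trans (mv-cong S (pw-act S j m c v) i)
                                 (act-commute S (mv-linear S) (λ _ _ → refl) m c (pw S j v) i)

act-leading : ∀ {n} (S : Matrix ℤ n) m c v γ → (∀ i → i ℕ.< m → pw S i v ∙ γ ≡ + 0) →
  act S (suc m) c v ∙ γ ≡ c m * (pw S m v ∙ γ)
act-leading S zero c v γ h = begin
  (c 0 ⊛ v ⊕ mv S 𝟘) ∙ γ  ≡⟨ ∙-congˡ γ (λ i → trans (cong (_+_ (c 0 * v i)) (mv-𝟘 S (λ _ → refl) i)) (ℤₚ.+-identityʳ (c 0 * v i))) ⟩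
  (c 0 ⊛ v) ∙ γ           ≡⟨ ∙-⊛ (c 0) v γ ⟩
  c 0 * (v ∙ γ)           ∎
act-leading {n} S (suc m) c v γ h = begin
  (c 0 ⊛ v ⊕ mv S (A v)) ∙ γ                  ≡⟨ trans (∙-⊕ (c 0 ⊛ v) (mv S (A v)) γ) (cong₂ _+_ (∙-⊛ (c 0) v γ) (∙-congˡ γ commute)) ⟩
  c 0 * (v ∙ γ) + A (mv S v) ∙ γ              ≡⟨ cong₂ (λ s t → c 0 * s + t) (h 0 (s≤s z≤n))
                                                  (act-leading S m (c ∘ suc) (mv S v) γ (λ i lt → trans (cong (_∙ γ) (pw-suc S i v)) (h (suc i) (s≤s lt)))) ⟩
  c 0 * + 0 + c (suc m) * (pw S m (mv S v) ∙ γ) ≡⟨ cong₂ _+_ (ℤₚ.*-zeroʳ (c 0)) (cong (λ w → c (suc m) * (w ∙ γ)) (pw-suc S m v)) ⟩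
  + 0 + c (suc m) * (pw S (suc m) v ∙ γ)      ≡⟨ ℤₚ.+-identityˡ (c (suc m) * (pw S (suc m) v ∙ γ)) ⟩
  c (suc m) * (pw S (suc m) v ∙ γ)            ∎
  where
  A : V n → V n
  A = act S (suc m) (c ∘ suc)
  commute : mv S (A v) ≗ A (mv S v)
  commute = act-commute S (mv-linear S) (λ _ _ → refl) (suc m) (c ∘ suc) v

walkRows : ∀ {n} → Matrix ℤ n → Matrix ℤ n
walkRows S k = pw S (toℕ k) 𝟙

-- With η = ½ g(S)𝟙, where g is monic of degree q, the rows 𝟙, S𝟙, …, S^(q-1)𝟙, η, Sη, …
reducedRows : ∀ {n} → Matrix ℤ n → ℕ → V n → Matrix ℤ n
reducedRows S q η = hybrid (walkRows S) (λ k → pw S (toℕ k ∸ q) η) q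

-- Since g is monic of degree q, 2Sʲη = Sʲg(S)e differs from Sʲ⁺ᵠe by a combination of earlier rows
-- of the walk matrix. Each of the h replaced rows therefore accounts for one factor 2.
det-walkRows : ∀ {n} (S : Matrix ℤ n) h q g η → h ℕ.+ q ≡ n → g q ≡ + 1 →
  act S (suc q) g 𝟙 ≗ + 2 ⊛ η → det (walkRows S) ≡ (+ 2) ℤ.^ h * det (reducedRows S q η)
det-walkRows {n} S h q g η h+q g-monic η-half = begin
  det R
    ≡⟨ det-cong (λ i j → cong (λ v → v j) (sym (hybrid-< R R′ (subst (toℕ i ℕ.<_) (sym h+q) (Finₚ.toℕ<n i))))) ⟩
  det (hybrid R R′ (h ℕ.+ q))
    ≡⟨ det-hybrid R R′ (+ 2) q step h (ℕₚ.≤-reflexive h+q) ⟩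
  (+ 2) ℤ.^ h * det (hybrid R R′ q)
    ∎
  where
  R R′ : Matrix ℤ n
  R = walkRows S
  R′ k = pw S (toℕ k ∸ q) η
  step : ∀ k γ → q ≤ toℕ k → (∀ i → toℕ i ℕ.< toℕ k → R i ∙ γ ≡ + 0) → + 2 * (R′ k ∙ γ) ≡ R k ∙ γ
  step k γ q≤k kills = begin
    + 2 * (pw S j η ∙ γ)                  ≡⟨ sym (∙-⊛ (+ 2) (pw S j η) γ) ⟩
    (+ 2 ⊛ pw S j η) ∙ γ                  ≡⟨ ∙-congˡ γ (λ i → sym (pw-⊛ S j (+ 2) η i)) ⟩
    pw S j (+ 2 ⊛ η) ∙ γ                  ≡⟨ ∙-congˡ γ (pw-cong S j (λ i → sym (η-half i))) ⟩
    pw S j (act S (suc q) g 𝟙) ∙ γ        ≡⟨ ∙-congˡ γ (pw-act S j (suc q) g 𝟙) ⟩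
    act S (suc q) g (pw S j 𝟙) ∙ γ        ≡⟨ act-leading S q g (pw S j 𝟙) γ low ⟩
    g q * (pw S q (pw S j 𝟙) ∙ γ)         ≡⟨ cong₂ (λ a w → a * (w ∙ γ)) g-monic (trans (sym (pw-+ S q j 𝟙)) (cong (λ m → pw S m 𝟙) (ℕₚ.m+[n∸m]≡n q≤k))) ⟩
    + 1 * (R k ∙ γ)                       ≡⟨ ℤₚ.*-identityˡ (R k ∙ γ) ⟩
    R k ∙ γ                               ∎
    where
    j = toℕ k ∸ q
    low : ∀ i → i ℕ.< q → pw S i (pw S j 𝟙) ∙ γ ≡ + 0
    low i i<q = trans (cong (_∙ γ) (sym (trans (cong (λ m → pw S m 𝟙) (Finₚ.toℕ-fromℕ< lt)) (pw-+ S i j 𝟙))))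
                      (kills (fromℕ< lt) (subst (ℕ._< toℕ k) (sym (Finₚ.toℕ-fromℕ< lt)) lt′))
      where
      lt′ : (i ℕ.+ j) ℕ.< toℕ k
      lt′ = subst ((i ℕ.+ j) ℕ.<_) (ℕₚ.m+[n∸m]≡n q≤k) (ℕₚ.+-monoˡ-< j i<q)
      lt : (i ℕ.+ j) ℕ.< n
      lt = ℕₚ.<-trans lt′ (Finₚ.toℕ<n k)

sum-nonneg-0 : ∀ {n} (f : V n) → (∀ i → + 0 ℤ.≤ f i) → sum f ≡ + 0 → ∀ i → f i ≡ + 0
sum-nonneg-0 {suc n} f h e i = go i
  where
  sum-nonneg : ∀ {n} (f : V n) → (∀ i → + 0 ℤ.≤ f i) → + 0 ℤ.≤ sum f
  sum-nonneg {zero}  f h = ℤₚ.≤-reflexive (sym (sum-[] f))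
  sum-nonneg {suc n} f h = ℤₚ.≤-trans (ℤₚ.+-mono-≤ (h zero) (sum-nonneg (f ∘ suc) (h ∘ suc))) (ℤₚ.≤-reflexive (sym (sum-∷ f)))
  split : f zero ≡ + 0 × sum (f ∘ suc) ≡ + 0
  split = nonneg-sum-0 (h zero) (sum-nonneg (f ∘ suc) (h ∘ suc)) (trans (sym (sum-∷ f)) e)
  go : ∀ i → f i ≡ + 0
  go zero    = proj₁ split
  go (suc i) = sum-nonneg-0 (f ∘ suc) (h ∘ suc) (proj₂ split) i

OrthogonalColumns OrthogonalRows : ∀ {n} → Matrix ℤ n → ℤ → Set
OrthogonalColumns A c = ∀ k l → transpose A k ∙ transpose A l ≡ c * δ k l
OrthogonalRows A c = ∀ i j → A i ∙ A j ≡ c * δ i j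

columns-op : ∀ {n} (A : Matrix ℤ n) c → OrthogonalColumns A c → ∀ v → mv (transpose A) (mv A v) ≗ c ⊛ v
columns-op A c h v k = begin
  transpose A k ∙ mv A v                     ≡⟨ mv-adjoint A (transpose A k) v ⟩
  mv (transpose A) (transpose A k) ∙ v       ≡⟨ ∙-congˡ v (λ l → trans (h l k) (cong (c *_) (δ-sym l k))) ⟩
  (c ⊛ δ k) ∙ v                              ≡⟨ trans (∙-⊛ c (δ k) v) (cong (c *_) (trans (∙-comm (δ k) v) (∙-δ v k))) ⟩
  c * v k                                    ∎

-- The Frobenius norm of A Aᵀ − c I vanishes, because tr (A Aᵀ) = tr (Aᵀ A).
rows-orthogonal : ∀ {n} (A : Matrix ℤ n) c → OrthogonalColumns A c → OrthogonalRows A c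
rows-orthogonal {n} A c h i j = begin
  A i ∙ A j                                  ≡⟨ lem (A i ∙ A j) (c * δ i j) ⟩
  A i ∙ A j + - c′ + c′                      ≡⟨ cong (_+ c′) (cong (_+_ (A i ∙ A j)) (ℤₚ.neg-distribˡ-* c (δ i j))) ⟩
  E i j + c′                                 ≡⟨ cong (_+ c′) (∙-definite (E i) (sum-nonneg-0 (λ i → E i ∙ E i) (λ i → ∙-nonneg (E i)) total i) j) ⟩
  + 0 + c′                                   ≡⟨ ℤₚ.+-identityˡ c′ ⟩
  c * δ i j                                  ∎
  where
  c′ = c * δ i j
  lem : ∀ a b → a ≡ a + - b + b
  lem = solve-∀
  B E : Matrix ℤ n
  B i j = A i ∙ A j
  E i = B i ⊕ (- c) ⊛ δ i
  -- The diagonal of (A Aᵀ)² = A (Aᵀ A) Aᵀ = c A Aᵀ.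
  BB : ∀ i → B i ∙ B i ≡ c * B i i
  BB i = begin
    B i ∙ B i                                ≡⟨ ∙-cong {u = B i} (λ j → ∙-comm (A i) (A j)) (λ j → ∙-comm (A i) (A j)) ⟩
    mv A (A i) ∙ mv A (A i)                  ≡⟨ mv-adjoint A (mv A (A i)) (A i) ⟩
    mv (transpose A) (mv A (A i)) ∙ A i      ≡⟨ ∙-congˡ (A i) (columns-op A c h (A i)) ⟩
    (c ⊛ A i) ∙ A i                          ≡⟨ ∙-⊛ c (A i) (A i) ⟩
    c * B i i                                ∎
  δδ : ∀ i → δ i ∙ δ i ≡ + 1
  δδ i = trans (∙-δ (δ i) i) (δ-diag i)
  EE : ∀ i → E i ∙ E i ≡ c * (c + - + 1 * B i i)
  EE i = begin
    E i ∙ E i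
      ≡⟨ ∙-⊕ (B i) ((- c) ⊛ δ i) (E i) ⟩
    B i ∙ E i + ((- c) ⊛ δ i) ∙ E i
      ≡⟨ cong₂ _+_ (trans (∙-⊕ʳ (B i) (B i) ((- c) ⊛ δ i)) (cong₂ _+_ (BB i) (trans (∙-⊛ʳ (- c) (B i) (δ i)) (cong (- c *_) (∙-δ (B i) i)))))
                   (trans (∙-⊛ (- c) (δ i) (E i)) (cong (- c *_) (trans (∙-⊕ʳ (δ i) (B i) ((- c) ⊛ δ i))
                     (cong₂ _+_ (trans (∙-comm (δ i) (B i)) (∙-δ (B i) i)) (trans (∙-⊛ʳ (- c) (δ i) (δ i)) (cong (- c *_) (δδ i))))))) ⟩
    c * B i i + - c * B i i + - c * (B i i + - c * + 1)
      ≡⟨ lem₂ c (B i i) ⟩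
    c * (c + - + 1 * B i i)
      ∎
    where
    lem₂ : ∀ c b → c * b + - c * b + - c * (b + - c * + 1) ≡ c * (c + - + 1 * b)
    lem₂ = solve-∀
  trace : sum (λ i → B i i) ≡ sum {n} (λ _ → c)
  trace = begin
    sum (λ i → A i ∙ A i)                       ≡⟨ sum-cong (λ i → ∙-def (A i) (A i)) ⟩
    sum (λ i → sum (λ k → A i k * A i k))       ≡⟨ sum-swap (λ i k → A i k * A i k) ⟩
    sum (λ k → sum (λ i → A i k * A i k))       ≡⟨ sum-cong (λ k → trans (sym (∙-def (transpose A k) (transpose A k)))
                                                     (trans (h k k) (trans (cong (c *_) (δ-diag k)) (ℤₚ.*-identityʳ c)))) ⟩
    sum (λ _ → c)                               ∎
  total : sum (λ i → E i ∙ E i) ≡ + 0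
  total = begin
    sum (λ i → E i ∙ E i)                       ≡⟨ sum-cong EE ⟩
    sum (λ i → c * (c + - + 1 * B i i))         ≡⟨ sum-* c (λ i → c + - + 1 * B i i) ⟩
    c * sum (λ i → c + - + 1 * B i i)           ≡⟨ cong (c *_) (trans (sum-+ (λ _ → c) (λ i → - + 1 * B i i)) (cong (_+_ (sum {n} (λ _ → c))) (sum-* (- + 1) (λ i → B i i)))) ⟩
    c * (sum {n} (λ _ → c) + - + 1 * sum (λ i → B i i))
                                                ≡⟨ cong (λ t → c * (sum {n} (λ _ → c) + - + 1 * t)) trace ⟩
    c * (sum {n} (λ _ → c) + - + 1 * sum {n} (λ _ → c))
                                                ≡⟨ lem₃ c (sum {n} (λ _ → c)) ⟩
    + 0                                         ∎
    where
    lem₃ : ∀ c s → c * (s + - + 1 * s) ≡ + 0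
    lem₃ = solve-∀

-- N / o is the rational orthogonal matrix carrying Sᵏ𝟙 to Tᵏ𝟙.
record Transfer {n} (S T X : Matrix ℤ n) (o : ℤ) : Set where
  field
    N         : Matrix ℤ n
    columns   : OrthogonalColumns N (o * o)
    rows      : OrthogonalRows N (o * o)
    ones      : mv N 𝟙 ≗ o ⊛ 𝟙
    intertwine : ∀ v → mv N (mv S v) ≗ mv T (mv N v)
    -- All that is kept of the corresponding integral matrix X′ of the other graph: N carries row l
    -- of X to o times row l of X′.
    integral  : ∀ i l → o ∣ N i ∙ X l

module Twin {n} (S T : Matrix ℤ n) (skS : Skew S) (skT : Skew T)
  (walks : ∀ k → 𝟙 ∙ pw S k 𝟙 ≡ 𝟙 ∙ pw T k 𝟙) where

  infix 4 _~_
  -- Pairs of vectors arising by the same construction from S and from T, that is, pairs which R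
  -- should match. Equality of all inner products is proved by induction on the construction, before
  -- any R exists; `quot` admits the division by 2 in η.
  data _~_ : V n → V n → Set where
    base : 𝟙 ~ 𝟙
    step : ∀ {z z′} → z ~ z′ → mv S z ~ mv T z′
    comb : ∀ a b {z z′ w w′} → z ~ z′ → w ~ w′ → a ⊛ z ⊕ b ⊛ w ~ a ⊛ z′ ⊕ b ⊛ w′
    quot : ∀ k {z z′ y y′} → (+ suc k) ⊛ z ≗ y → (+ suc k) ⊛ z′ ≗ y′ → y ~ y′ → z ~ z′

  ~-pw : ∀ {z z′} k → z ~ z′ → pw S k z ~ pw T k z′
  ~-pw zero    p = p
  ~-pw (suc k) p = step (~-pw k p)

  ~-act : ∀ {z z′} m c → z ~ z′ → act S m c z ~ act T m c z′
  -- Division by one, `quot 0`, transports a pair along pointwise equality; the zero vector is a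
  -- combination with zero coefficients.
  ~-act zero c p = quot 0 (λ _ → refl) (λ _ → refl) (comb (+ 0) (+ 0) p p)
  ~-act {z} {z′} (suc m) c p = quot 0 (λ i → unit (c 0 * z i) (mv S (act S m (c ∘ suc) z) i))
                             (λ i → unit (c 0 * z′ i) (mv T (act T m (c ∘ suc) z′) i))
                             (comb (c 0) (+ 1) p (step (~-act m (c ∘ suc) p)))
    where
    unit : ∀ a b → + 1 * (a + b) ≡ a + + 1 * b
    unit = solve-∀

  private
    combine : ∀ a b (z w y : V n) → (a ⊛ z ⊕ b ⊛ w) ∙ y ≡ a * (z ∙ y) + b * (w ∙ y)
    combine a b z w y = trans (∙-⊕ (a ⊛ z) (b ⊛ w) y) (cong₂ _+_ (∙-⊛ a z y) (∙-⊛ b w y))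

    gram-walk : ∀ {z z′} → z ~ z′ → ∀ l → z ∙ pw S l 𝟙 ≡ z′ ∙ pw T l 𝟙
    gram-walk base l = walks l
    gram-walk (step {z} {z′} p) l = begin
      mv S z ∙ pw S l 𝟙            ≡⟨ mv-skew skS z (pw S l 𝟙) ⟩
      - (z ∙ pw S (suc l) 𝟙)       ≡⟨ -‿cong (gram-walk p (suc l)) ⟩
      - (z′ ∙ pw T (suc l) 𝟙)      ≡⟨ sym (mv-skew skT z′ (pw T l 𝟙)) ⟩
      mv T z′ ∙ pw T l 𝟙           ∎
    gram-walk (comb a b {z} {z′} {w} {w′} p q) l = begin
      (a ⊛ z ⊕ b ⊛ w) ∙ pw S l 𝟙                      ≡⟨ combine a b z w (pw S l 𝟙) ⟩
      a * (z ∙ pw S l 𝟙) + b * (w ∙ pw S l 𝟙)         ≡⟨ cong₂ (λ s t → a * s + b * t) (gram-walk p l) (gram-walk q l) ⟩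
      a * (z′ ∙ pw T l 𝟙) + b * (w′ ∙ pw T l 𝟙)       ≡⟨ sym (combine a b z′ w′ (pw T l 𝟙)) ⟩
      (a ⊛ z′ ⊕ b ⊛ w′) ∙ pw T l 𝟙                    ∎
    gram-walk (quot k {z} {z′} {y} {y′} e e′ p) l = ℤₚ.*-cancelˡ-≡ (+ suc k) (z ∙ pw S l 𝟙) (z′ ∙ pw T l 𝟙) (begin
      + suc k * (z ∙ pw S l 𝟙)      ≡⟨ trans (sym (∙-⊛ (+ suc k) z (pw S l 𝟙))) (∙-congˡ (pw S l 𝟙) e) ⟩
      y ∙ pw S l 𝟙                  ≡⟨ gram-walk p l ⟩
      y′ ∙ pw T l 𝟙                 ≡⟨ sym (trans (sym (∙-⊛ (+ suc k) z′ (pw T l 𝟙))) (∙-congˡ (pw T l 𝟙) e′)) ⟩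
      + suc k * (z′ ∙ pw T l 𝟙)     ∎)

  -- Skewness moves each matrix from the second factor to the first, so induction on the second
  -- construction ends at e. There `gram-walk` recurses on the first one, moving matrices back onto
  -- e and ending in walk counts.
  gram : ∀ {z z′ w w′} → z ~ z′ → w ~ w′ → z ∙ w ≡ z′ ∙ w′
  gram p base = gram-walk p 0
  gram {z} {z′} p (step {w} {w′} q) = begin
    z ∙ mv S w            ≡⟨ sym (trans (-‿cong (mv-skew skS z w)) (ℤₚ.neg-involutive (z ∙ mv S w))) ⟩
    - (mv S z ∙ w)        ≡⟨ -‿cong (gram (step p) q) ⟩
    - (mv T z′ ∙ w′)      ≡⟨ trans (-‿cong (mv-skew skT z′ w′)) (ℤₚ.neg-involutive (z′ ∙ mv T w′)) ⟩
    z′ ∙ mv T w′          ∎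
  gram {z} {z′} p (comb a b {w} {w′} {y} {y′} q r) = begin
    z ∙ (a ⊛ w ⊕ b ⊛ y)          ≡⟨ trans (∙-comm z (a ⊛ w ⊕ b ⊛ y)) (combine a b w y z) ⟩
    a * (w ∙ z) + b * (y ∙ z)    ≡⟨ cong₂ (λ s t → a * s + b * t) (trans (∙-comm w z) (trans (gram p q) (∙-comm z′ w′)))
                                                                  (trans (∙-comm y z) (trans (gram p r) (∙-comm z′ y′))) ⟩
    a * (w′ ∙ z′) + b * (y′ ∙ z′) ≡⟨ sym (trans (∙-comm z′ (a ⊛ w′ ⊕ b ⊛ y′)) (combine a b w′ y′ z′)) ⟩
    z′ ∙ (a ⊛ w′ ⊕ b ⊛ y′)       ∎
  gram {z} {z′} p (quot k {w} {w′} {y} {y′} e e′ q) = ℤₚ.*-cancelˡ-≡ (+ suc k) (z ∙ w) (z′ ∙ w′) (begin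
    + suc k * (z ∙ w)       ≡⟨ trans (sym (∙-⊛ʳ (+ suc k) z w)) (∙-congʳ z e) ⟩
    z ∙ y                   ≡⟨ gram p q ⟩
    z′ ∙ y′                 ≡⟨ sym (trans (sym (∙-⊛ʳ (+ suc k) z′ w′)) (∙-congʳ z′ e′)) ⟩
    + suc k * (z′ ∙ w′)     ∎)

  module _ (X X′ : Matrix ℤ n) (X~X′ : ∀ l → X l ~ X′ l) (X≢0 : det X ≢ + 0) where
    private
      o = det X
      -- `c k` is column k of the adjugate of Xᵀ, so N = X′ᵀ adj(Xᵀ) is o times the matrix that
      -- carries each row of X to the same row of X′.
      c : Matrix ℤ n
      c = cof (transpose X)
      N : Matrix ℤ n
      N i k = transpose X′ i ∙ c k

      solve : ∀ k → mv (transpose X) (c k) ≗ o ⊛ δ k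
      solve k i = trans (cof-δ (transpose X) i k) (cong₂ _*_ (det-transpose X) (δ-sym i k))

      column-∙ : ∀ k {z z′} → z ~ z′ → transpose N k ∙ z′ ≡ o * z k
      column-∙ k {z} {z′} p = begin
        mv (transpose X′) (c k) ∙ z′   ≡⟨ sym (mv-adjoint X′ (c k) z′) ⟩
        c k ∙ mv X′ z′                 ≡⟨ ∙-congʳ (c k) (λ l → sym (gram (X~X′ l) p)) ⟩
        c k ∙ mv X z                   ≡⟨ mv-adjoint X (c k) z ⟩
        mv (transpose X) (c k) ∙ z     ≡⟨ ∙-congˡ z (solve k) ⟩
        (o ⊛ δ k) ∙ z                  ≡⟨ trans (∙-⊛ o (δ k) z) (cong (o *_) (trans (∙-comm (δ k) z) (∙-δ z k))) ⟩
        o * z k                        ∎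

      columns : OrthogonalColumns N (o * o)
      columns k l = begin
        mv (transpose X′) (c k) ∙ transpose N l   ≡⟨ sym (mv-adjoint X′ (c k) (transpose N l)) ⟩
        c k ∙ mv X′ (transpose N l)               ≡⟨ ∙-congʳ (c k) (λ m → trans (∙-comm (X′ m) (transpose N l)) (column-∙ l (X~X′ m))) ⟩
        c k ∙ (o ⊛ transpose X l)                 ≡⟨ trans (∙-⊛ʳ o (c k) (transpose X l)) (cong (o *_) (∙-comm (c k) (transpose X l))) ⟩
        o * mv (transpose X) (c k) l              ≡⟨ trans (cong (o *_) (solve k l)) (sym (ℤₚ.*-assoc o o (δ k l))) ⟩
        o * o * δ k l                             ∎

      rows : OrthogonalRows N (o * o)
      rows = rows-orthogonal N (o * o) columns

      -- This covers every related pair, e included, and not only the rows of X: expanding |Nz -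
      -- oz′|² by orthogonality and equality of inner products gives zero.
      carries : ∀ {z z′} → z ~ z′ → mv N z ≗ o ⊛ z′
      carries {z} {z′} p i = ℤₚ.i-j≡0⇒i≡j (mv N z i) (o * z′ i)
        (trans (lem (mv N z i) o (z′ i)) (∙-definite d d∙d i))
        where
        lem : ∀ a b c → a - b * c ≡ a + - b * c
        lem = solve-∀
        d : V n
        d = mv N z ⊕ (- o) ⊛ z′
        NN : mv N z ∙ mv N z ≡ o * o * (z ∙ z)
        NN = trans (mv-adjoint N (mv N z) z) (trans (∙-congˡ z (columns-op N (o * o) columns z)) (∙-⊛ (o * o) z z))
        Nz′ : mv N z ∙ z′ ≡ o * (z ∙ z)
        Nz′ = begin
          mv N z ∙ z′              ≡⟨ ∙-comm (mv N z) z′ ⟩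
          z′ ∙ mv N z              ≡⟨ mv-adjoint N z′ z ⟩
          mv (transpose N) z′ ∙ z  ≡⟨ ∙-congˡ z (λ k → column-∙ k p) ⟩
          (o ⊛ z) ∙ z              ≡⟨ ∙-⊛ o z z ⟩
          o * (z ∙ z)              ∎
        d∙d : d ∙ d ≡ + 0
        d∙d = begin
          d ∙ d
            ≡⟨ trans (∙-⊕ (mv N z) ((- o) ⊛ z′) d) (cong₂ _+_ (∙-⊕ʳ (mv N z) (mv N z) ((- o) ⊛ z′))
                 (trans (∙-⊛ (- o) z′ d) (cong (- o *_) (∙-⊕ʳ z′ (mv N z) ((- o) ⊛ z′))))) ⟩
          mv N z ∙ mv N z + mv N z ∙ ((- o) ⊛ z′) + - o * (z′ ∙ mv N z + z′ ∙ ((- o) ⊛ z′))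
            ≡⟨ cong₂ (λ s t → s + - o * t) (cong₂ _+_ NN (trans (∙-⊛ʳ (- o) (mv N z) z′) (cong (- o *_) Nz′)))
                 (cong₂ _+_ (trans (∙-comm z′ (mv N z)) Nz′) (trans (∙-⊛ʳ (- o) z′ z′) (cong (- o *_) (sym (gram p p))))) ⟩
          o * o * (z ∙ z) + - o * (o * (z ∙ z)) + - o * (o * (z ∙ z) + - o * (z ∙ z))
            ≡⟨ lem₂ o (z ∙ z) ⟩
          + 0
            ∎
          where
          lem₂ : ∀ o s → o * o * s + - o * (o * s) + - o * (o * s + - o * s) ≡ + 0
          lem₂ = solve-∀

      -- Both sides have the same products with all X′ l, hence with the columns of N; and N Nᵀ = o² I.
      intertwine : ∀ v → mv N (mv S v) ≗ mv T (mv N v)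
      intertwine v i = ℤₚ.i-j≡0⇒i≡j (mv N (mv S v) i) (mv T (mv N v) i) (trans (lem (mv N (mv S v) i) (mv T (mv N v) i)) (d≗𝟘 i))
        where
        lem : ∀ a b → a - b ≡ a + - + 1 * b
        lem = solve-∀
        d : V n
        d = mv N (mv S v) ⊕ (- + 1) ⊛ mv T (mv N v)
        test : ∀ {z z′} w → z ~ z′ → mv N w ∙ z′ ≡ o * (w ∙ z)
        test {z} {z′} w p = begin
          mv N w ∙ z′              ≡⟨ trans (∙-comm (mv N w) z′) (mv-adjoint N z′ w) ⟩
          mv (transpose N) z′ ∙ w  ≡⟨ ∙-congˡ w (λ k → column-∙ k p) ⟩
          (o ⊛ z) ∙ w              ≡⟨ trans (∙-⊛ o z w) (cong (o *_) (∙-comm z w)) ⟩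
          o * (w ∙ z)              ∎
        d⊥ : ∀ {z z′} → z ~ z′ → d ∙ z′ ≡ + 0
        d⊥ {z} {z′} p = begin
          d ∙ z′
            ≡⟨ trans (∙-⊕ (mv N (mv S v)) ((- + 1) ⊛ mv T (mv N v)) z′) (cong (_+_ (mv N (mv S v) ∙ z′)) (∙-⊛ (- + 1) (mv T (mv N v)) z′)) ⟩
          mv N (mv S v) ∙ z′ + - + 1 * (mv T (mv N v) ∙ z′)
            ≡⟨ cong₂ (λ s t → s + - + 1 * t) (trans (test (mv S v) p) (cong (o *_) (mv-skew skS v z)))
                 (trans (mv-skew skT (mv N v) z′) (-‿cong (test v (step p)))) ⟩
          o * - (v ∙ mv S z) + - + 1 * - (o * (v ∙ mv S z))
            ≡⟨ lem₂ o (v ∙ mv S z) ⟩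
          + 0
            ∎
          where
          lem₂ : ∀ o s → o * - s + - + 1 * - (o * s) ≡ + 0
          lem₂ = solve-∀
        Nᵀd : ∀ k → transpose N k ∙ d ≡ + 0
        Nᵀd k = trans (sym (mv-adjoint X′ (c k) d)) (∙-zeroʳ (c k) (λ l → trans (∙-comm (X′ l) d) (d⊥ (X~X′ l))))
        d≗𝟘 : d ≗ 𝟘
        d≗𝟘 i with ℤₚ.i*j≡0⇒i≡0∨j≡0 (o * o) (trans (sym (columns-op (transpose N) (o * o) rows d i)) (∙-zeroʳ (N i) Nᵀd))
        ... | inj₂ e = e
        ... | inj₁ e = ⊥-elim (X≢0 (square-0 o e))

    transfer : Transfer S T X (det X)
    transfer = record
      { N = N ; columns = columns ; rows = rows ; ones = carries base ; intertwine = intertwine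
      ; integral = λ i l → divides (X′ l i) (trans (carries (X~X′ l) i) (ℤₚ.*-comm o (X′ l i))) }

  ~-reducedRows : ∀ q g {η η′} → act S (suc q) g 𝟙 ≗ + 2 ⊛ η → act T (suc q) g 𝟙 ≗ + 2 ⊛ η′ →
    ∀ l → reducedRows S q η l ~ reducedRows T q η′ l
  ~-reducedRows q g {η} {η′} e e′ l with toℕ l ℕ.<? q
  ... | yes _ = ~-pw (toℕ l) base
  ... | no  _ = ~-pw (toℕ l ∸ q) (quot 1 (λ i → sym (e i)) (λ i → sym (e′ i)) (~-act (suc q) g base))

-- Odd primes

prime-∣-square : ∀ {p a b} → Prime p → p ℕ.* p ℕ∣.∣ a ℕ.* b → ¬ p ℕ.* p ℕ∣.∣ b → p ℕ∣.∣ a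
prime-∣-square {p} {a} {b} pr pp∣ab pp∤b with euclidsLemma a b pr (ℕ∣.∣-trans (ℕ∣.m∣m*n p) pp∣ab)
... | inj₁ p∣a = p∣a
... | inj₂ (ℕ∣.divides b′ refl) with euclidsLemma a b′ pr (ℕ∣.*-cancelʳ-∣ p {{prime⇒nonZero pr}} (subst (p ℕ.* p ℕ∣.∣_) (sym (ℕₚ.*-assoc a b′ p)) pp∣ab))
...   | inj₁ p∣a  = p∣a
...   | inj₂ p∣b′ = ⊥-elim (pp∤b (ℕ∣.*-monoˡ-∣ p p∣b′))

prime-cancel-square : ∀ {p c t} → Prime p → ¬ p ℕ∣.∣ c → p ℕ.* p ℕ∣.∣ c ℕ.* t → p ℕ.* p ℕ∣.∣ t
prime-cancel-square {p} {c} {t} pr p∤c pp∣ct with euclidsLemma c t pr (ℕ∣.∣-trans (ℕ∣.m∣m*n p) pp∣ct)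
... | inj₁ p∣c = ⊥-elim (p∤c p∣c)
... | inj₂ (ℕ∣.divides t′ refl) with euclidsLemma c t′ pr (ℕ∣.*-cancelʳ-∣ p {{prime⇒nonZero pr}} (subst (p ℕ.* p ℕ∣.∣_) (sym (ℕₚ.*-assoc c t′ p)) pp∣ct))
...   | inj₁ p∣c  = ⊥-elim (p∤c p∣c)
...   | inj₂ p∣t′ = ℕ∣.*-monoˡ-∣ p p∣t′

prime≢1 : ∀ {p} → Prime p → p ≢ 1
prime≢1 pr refl with prime⇒nonTrivial pr
... | ()

-- When p is split off the factorisation, square-freeness keeps p from dividing the product d of the
-- remaining primes. So p² still divides the quotient of x by d².
squareFree-square-∣ : ∀ {m x} → .{{ℕ.NonZero m}} → SquareFree m →
  (∀ p → Prime p → p ℕ∣.∣ m → p ℕ.* p ℕ∣.∣ x) → m ℕ.* m ℕ∣.∣ x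
squareFree-square-∣ {m} {x} sf h =
  subst (λ k → k ℕ.* k ℕ∣.∣ x) (sym F.isFactorisation) (go F.factors F.factorsPrime (ℕ∣.∣-reflexive (sym F.isFactorisation)))
  where
  module F = PrimeFactorisation (factorise m)
  go : ∀ ps → All Prime ps → product ps ℕ∣.∣ m → product ps ℕ.* product ps ℕ∣.∣ x
  go []       _          _   = ℕ∣.1∣ x
  go (p ∷ ps) (pr ∷ prs) d∣m with go ps prs (ℕ∣.∣-trans (ℕ∣.n∣m*n p) d∣m)
  ... | ℕ∣.divides t refl =
    subst (ℕ∣._∣ t ℕ.* (d ℕ.* d)) (shuffle p d)
      (ℕ∣.*-monoˡ-∣ (d ℕ.* d) (prime-cancel-square pr p∤dd (subst (p ℕ.* p ℕ∣.∣_) (ℕₚ.*-comm t (d ℕ.* d)) (h p pr (ℕ∣.∣-trans (ℕ∣.m∣m*n d) d∣m)))))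
    where
    d = product ps
    shuffle : ∀ p d → p ℕ.* p ℕ.* (d ℕ.* d) ≡ p ℕ.* d ℕ.* (p ℕ.* d)
    shuffle = ℕ-solve-∀
    p∤d : ¬ p ℕ∣.∣ d
    p∤d p∣d = prime≢1 pr (sf p (ℕ∣.∣-trans (ℕ∣.*-monoʳ-∣ p p∣d) d∣m))
    p∤dd : ¬ p ℕ∣.∣ d ℕ.* d
    p∤dd p∣dd with euclidsLemma d d pr p∣dd
    ... | inj₁ e = p∤d e
    ... | inj₂ e = p∤d e

-- Relations between the rows modulo a prime

private
  -- Replace row i of M by the combination of the rows with coefficients x, divided by P, and then
  -- row j by the one with coefficients y.
  minor-∣-pivot : ∀ {n} (M : Matrix ℤ n) P x y → (∀ k → P ∣ mv (transpose M) x k) → (∀ k → P ∣ mv (transpose M) y k) →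
    ∀ i j → i ≢ j → x i ≢ + 0 → P * P ∣ (x i * y j - x j * y i) * det M
  minor-∣-pivot {n} M P x y hx hy i j i≢j x≢0 = divides (b ∙ γ′)
    (ℤₚ.*-cancelʳ-≡ ((x i * y j - x j * y i) * det M) (b ∙ γ′ * (P * P)) (x i) {{ℤ.≢-nonZero x≢0}} (begin
      (x i * y j - x j * y i) * det M * x i
        ≡⟨ lem₁ (x i * y j - x j * y i) (det M) (x i) ⟩
      (x i * y j - x j * y i) * (det M * x i)
        ≡⟨ cong ((x i * y j - x j * y i) *_) (sym first) ⟩
      (x i * y j - x j * y i) * (P * det M₁)
        ≡⟨ lem₂ (x i) (y j) (x j) (y i) P (det M₁) t ⟩
      P * (x i * (det M₁ * y j + t * y i) - y i * (det M₁ * x j + t * x i))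
        ≡⟨ cong₂ (λ u v → P * (x i * u - y i * v)) (sym (second y b (λ k → _∣_.equality (hy k)))) vanish ⟩
      P * (x i * (P * (b ∙ γ′)) - y i * + 0)
        ≡⟨ lem₃ P (x i) (b ∙ γ′) (y i) ⟩
      b ∙ γ′ * (P * P) * x i
        ∎))
    where
    a b : V n
    a k = _∣_.quotient (hx k)
    b k = _∣_.quotient (hy k)
    combination : ∀ w c γ → (∀ k → mv (transpose M) w k ≡ c k * P) → P * (c ∙ γ) ≡ w ∙ mv M γ
    combination w c γ e = begin
      P * (c ∙ γ)               ≡⟨ sym (∙-⊛ P c γ) ⟩
      (P ⊛ c) ∙ γ               ≡⟨ ∙-congˡ γ (λ k → trans (ℤₚ.*-comm P (c k)) (sym (e k))) ⟩
      mv (transpose M) w ∙ γ    ≡⟨ sym (mv-adjoint M w γ) ⟩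
      w ∙ mv M γ                ∎
    M₁ : Matrix ℤ n
    M₁ = updateAt M i (const a)
    M₁-i : M₁ i ≡ a
    M₁-i = Vectorₚ.updateAt-updates i M
    M₁-off : ∀ l → l ≢ i → M₁ l ≡ M l
    M₁-off l l≢i = Vectorₚ.updateAt-minimal l i M l≢i
    first : P * det M₁ ≡ det M * x i
    first = begin
      P * det M₁                ≡⟨ cong (P *_) (trans (det-cof M M₁ i (λ l l≢i k → cong (λ v → v k) (M₁-off l l≢i))) (cong (_∙ cof M i) M₁-i)) ⟩
      P * (a ∙ cof M i)         ≡⟨ combination x a (cof M i) (λ k → _∣_.equality (hx k)) ⟩
      x ∙ mv M (cof M i)        ≡⟨ ∙-congʳ x (λ l → trans (cof-δ M l i) (cong (det M *_) (δ-sym l i))) ⟩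
      x ∙ (det M ⊛ δ i)         ≡⟨ trans (∙-⊛ʳ (det M) x (δ i)) (cong (det M *_) (∙-δ x i)) ⟩
      det M * x i               ∎
    γ′ : V n
    γ′ = cof M₁ j
    -- The product of the replaced row with γ′ has no closed form. The relation for x, whose left
    -- side is zero because `a` is already a row of M₁, eliminates it from the relation for y.
    t : ℤ
    t = M i ∙ γ′
    rows : ∀ l → mv M γ′ l ≡ det M₁ * δ j l + t * δ i l
    rows l with l ≟ i
    ... | yes refl = begin
      t                                ≡⟨ lem (det M₁) t ⟩
      det M₁ * + 0 + t * + 1           ≡⟨ cong₂ (λ u v → det M₁ * u + t * v) (sym (δ-off (i≢j ∘ sym))) (sym (δ-diag i)) ⟩
      det M₁ * δ j i + t * δ i i       ∎
      where
      lem : ∀ d t → t ≡ d * + 0 + t * + 1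
      lem = solve-∀
    ... | no l≢i = begin
      M l ∙ γ′                         ≡⟨ cong (_∙ γ′) (sym (M₁-off l l≢i)) ⟩
      M₁ l ∙ γ′                        ≡⟨ trans (cof-δ M₁ l j) (cong (det M₁ *_) (δ-sym l j)) ⟩
      det M₁ * δ j l                   ≡⟨ lem (det M₁ * δ j l) t ⟩
      det M₁ * δ j l + t * + 0         ≡⟨ cong (λ v → det M₁ * δ j l + t * v) (sym (δ-off (l≢i ∘ sym))) ⟩
      det M₁ * δ j l + t * δ i l       ∎
      where
      lem : ∀ d t → d ≡ d + t * + 0
      lem = solve-∀
    second : ∀ w c → (∀ k → mv (transpose M) w k ≡ c k * P) → P * (c ∙ γ′) ≡ det M₁ * w j + t * w i
    second w c e = begin
      P * (c ∙ γ′)                               ≡⟨ combination w c γ′ e ⟩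
      w ∙ mv M γ′                                ≡⟨ ∙-congʳ w rows ⟩
      w ∙ (det M₁ ⊛ δ j ⊕ t ⊛ δ i)               ≡⟨ trans (∙-⊕ʳ w (det M₁ ⊛ δ j) (t ⊛ δ i)) (cong₂ _+_ (∙-⊛ʳ (det M₁) w (δ j)) (∙-⊛ʳ t w (δ i))) ⟩
      det M₁ * (w ∙ δ j) + t * (w ∙ δ i)         ≡⟨ cong₂ (λ u v → det M₁ * u + t * v) (∙-δ w j) (∙-δ w i) ⟩
      det M₁ * w j + t * w i                     ∎
    vanish : det M₁ * x j + t * x i ≡ + 0
    vanish = begin
      det M₁ * x j + t * x i    ≡⟨ sym (second x a (λ k → _∣_.equality (hx k))) ⟩
      P * (a ∙ γ′)              ≡⟨ cong (P *_) (trans (cong (_∙ γ′) (sym M₁-i)) (cof-other M₁ i≢j)) ⟩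
      P * + 0                   ≡⟨ ℤₚ.*-zeroʳ P ⟩
      + 0                       ∎
    lem₁ : ∀ a b c → a * b * c ≡ a * (b * c)
    lem₁ = solve-∀
    lem₂ : ∀ xi yj xj yi P d t → (xi * yj - xj * yi) * (P * d) ≡ P * (xi * (d * yj + t * yi) - yi * (d * xj + t * xi))
    lem₂ = solve-∀
    lem₃ : ∀ P xi s yi → P * (xi * (P * s) - yi * + 0) ≡ s * (P * P) * xi
    lem₃ = solve-∀

-- A quantitative form of the fact that two independent relations between the rows modulo P force P²
-- to divide the determinant. Where P² does not divide it, for P prime, all relations modulo P are
-- multiples of one. A zero coefficient at `i` is handled by exchanging x and y, or makes the minor
-- vanish.
minor-∣ : ∀ {n} (M : Matrix ℤ n) P x y → (∀ k → P ∣ mv (transpose M) x k) → (∀ k → P ∣ mv (transpose M) y k) →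
  ∀ i j → P * P ∣ (x i * y j - x j * y i) * det M
minor-∣ {n} M P x y hx hy i j with i ≟ j
... | yes refl = divides (+ 0) (lem (x i) (y i) (det M) P)
  where
  lem : ∀ a b d P → (a * b - a * b) * d ≡ + 0 * (P * P)
  lem = solve-∀
... | no i≢j with x i ℤ.≟ + 0 | y i ℤ.≟ + 0
...   | no x≢0  | _       = minor-∣-pivot M P x y hx hy i j i≢j x≢0
...   | yes _   | no y≢0  = subst (P * P ∣_) (lem (x i) (y j) (x j) (y i) (det M)) (∣m⇒∣-m (minor-∣-pivot M P y x hy hx i j i≢j y≢0))
  where
  lem : ∀ xi yj xj yi d → - ((yi * xj - yj * xi) * d) ≡ (xi * yj - xj * yi) * d
  lem = solve-∀
...   | yes x≡0 | yes y≡0 = divides (+ 0) (trans (cong₂ (λ u v → (u * y j - x j * v) * det M) x≡0 y≡0) (lem (y j) (x j) (det M) P))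
  where
  lem : ∀ y x d P → (+ 0 * y - x * + 0) * d ≡ + 0 * (P * P)
  lem = solve-∀

module _ {n} {S X : Matrix ℤ n} {o : ℤ} (o≡ : det X ≡ o) (sf : SquareFree ∣ o ∣) where

  module Prime-∣ {p} (pr : Prime p) (p∣o : p ℕ∣.∣ ∣ o ∣) (p∤2 : ¬ p ℕ∣.∣ 2) where
    private
      P : ℤ
      P = + p

      nat : ∀ {a} → P ∣ a → p ℕ∣.∣ ∣ a ∣
      nat = ∣⇒∣ᵤ
      nat² : ∀ {a} → P * P ∣ a → p ℕ.* p ℕ∣.∣ ∣ a ∣
      nat² {a} h = subst (ℕ∣._∣ ∣ a ∣) (ℤₚ.abs-* P P) (∣⇒∣ᵤ h)
      int² : ∀ {a} → p ℕ.* p ℕ∣.∣ ∣ a ∣ → P * P ∣ a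
      int² {a} h = ∣ᵤ⇒∣ (subst (ℕ∣._∣ ∣ a ∣) (sym (ℤₚ.abs-* P P)) h)

      unit-* : ∀ {a b} → ¬ P ∣ a → ¬ P ∣ b → ¬ P ∣ a * b
      unit-* {a} {b} ha hb h with euclidsLemma ∣ a ∣ ∣ b ∣ pr (subst (p ℕ∣.∣_) (ℤₚ.abs-* a b) (nat h))
      ... | inj₁ e = ha (∣ᵤ⇒∣ e)
      ... | inj₂ e = hb (∣ᵤ⇒∣ e)

      cancel² : ∀ {c t} → ¬ P ∣ c → P * P ∣ c * t → P * P ∣ t
      cancel² {c} {t} hc h = int² (prime-cancel-square pr (λ e → hc (∣ᵤ⇒∣ e)) (subst (p ℕ.* p ℕ∣.∣_) (ℤₚ.abs-* c t) (nat² h)))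

      Integral : V n → Set
      Integral v = ∀ l → P ∣ v ∙ X l

      -- Both vectors solve Xv ≡ 0 (mod p). As p² does not divide det X, p must divide all their 2×2
      -- minors.
      proportional : ∀ {v w} → Integral v → Integral w → ∀ i j → P ∣ v i * w j - v j * w i
      proportional {v} {w} hv hw i j = ∣ᵤ⇒∣ (prime-∣-square pr
        (subst (p ℕ.* p ℕ∣.∣_) (ℤₚ.abs-* (v i * w j - v j * w i) o)
          (nat² (subst (λ d → P * P ∣ (v i * w j - v j * w i) * d) (trans (det-transpose X) o≡)
            (minor-∣ (transpose X) P v w (λ k → subst (P ∣_) (∙-comm v (X k)) (hv k)) (λ k → subst (P ∣_) (∙-comm w (X k)) (hw k)) i j))))
        (λ pp∣o → prime≢1 pr (sf p pp∣o)))

      bilinear : ∀ a b c d (u v w y : V n) →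
        (a ⊛ u ⊕ b ⊛ v) ∙ (c ⊛ w ⊕ d ⊛ y) ≡ a * (c * (u ∙ w) + d * (u ∙ y)) + b * (c * (v ∙ w) + d * (v ∙ y))
      bilinear a b c d u v w y = trans (∙-⊕ (a ⊛ u) (b ⊛ v) (c ⊛ w ⊕ d ⊛ y)) (cong₂ _+_ (one a u) (one b v))
        where
        one : ∀ a u → (a ⊛ u) ∙ (c ⊛ w ⊕ d ⊛ y) ≡ a * (c * (u ∙ w) + d * (u ∙ y))
        one a u = trans (∙-⊛ a u (c ⊛ w ⊕ d ⊛ y)) (cong (a *_) (trans (∙-⊕ʳ u (c ⊛ w) (d ⊛ y)) (cong₂ _+_ (∙-⊛ʳ c u w) (∙-⊛ʳ d u y))))

      ∙-∣² : ∀ {u v : V n} → (∀ i → P ∣ u i) → (∀ i → P ∣ v i) → P * P ∣ u ∙ v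
      ∙-∣² {u} {v} hu hv = subst (P * P ∣_) (sym (∙-def u v)) (sum-∣ (λ i → product-∣ (hu i) (hv i)))
        where
        product-∣ : ∀ {a b} → P ∣ a → P ∣ b → P * P ∣ a * b
        product-∣ (divides q refl) (divides r refl) = divides (q * r) (lem q r P)
          where
          lem : ∀ q r P → q * P * (r * P) ≡ q * r * (P * P)
          lem = solve-∀

      row-∣² : ∀ {T} (t : Transfer S T X o) i j → P * P ∣ Transfer.N t i ∙ Transfer.N t j
      row-∣² t i j = subst (P * P ∣_) (sym (Transfer.rows t i j)) (∣m⇒∣m*n (δ i j) (square (∣ᵤ⇒∣ p∣o)))
        where
        square : P ∣ o → P * P ∣ o * o
        square (divides q e) = divides (q * q) (trans (cong₂ _*_ e e) (lem q P))
          where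
          lem : ∀ q P → q * P * (q * P) ≡ q * q * (P * P)
          lem = solve-∀

      row-integral : ∀ {T} (t : Transfer S T X o) i → Integral (Transfer.N t i)
      row-integral t i l = ∣-trans (∣ᵤ⇒∣ p∣o) (Transfer.integral t i l)

    Divisible : ∀ {T} → Transfer S T X o → Set
    Divisible t = ∀ i j → P ∣ Transfer.N t i j

    divisible? : ∀ {T} (t : Transfer S T X o) → Dec (Divisible t)
    divisible? t = Finₚ.all? (λ i → Finₚ.all? (λ j → P ∣? Transfer.N t i j))

    private
      entry : ∀ {T} (t : Transfer S T X o) → ¬ Divisible t → ∃ λ i → ∃ λ j → ¬ P ∣ Transfer.N t i j
      entry t h with Finₚ.¬∀⟶∃¬ n _ (λ i → Finₚ.all? (λ j → P ∣? Transfer.N t i j)) h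
      ... | i , h′ = i , Finₚ.¬∀⟶∃¬ n _ (λ j → P ∣? Transfer.N t i j) h′

    -- All rows are multiples of one vector modulo p, and their mutual products within N and within
    -- N′ vanish modulo p²; hence so do the products between N and N′.
    cross-∣ : ∀ {T T′} (t : Transfer S T X o) (t′ : Transfer S T′ X o) →
      (Divisible t → Divisible t′) → (Divisible t′ → Divisible t) →
      ∀ i j → P * P ∣ Transfer.N t i ∙ Transfer.N t′ j
    cross-∣ t t′ f g i j with divisible? t
    ... | yes d = ∙-∣² (d i) (f d j)
    ... | no ¬d with entry t ¬d | entry t′ (¬d ∘ g)
    ...   | i₀ , a , α-unit | j₀ , b , yb-unit = cancel² (unit-* α-unit β-unit) (subst (P * P ∣_) (eq₄ α β (v a) (w a) (v ∙ w) (v ∙ y) (x ∙ w) (x ∙ y))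
        (∣m∣n⇒∣m+n (∣m∣n⇒∣m+n (subst (P * P ∣_) (bilinear α (- v a) β (- w a) v x w y) (∙-∣² v-red w-red))
          (∣n⇒∣m*n (α * w a) vy)) (∣m∣n⇒∣m-n (∣n⇒∣m*n (v a * β) xw) (∣n⇒∣m*n (v a * w a) xy))))
      where
      N = Transfer.N t
      N′ = Transfer.N t′
      v w x y : V n
      v = N i
      w = N′ j
      x = N i₀
      y = N′ j₀
      α β : ℤ
      α = x a
      β = y a
      -- Modulo p, y is proportional to x; its nonzero entry in column b therefore forces a nonzero
      -- one in column a, where x is nonzero. So α and β are units from the same column.
      β-unit : ¬ P ∣ β
      β-unit P∣β = unit-* α-unit yb-unit (subst (P ∣_) (lem α (y b) (x b) β)
        (∣m∣n⇒∣m+n (proportional (row-integral t i₀) (row-integral t′ j₀) a b) (∣n⇒∣m*n (x b) P∣β)))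
        where
        lem : ∀ α yb xb β → α * yb - xb * β + xb * β ≡ α * yb
        lem = solve-∀
      reduce : ∀ {z u : V n} → Integral z → Integral u → ∀ k → P ∣ (z a ⊛ u ⊕ (- u a) ⊛ z) k
      reduce {z} {u} hz hu k = subst (P ∣_) (lem (z a) (u k) (z k) (u a)) (proportional hz hu a k)
        where
        lem : ∀ za uk zk ua → za * uk - zk * ua ≡ za * uk + - ua * zk
        lem = solve-∀
      v-red : ∀ k → P ∣ (α ⊛ v ⊕ (- v a) ⊛ x) k
      v-red = reduce (row-integral t i₀) (row-integral t i)
      w-red : ∀ k → P ∣ (β ⊛ w ⊕ (- w a) ⊛ y) k
      w-red = reduce (row-integral t′ j₀) (row-integral t′ j)
      y-red : ∀ k → P ∣ (α ⊛ y ⊕ (- β) ⊛ x) k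
      y-red = reduce (row-integral t i₀) (row-integral t′ j₀)
      xx = row-∣² t i₀ i₀
      yy = row-∣² t′ j₀ j₀
      xv = row-∣² t i₀ i
      yw = row-∣² t′ j₀ j
      2-unit : ¬ P ∣ + 2
      2-unit h = p∤2 (nat h)
      eq₁ : ∀ α β yy xy xx → α * (α * yy + - β * xy) + - β * (α * xy + - β * xx) - α * α * yy - β * β * xx ≡ - + 2 * (α * β) * xy
      eq₁ = solve-∀
      -- αy - βx is divisible by p, so its square norm is 0 modulo p². As |x|² and |y|² are too,
      -- -2αβ x·y remains, and p is odd.
      xy : P * P ∣ x ∙ y
      xy = cancel² (unit-* { - + 2} {α * β} (2-unit ∘ ∣m⇒∣-m) (unit-* α-unit β-unit))
        (subst (P * P ∣_) (trans (cong (λ s → α * (α * (y ∙ y) + - β * s) + - β * (α * (x ∙ y) + - β * (x ∙ x)) - α * α * (y ∙ y) - β * β * (x ∙ x)) (∙-comm y x))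
                                 (eq₁ α β (y ∙ y) (x ∙ y) (x ∙ x)))
          (∣m∣n⇒∣m-n (∣m∣n⇒∣m-n (subst (P * P ∣_) (bilinear α (- β) α (- β) y x y x) (∙-∣² y-red y-red))
            (∣n⇒∣m*n (α * α) yy)) (∣n⇒∣m*n (β * β) xx)))
      yx : P * P ∣ y ∙ x
      yx = subst (P * P ∣_) (∙-comm x y) xy
      eq₂ : ∀ α β va yv yx xv xx → α * (α * yv + - va * yx) + - β * (α * xv + - va * xx) + α * va * yx + (β * α * xv - β * va * xx) ≡ α * α * yv
      eq₂ = solve-∀
      -- The same device with v reduced against x: in the product of αy - βx and αv - vₐx all terms
      -- but α² y·v are known. It is repeated for x·w, and at last for v·w.
      vy : P * P ∣ v ∙ y
      vy = subst (P * P ∣_) (∙-comm y v) (cancel² (unit-* α-unit α-unit)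
        (subst (P * P ∣_) (eq₂ α β (v a) (y ∙ v) (y ∙ x) (x ∙ v) (x ∙ x))
          (∣m∣n⇒∣m+n (∣m∣n⇒∣m+n (subst (P * P ∣_) (bilinear α (- β) α (- v a) y x v x) (∙-∣² y-red v-red))
            (∣n⇒∣m*n (α * v a) yx)) (∣m∣n⇒∣m-n (∣n⇒∣m*n (β * α) xv) (∣n⇒∣m*n (β * v a) xx)))))
      eq₃ : ∀ α β wa yw yy xw xy → α * (β * yw + - wa * yy) + - β * (β * xw + - wa * xy) - α * β * yw + (α * wa * yy - β * wa * xy) ≡ - (β * β) * xw
      eq₃ = solve-∀
      xw : P * P ∣ x ∙ w
      xw = cancel² (λ h → unit-* β-unit β-unit (subst (P ∣_) (ℤₚ.neg-involutive (β * β)) (∣m⇒∣-m h)))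
        (subst (P * P ∣_) (eq₃ α β (w a) (y ∙ w) (y ∙ y) (x ∙ w) (x ∙ y))
          (∣m∣n⇒∣m+n (∣m∣n⇒∣m-n (subst (P * P ∣_) (bilinear α (- β) β (- w a) y x w y) (∙-∣² y-red w-red))
            (∣n⇒∣m*n (α * β) yw)) (∣m∣n⇒∣m-n (∣n⇒∣m*n (α * w a) yy) (∣n⇒∣m*n (β * w a) xy))))
      eq₄ : ∀ α β va wa vw vy xw xy → α * (β * vw + - wa * vy) + - va * (β * xw + - wa * xy) + α * wa * vy + (va * β * xw - va * wa * xy) ≡ α * β * vw
      eq₄ = solve-∀

  cross-square-∣ : ∀ {T T′} (t : Transfer S T X o) (t′ : Transfer S T′ X o) → .{{ℕ.NonZero ∣ o ∣}} → Odd ∣ o ∣ →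
    (∀ p → Prime p → p ℕ∣.∣ ∣ o ∣ → (∀ i j → + p ∣ Transfer.N t i j) → ∀ i j → + p ∣ Transfer.N t′ i j) →
    (∀ p → Prime p → p ℕ∣.∣ ∣ o ∣ → (∀ i j → + p ∣ Transfer.N t′ i j) → ∀ i j → + p ∣ Transfer.N t i j) →
    ∀ i j → o * o ∣ Transfer.N t i ∙ Transfer.N t′ j
  cross-square-∣ t t′ odd f g i j = ∣ᵤ⇒∣ (subst (ℕ∣._∣ ∣ r ∣) (sym (ℤₚ.abs-* o o)) (squareFree-square-∣ sf (λ p pr p∣o →
    subst (ℕ∣._∣ ∣ r ∣) (ℤₚ.abs-* (+ p) (+ p)) (∣⇒∣ᵤ (Prime-∣.cross-∣ pr p∣o (p∤2 pr p∣o) t t′ (f p pr p∣o) (g p pr p∣o) i j)))))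
    where
    r = Transfer.N t i ∙ Transfer.N t′ j
    p∤2 : ∀ {p} → Prime p → p ℕ∣.∣ ∣ o ∣ → ¬ p ℕ∣.∣ 2
    p∤2 {zero} pr p∣o h with ℕ∣.0∣⇒≡0 h
    ... | ()
    p∤2 {suc zero} pr p∣o h = prime≢1 pr refl
    p∤2 {suc (suc zero)} pr p∣o h with trans (sym odd) (ℕ∣.n∣m⇒m%n≡0 ∣ o ∣ 2 p∣o)
    ... | ()
    p∤2 {suc (suc (suc p))} pr p∣o h with ℕ∣.∣⇒≤ h
    ... | s≤s (s≤s ())

-- Permutation matrices and isomorphisms

OneHot : ∀ {n} → V n → Fin n → Set
OneHot v j = v j ≡ + 1 × (∀ k → k ≢ j → v k ≡ + 0)

oneHot-∙ : ∀ {n} {v : V n} {j} → OneHot v j → ∀ w → v ∙ w ≡ w j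
oneHot-∙ {v = v} {j} (e , z) w = begin
  v ∙ w                    ≡⟨ ∙-def v w ⟩
  sum (λ k → v k * w k)    ≡⟨ sum-single j (λ k → v k * w k) (λ k k≢j → cong (_* w k) (z k k≢j)) ⟩
  v j * w j                ≡⟨ trans (cong (_* w j) e) (ℤₚ.*-identityˡ (w j)) ⟩
  w j                      ∎

square-pos : ∀ a → a ≢ + 0 → Σ ℕ λ k → a * a ≡ + suc k
square-pos (+ zero)  h = ⊥-elim (h refl)
square-pos (+ suc k) h = k ℕ.+ k ℕ.* suc k , refl
square-pos -[1+ k ]  h = k ℕ.+ k ℕ.* suc k , refl

opaque
  unfolding _∙_ sum
  unit-vector : ∀ {n} (v : V n) → v ∙ v ≡ + 1 → ∃ λ j → v j ≢ + 0 × (∀ k → k ≢ j → v k ≡ + 0)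
  unit-vector {zero} v ()
  unit-vector {suc n} v e with v zero ℤ.≟ + 0
  ... | no v₀≢0 = zero , v₀≢0 , others
    where
    rest≡0 : ∀ {a b} → (Σ ℕ λ k → a ≡ + suc k) → + 0 ℤ.≤ b → a + b ≡ + 1 → b ≡ + 0
    rest≡0 {b = + zero}  _ _ _ = refl
    rest≡0 {b = + suc l} (k , refl) _ e with trans (sym (ℕₚ.+-suc k l)) (ℕₚ.suc-injective (ℤₚ.+-injective e))
    ... | ()
    others : ∀ k → k ≢ zero → v k ≡ + 0
    others zero    h = ⊥-elim (h refl)
    others (suc k) h = ∙-definite (v ∘ suc) (rest≡0 (square-pos (v zero) v₀≢0) (∙-nonneg (v ∘ suc)) e) k
  ... | yes v₀≡0 with unit-vector (v ∘ suc) (trans (sym (ℤₚ.+-identityˡ ((v ∘ suc) ∙ (v ∘ suc)))) (trans (cong (λ t → t * t + (v ∘ suc) ∙ (v ∘ suc)) (sym v₀≡0)) e))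
  ...   | j , vj≢0 , others = suc j , vj≢0 , λ { zero _ → v₀≡0 ; (suc k) h → others k (h ∘ cong suc) }

-- Norm one leaves a single nonzero entry, and the sum of the entries then has to be that entry.
oneHot : ∀ {n} (v : V n) → v ∙ v ≡ + 1 → v ∙ 𝟙 ≡ + 1 → ∃ (OneHot v)
oneHot v vv v1 with unit-vector v vv
... | j , _ , z = j , (begin
    v j                      ≡⟨ sym (trans (sum-single j (λ k → v k * + 1) (λ k h → cong (_* + 1) (z k h))) (ℤₚ.*-identityʳ (v j))) ⟩
    sum (λ k → v k * + 1)    ≡⟨ sym (∙-def v 𝟙) ⟩
    v ∙ 𝟙                    ≡⟨ v1 ⟩
    + 1                      ∎) , z

module _ {n} {S T T′ X : Matrix ℤ n} {o : ℤ} (skS : Skew S) (skT′ : Skew T′) (o≢0 : o ≢ + 0)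
  (t : Transfer S T X o) (t′ : Transfer S T′ X o) (P : Matrix ℤ n)
  (P-def : ∀ i j → Transfer.N t i ∙ Transfer.N t′ j ≡ P i j * (o * o)) where

  private
    module A = Transfer t
    module B = Transfer t′
    c = o * o

    instance
      c-nonZero : ℤ.NonZero c
      c-nonZero = ℤ.≢-nonZero (o≢0 ∘ square-0 o)
      o-nonZero : ℤ.NonZero o
      o-nonZero = ℤ.≢-nonZero o≢0

    cP : ∀ i → c ⊛ P i ≗ mv B.N (A.N i)
    cP i j = trans (ℤₚ.*-comm c (P i j)) (trans (sym (P-def i j)) (∙-comm (A.N i) (B.N j)))

  -- From cP = N N′ᵀ follows c²PPᵀ = N (N′ᵀN′) Nᵀ = c N Nᵀ = c²I.
  transition-rows : ∀ i k → P i ∙ P k ≡ δ i k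
  transition-rows i k = ℤₚ.*-cancelˡ-≡ c (P i ∙ P k) (δ i k) (ℤₚ.*-cancelˡ-≡ c (c * (P i ∙ P k)) (c * δ i k) (begin
    c * (c * (P i ∙ P k))                       ≡⟨ cong (c *_) (sym (∙-⊛ʳ c (P i) (P k))) ⟩
    c * (P i ∙ (c ⊛ P k))                       ≡⟨ sym (∙-⊛ c (P i) (c ⊛ P k)) ⟩
    (c ⊛ P i) ∙ (c ⊛ P k)                       ≡⟨ ∙-cong (cP i) (cP k) ⟩
    mv B.N (A.N i) ∙ mv B.N (A.N k)             ≡⟨ mv-adjoint B.N (mv B.N (A.N i)) (A.N k) ⟩
    mv (transpose B.N) (mv B.N (A.N i)) ∙ A.N k ≡⟨ ∙-congˡ (A.N k) (columns-op B.N c B.columns (A.N i)) ⟩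
    (c ⊛ A.N i) ∙ A.N k                         ≡⟨ ∙-⊛ c (A.N i) (A.N k) ⟩
    c * (A.N i ∙ A.N k)                         ≡⟨ cong (c *_) (A.rows i k) ⟩
    c * (c * δ i k)                             ∎))

  transition-sums : ∀ i → P i ∙ 𝟙 ≡ + 1
  transition-sums i = ℤₚ.*-cancelˡ-≡ c (P i ∙ 𝟙) (+ 1) (begin
    c * (P i ∙ 𝟙)                   ≡⟨ sym (∙-⊛ c (P i) 𝟙) ⟩
    (c ⊛ P i) ∙ 𝟙                   ≡⟨ ∙-congˡ 𝟙 (cP i) ⟩
    mv B.N (A.N i) ∙ 𝟙              ≡⟨ trans (∙-comm (mv B.N (A.N i)) 𝟙) (mv-adjoint B.N 𝟙 (A.N i)) ⟩
    mv (transpose B.N) 𝟙 ∙ A.N i    ≡⟨ ∙-congˡ (A.N i) Nᵀ𝟙 ⟩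
    (o ⊛ 𝟙) ∙ A.N i                 ≡⟨ trans (∙-⊛ o 𝟙 (A.N i)) (cong (o *_) (trans (∙-comm 𝟙 (A.N i)) (trans (A.ones i) (ℤₚ.*-identityʳ o)))) ⟩
    o * o                           ≡⟨ sym (ℤₚ.*-identityʳ c) ⟩
    c * + 1                         ∎)
    where
    Nᵀ𝟙 : mv (transpose B.N) 𝟙 ≗ o ⊛ 𝟙
    Nᵀ𝟙 k = ℤₚ.*-cancelˡ-≡ o (mv (transpose B.N) 𝟙 k) (o * + 1) (begin
      o * mv (transpose B.N) 𝟙 k                ≡⟨ sym (mv-⊛ (transpose B.N) o 𝟙 k) ⟩
      mv (transpose B.N) (o ⊛ 𝟙) k              ≡⟨ mv-cong (transpose B.N) (λ i → sym (B.ones i)) k ⟩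
      mv (transpose B.N) (mv B.N 𝟙) k           ≡⟨ columns-op B.N c B.columns 𝟙 k ⟩
      o * o * + 1                               ≡⟨ ℤₚ.*-assoc o o (+ 1) ⟩
      o * (o * + 1)                             ∎)

  -- Since S and T′ are skew, the transpose of N′ intertwines them in the opposite direction. Thus P
  -- passes from T′ to S and then, through N, from S to T.
  transition-intertwine : ∀ v → mv P (mv T′ v) ≗ mv T (mv P v)
  transition-intertwine v i = ℤₚ.*-cancelˡ-≡ c (mv P (mv T′ v) i) (mv T (mv P v) i) (begin
    c * mv P (mv T′ v) i                        ≡⟨ c-mv (mv T′ v) i ⟩
    mv A.N (Nᵀ (mv T′ v)) i                     ≡⟨ mv-cong A.N Nᵀ-intertwine i ⟩
    mv A.N (mv S (Nᵀ v)) i                      ≡⟨ A.intertwine (Nᵀ v) i ⟩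
    mv T (mv A.N (Nᵀ v)) i                      ≡⟨ mv-cong T (λ k → sym (c-mv v k)) i ⟩
    mv T (c ⊛ mv P v) i                         ≡⟨ mv-⊛ T c (mv P v) i ⟩
    c * mv T (mv P v) i                         ∎)
    where
    Nᵀ : V n → V n
    Nᵀ = mv (transpose B.N)
    c-mv : ∀ v → c ⊛ mv P v ≗ mv A.N (Nᵀ v)
    c-mv v i = begin
      c * (P i ∙ v)             ≡⟨ sym (∙-⊛ c (P i) v) ⟩
      (c ⊛ P i) ∙ v             ≡⟨ ∙-congˡ v (cP i) ⟩
      mv B.N (A.N i) ∙ v        ≡⟨ trans (∙-comm (mv B.N (A.N i)) v) (mv-adjoint B.N v (A.N i)) ⟩
      Nᵀ v ∙ A.N i              ≡⟨ ∙-comm (Nᵀ v) (A.N i) ⟩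
      A.N i ∙ Nᵀ v              ∎
    test : ∀ u → Nᵀ (mv T′ v) ∙ u ≡ mv S (Nᵀ v) ∙ u
    test u = begin
      Nᵀ (mv T′ v) ∙ u          ≡⟨ sym (mv-adjoint B.N (mv T′ v) u) ⟩
      mv T′ v ∙ mv B.N u        ≡⟨ mv-skew skT′ v (mv B.N u) ⟩
      - (v ∙ mv T′ (mv B.N u))  ≡⟨ -‿cong (∙-congʳ v (λ k → sym (B.intertwine u k))) ⟩
      - (v ∙ mv B.N (mv S u))   ≡⟨ -‿cong (mv-adjoint B.N v (mv S u)) ⟩
      - (Nᵀ v ∙ mv S u)         ≡⟨ sym (mv-skew skS (Nᵀ v) u) ⟩
      mv S (Nᵀ v) ∙ u           ∎
    Nᵀ-intertwine : Nᵀ (mv T′ v) ≗ mv S (Nᵀ v)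
    Nᵀ-intertwine k = trans (sym (∙-δ (Nᵀ (mv T′ v)) k)) (trans (test (δ k)) (∙-δ (mv S (Nᵀ v)) k))

-- The quotient P is integral with orthonormal rows of sum one, hence a permutation matrix; the
-- isomorphism is the equation PT′ = TP read at the entry (i, σ j).
permutation-similar : ∀ {n} {S T T′ X : Matrix ℤ n} {o : ℤ} → Skew S → Skew T → Skew T′ → o ≢ + 0 →
  (t : Transfer S T X o) (t′ : Transfer S T′ X o) →
  (∀ i j → o * o ∣ Transfer.N t i ∙ Transfer.N t′ j) →
  Σ (Fin n ↔ Fin n) λ σ → ∀ i j → T i j ≡ T′ (Inverse.to σ i) (Inverse.to σ j)
permutation-similar {n} {S} {T} {T′} {X} {o} skS skT skT′ o≢0 t t′ div = mk↔ₛ′ σ τ στ τσ , λ i j → begin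
    T i j                             ≡⟨ sym (trans (∙-comm (T i) (λ k → P k (σ j))) (oneHot-∙ (col-σ j) (T i))) ⟩
    T i ∙ (λ k → P k (σ j))           ≡⟨ ∙-congʳ (T i) (λ k → sym (∙-δ (P k) (σ j))) ⟩
    mv T (mv P (δ (σ j))) i           ≡⟨ sym (transition-intertwine skS skT′ o≢0 t t′ P P-def (δ (σ j)) i) ⟩
    mv P (mv T′ (δ (σ j))) i          ≡⟨ oneHot-∙ (proj₂ (row i)) (mv T′ (δ (σ j))) ⟩
    mv T′ (δ (σ j)) (σ i)             ≡⟨ ∙-δ (T′ (σ i)) (σ j) ⟩
    T′ (σ i) (σ j)                    ∎
  where
  P : Matrix ℤ n
  P i j = _∣_.quotient (div i j)
  P-def : ∀ i j → Transfer.N t i ∙ Transfer.N t′ j ≡ P i j * (o * o)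
  P-def i j = _∣_.equality (div i j)
  Pᵀ-def : ∀ j i → Transfer.N t′ j ∙ Transfer.N t i ≡ P i j * (o * o)
  Pᵀ-def j i = trans (∙-comm (Transfer.N t′ j) (Transfer.N t i)) (P-def i j)
  row : ∀ i → ∃ (OneHot (P i))
  row i = oneHot (P i) (trans (transition-rows skS skT′ o≢0 t t′ P P-def i i) (δ-diag i))
                       (transition-sums skS skT′ o≢0 t t′ P P-def i)
  -- The columns of P are the rows of the corresponding matrix with the two transfers exchanged, so
  -- they are one-hot by the same argument.
  col : ∀ j → ∃ (OneHot (λ i → P i j))
  col j = oneHot (λ i → P i j) (trans (transition-rows skS skT o≢0 t′ t (transpose P) Pᵀ-def j j) (δ-diag j))
                               (transition-sums skS skT o≢0 t′ t (transpose P) Pᵀ-def j)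
  σ τ : Fin n → Fin n
  σ i = proj₁ (row i)
  τ j = proj₁ (col j)
  1≢0 : ∀ {a} → a ≡ + 1 → a ≢ + 0
  1≢0 refl ()
  στ : ∀ j → σ (τ j) ≡ j
  στ j = decidable-stable (σ (τ j) ≟ j) (λ h → 1≢0 (proj₁ (proj₂ (col j))) (proj₂ (proj₂ (row (τ j))) j (h ∘ sym)))
  τσ : ∀ i → τ (σ i) ≡ i
  τσ i = decidable-stable (τ (σ i) ≟ i) (λ h → 1≢0 (proj₁ (proj₂ (row i))) (proj₂ (proj₂ (col (σ i))) i (h ∘ sym)))
  col-σ : ∀ j → OneHot (λ k → P k (σ j)) j
  col-σ j = subst (OneHot (λ k → P k (σ j))) (τσ j) (proj₂ (col (σ j)))

-- From oriented graphs to skew matrices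

S-skew : ∀ {n} (D : OrientedGraph n) → Skew (S D)
S-skew D i j with arc D i j in ij | arc D j i in ji
... | false | false = refl
... | false | true  = refl
... | true  | false = refl
... | true  | true  with trans (sym ji) (antisym D i j ij)
...   | ()

S-arc : ∀ {n} (D C : OrientedGraph n) {i j k l} → S D i j ≡ S C k l → arc D i j ≡ arc C k l
S-arc D C {i} {j} {k} {l} e with arc D i j | arc D j i | arc C k l | arc C l k
... | true  | _     | true  | _     = refl
... | false | _     | false | _     = refl
S-arc D C () | true  | _     | false | true
S-arc D C () | true  | _     | false | false
S-arc D C () | false | true  | true  | _
S-arc D C () | false | false | true  | _

detW≡det-walkRows : ∀ {n} (D : OrientedGraph n) → detW D ≡ det (walkRows (S D))
detW≡det-walkRows D = trans (sym (det≡detℤ (W D))) (trans (sym (det-transpose (W D))) (det-cong (λ i → walk (toℕ i))))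
  where
  walk : ∀ k → Spow-e D k ≗ pw (S D) k 𝟙
  walk zero    i = refl
  walk (suc k) i = begin
    sumFin (λ j → S D i j * Spow-e D k j)   ≡⟨ sym (sum≡sumFin (λ j → S D i j * Spow-e D k j)) ⟩
    sum (λ j → S D i j * Spow-e D k j)      ≡⟨ sum-cong (λ j → cong (S D i j *_) (walk k j)) ⟩
    sum (λ j → S D i j * pw (S D) k 𝟙 j)    ≡⟨ sym (∙-def (S D i) (pw (S D) k 𝟙)) ⟩
    S D i ∙ pw (S D) k 𝟙                    ∎

-- With y = m + 1 the two determinants of `walks-agree` are reversed characteristic polynomials: I +
-- yS = I - (-y)S, and I + yS - yJ = I - y(J - S).
genCospectral-walks : ∀ {n} (D C : OrientedGraph n) → GenCospectral D C →
  ∀ k → 𝟙 ∙ pw (S D) k 𝟙 ≡ 𝟙 ∙ pw (S C) k 𝟙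
genCospectral-walks D C (h , h′) = walks-agree (S D) (S C)
  (λ m → trans (det-cong (λ i j → neg (δ i j) (+ suc m) (S D i j)))
        (trans (det-reversed {M = S D} {S C} h (- + suc m) (λ ())) (det-cong (λ i j → sym (neg (δ i j) (+ suc m) (S C i j))))))
  (λ m → trans (det-cong (λ i j → shift (δ i j) (+ suc m) (S D i j)))
        (trans (det-reversed {M = J-S D} {J-S C} h′ (+ suc m) (λ ())) (det-cong (λ i j → sym (shift (δ i j) (+ suc m) (S C i j))))))
  where
  neg : ∀ d y s → d + y * s ≡ d - - y * s
  neg = solve-∀
  shift : ∀ d y s → d + y * s - + 1 * y ≡ d - y * (+ 1 - s)
  shift = solve-∀

opaque
  -- `X` and its determinant are fixed before `C`, which makes the matrices N of different graphs
  -- comparable. The polynomial g can be shared because it is built from the characteristic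
  -- polynomial, which C has in common with D.
  genCospectral-transfer : ∀ {n} (D : OrientedGraph n) → Σ (Matrix ℤ n) λ X →
    detW D ≡ + (2 ℕ.^ (n ℕ./ 2)) * det X ×
    (det X ≢ + 0 → ∀ C → GenCospectral D C → Transfer (S D) (S C) X (det X))
  genCospectral-transfer {n} D with charMatrix-monic (S D)
  ... | χ , monic , char with halfPoly n χ monic
  ...   | q , g , h+q , g-monic , even =
    reducedRows (S D) q (η D char) ,
    (begin
      detW D                                                        ≡⟨ detW≡det-walkRows D ⟩
      det (walkRows (S D))                                          ≡⟨ det-walkRows (S D) (n ℕ./ 2) q g (η D char) h+q g-monic (η-half D char) ⟩
      (+ 2) ℤ.^ (n ℕ./ 2) * det (reducedRows (S D) q (η D char))    ≡⟨ cong (_* det (reducedRows (S D) q (η D char))) (sym (pos-^ (n ℕ./ 2))) ⟩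
      + (2 ℕ.^ (n ℕ./ 2)) * det (reducedRows (S D) q (η D char))    ∎) ,
    to
    where
    CharPoly : OrientedGraph n → Set
    CharPoly C = ∀ x → det (charMatrix x (S C)) ≡ horner (suc n) χ x
    η : ∀ C → CharPoly C → V n
    η C c i = _∣_.quotient (even (S C) (S-skew C) c i)
    η-half : ∀ C c → act (S C) (suc q) g 𝟙 ≗ + 2 ⊛ η C c
    η-half C c i = trans (_∣_.equality (even (S C) (S-skew C) c i)) (ℤₚ.*-comm (η C c i) (+ 2))
    to : det (reducedRows (S D) q (η D char)) ≢ + 0 → ∀ C → GenCospectral D C →
      Transfer (S D) (S C) (reducedRows (S D) q (η D char)) (det (reducedRows (S D) q (η D char)))
    to X≢0 C gc = transfer (reducedRows (S D) q (η D char)) (reducedRows (S C) q (η C charC))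
                           (~-reducedRows q g (η-half D char) (η-half C charC)) X≢0
      where
      open Twin (S D) (S C) (S-skew D) (S-skew C) (genCospectral-walks D C gc)
      charC : CharPoly C
      charC x = trans (sym (det-charMatrix {M = S D} {S C} (proj₁ gc) x)) (char x)
    pos-^ : ∀ h → + (2 ℕ.^ h) ≡ (+ 2) ℤ.^ h
    pos-^ zero    = refl
    pos-^ (suc h) = trans (ℤₚ.pos-* 2 (2 ℕ.^ h)) (cong (+ 2 *_) (pos-^ h))

-- Counting

module _ {A I : Set} (Q : I → A → Set) (Q? : ∀ i a → Dec (Q i a)) where

  -- Differing in some property with index in `is`, stated negatively: this is the form that
  -- non-isomorphism yields, and no index has to be exhibited.
  Distinguished : List I → A → A → Set
  Distinguished is a b = ¬ (∀ i → i ∈ is → (Q i a → Q i b) × (Q i b → Q i a))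

  private
    partition-length : ∀ {P : A → Set} (P? : ∀ a → Dec (P a)) as →
      length as ≡ length (filter P? as) ℕ.+ length (filter (¬? ∘ P?) as)
    partition-length P? [] = refl
    partition-length P? (a ∷ as) with P? a
    ... | yes _ = cong suc (partition-length P? as)
    ... | no  _ = trans (cong suc (partition-length P? as)) (sym (ℕₚ.+-suc _ _))

    refine : ∀ {P : A → Set} {i is as} → (∀ {a b} → P a → P b → (Q i a → Q i b) × (Q i b → Q i a)) →
      All P as → AllPairs (Distinguished (i ∷ is)) as → AllPairs (Distinguished is) as
    refine agree []       []       = []
    refine {P} {i} {is} agree (p ∷ ps) (d ∷ ds) = related ps d ∷ refine agree ps ds
      where
      related : ∀ {bs} → All P bs → All (Distinguished (i ∷ is) _) bs → All (Distinguished is _) bs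
      related []       []       = []
      related (q ∷ qs) (e ∷ es) =
        (λ same → e (λ { j (here refl) → agree p q ; j (there j∈) → same j j∈ })) ∷ related qs es

  -- Splitting the list by the first property gives two lists whose members agree on it, so each is
  -- told apart by the remaining properties. With no property left, a list has at most one member.
  distinguished-length : ∀ is as → AllPairs (Distinguished is) as → length as ≤ 2 ^ length is
  distinguished-length [] []          _ = z≤n
  distinguished-length [] (a ∷ [])    _ = s≤s z≤n
  distinguished-length [] (a ∷ b ∷ _) ((d ∷ _) ∷ _) = ⊥-elim (d (λ i ()))
  distinguished-length (i ∷ is) as d = ℕₚ.≤-trans (ℕₚ.≤-reflexive (partition-length (Q? i) as))
    (ℕₚ.≤-trans (ℕₚ.+-mono-≤ (distinguished-length is (filter (Q? i) as) yes-part) (distinguished-length is (filter (¬? ∘ Q? i) as) no-part))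
                (ℕₚ.≤-reflexive (cong (2 ^ length is ℕ.+_) (sym (ℕₚ.+-identityʳ (2 ^ length is))))))
    where
    yes-part = refine (λ p q → const q , const p) (Allₚ.all-filter (Q? i) as) (AllPairsₚ.filter⁺ (Q? i) d)
    no-part = refine (λ p q → ⊥-elim ∘ p , ⊥-elim ∘ q) (Allₚ.all-filter (¬? ∘ Q? i) as) (AllPairsₚ.filter⁺ (¬? ∘ Q? i) d)

-- The bound on the number of mates

genCospectral-refl : ∀ {n} (D : OrientedGraph n) → GenCospectral D D
genCospectral-refl D = refl , refl

odd⇒≢0 : ∀ a → Odd ∣ a ∣ → a ≢ + 0
odd⇒≢0 a () refl

odd-divisor : ∀ {p m} → p ℕ∣.∣ m → Odd m → Odd p
odd-divisor {p} {m} p∣m odd with p ℕ.% 2 in eq | ℕ/.m%n<n p 2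
... | 1           | _ = refl
... | suc (suc _) | s≤s (s≤s ())
... | 0           | _ with trans (sym odd) (ℕ∣.n∣m⇒m%n≡0 m 2 (ℕ∣.∣-trans (ℕ∣.m%n≡0⇒n∣m p 2 eq) p∣m))
...   | ()

theorem1 : (n : ℕ) → 1 ≤ n → (D : OrientedGraph n) → InF D →
    (Cs : List (OrientedGraph n)) →
    All (Mate D) Cs →
    AllPairs (λ C C′ → ¬ Isomorphic C C′) Cs →
    length Cs ≤ 2 ^ oddPrimeFactorCount ∣ detW D ∣ ∸ 1
theorem1 n _ D (m , detW≡ , odd , sf) Cs mates distinct = goal
  where
  X : Matrix ℤ n
  X = proj₁ (genCospectral-transfer D)

  o = det X

  o≡m : o ≡ m
  o≡m = ℤₚ.*-cancelˡ-≡ (+ (2 ^ (n ℕ./ 2))) o m {{ℤ.≢-nonZero (λ e → ℕ.≢-nonZero⁻¹ (2 ^ (n ℕ./ 2)) {{ℕₚ.m^n≢0 2 (n ℕ./ 2)}} (ℤₚ.+-injective e))}}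
    (trans (sym (proj₁ (proj₂ (genCospectral-transfer D)))) detW≡)

  o-odd : Odd ∣ o ∣
  o-odd = subst (λ a → Odd ∣ a ∣) (sym o≡m) odd

  o-squareFree : SquareFree ∣ o ∣
  o-squareFree = subst (λ a → SquareFree ∣ a ∣) (sym o≡m) sf

  o≢0 : o ≢ + 0
  o≢0 = odd⇒≢0 o o-odd

  instance
    ∣o∣-nonZero : ℕ.NonZero ∣ o ∣
    ∣o∣-nonZero = ℕ.≢-nonZero (o≢0 ∘ ℤₚ.∣i∣≡0⇒i≡0)

  Cospectrals : Set
  Cospectrals = Σ (OrientedGraph n) λ C → Transfer (S D) (S C) X o

  transferTo : ∀ C → GenCospectral D C → Cospectrals
  transferTo C gc = C , proj₂ (proj₂ (genCospectral-transfer D)) o≢0 C gc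

  Divides : ℕ → Cospectrals → Set
  Divides p (C , t) = ∀ i j → + p ∣ Transfer.N t i j

  divides? : ∀ p c → Dec (Divides p c)
  divides? p (C , t) = Finₚ.all? (λ i → Finₚ.all? (λ j → + p ∣? Transfer.N t i j))

  -- This is the test inside `oddPrimeFactorCount`, so that the length of `primes` is that count by
  -- definition.
  oddPrimeFactor? : ∀ p → Dec (Prime p × p ℕ.% 2 ≡ 1 × p ℕ∣.∣ ∣ detW D ∣)
  oddPrimeFactor? p = prime? p ×-dec ((p ℕ.% 2) ℕ.≟ 1 ×-dec (p ℕ∣.∣? ∣ detW D ∣))

  primes : List ℕ
  primes = filter oddPrimeFactor? (upTo (suc ∣ detW D ∣))

  o∣detW : ∣ o ∣ ℕ∣.∣ ∣ detW D ∣
  o∣detW = subst (∣ o ∣ ℕ∣.∣_) (trans (sym (ℤₚ.abs-* (+ (2 ^ (n ℕ./ 2))) o)) (cong ∣_∣ (sym (proj₁ (proj₂ (genCospectral-transfer D))))))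
    (ℕ∣.n∣m*n (2 ^ (n ℕ./ 2)))

  ∣detW∣-nonZero : ℕ.NonZero ∣ detW D ∣
  ∣detW∣-nonZero = ℕ.≢-nonZero (λ e → ℕ.≢-nonZero⁻¹ (2 ^ (n ℕ./ 2) ℕ.* ∣ o ∣) {{ℕₚ.m*n≢0 _ _ {{ℕₚ.m^n≢0 2 (n ℕ./ 2)}}}}
    (trans (sym (trans (cong ∣_∣ (proj₁ (proj₂ (genCospectral-transfer D)))) (ℤₚ.abs-* (+ (2 ^ (n ℕ./ 2))) o))) e))

  ∈-primes : ∀ {p} → Prime p → p ℕ∣.∣ ∣ o ∣ → p ∈ primes
  ∈-primes pr p∣o = ∈-filter⁺ oddPrimeFactor? (∈-upTo⁺ (s≤s (ℕ∣.∣⇒≤ {{∣detW∣-nonZero}} p∣detW))) (pr , odd-divisor p∣o o-odd , p∣detW)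
    where
    p∣detW = ℕ∣.∣-trans p∣o o∣detW

  isomorphic : (c c′ : Cospectrals) → (∀ p → p ∈ primes → (Divides p c → Divides p c′) × (Divides p c′ → Divides p c)) →
    Isomorphic (proj₁ c) (proj₁ c′)
  isomorphic (C , t) (C′ , t′) same = proj₁ similar , λ i j → S-arc C C′ (proj₂ similar i j)
    where
    similar = permutation-similar (S-skew D) (S-skew C) (S-skew C′) o≢0 t t′
      (cross-square-∣ refl o-squareFree t t′ o-odd
        (λ p pr p∣o → proj₁ (same p (∈-primes pr p∣o))) (λ p pr p∣o → proj₂ (same p (∈-primes pr p∣o))))

  cospectrals : ∀ {Cs} → All (Mate D) Cs → List Cospectrals
  cospectrals []                            = []
  cospectrals (_∷_ {C} (_ , gc) mates) = transferTo C gc ∷ cospectrals mates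

  cospectrals-length : ∀ {Cs} (mates : All (Mate D) Cs) → length (cospectrals mates) ≡ length Cs
  cospectrals-length []          = refl
  cospectrals-length (_ ∷ mates) = cong suc (cospectrals-length mates)

  distinguished : ∀ {Cs} (mates : All (Mate D) Cs) → AllPairs (λ C C′ → ¬ Isomorphic C C′) Cs →
    AllPairs (Distinguished Divides divides? primes) (cospectrals mates)
  distinguished []          []       = []
  distinguished (_∷_ {C} (_ , gc) mates) (d ∷ ds) = against mates d ∷ distinguished mates ds
    where
    against : ∀ {Cs} (mates : All (Mate D) Cs) → All (λ C′ → ¬ Isomorphic C C′) Cs →
      All (Distinguished Divides divides? primes (transferTo C gc)) (cospectrals mates)
    against []                               []       = []
    against (_∷_ {C′} (_ , gc′) mates) (d ∷ ds) =
      (λ same → d (isomorphic (transferTo C gc) (transferTo C′ gc′) same)) ∷ against mates ds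

  fromD : ∀ {Cs} (mates : All (Mate D) Cs) →
    All (Distinguished Divides divides? primes (transferTo D (genCospectral-refl D))) (cospectrals mates)
  fromD []                           = []
  fromD (_∷_ {C} (¬iso , gc) mates) =
    (λ same → ¬iso (isomorphic (transferTo D (genCospectral-refl D)) (transferTo C gc) same)) ∷ fromD mates

  goal : length Cs ≤ 2 ^ length primes ∸ 1
  goal = ℕₚ.∸-monoˡ-≤ 1 (subst (λ l → suc l ≤ 2 ^ length primes) (cospectrals-length mates)
    (distinguished-length Divides divides? primes (transferTo D (genCospectral-refl D) ∷ cospectrals mates)
      (fromD mates ∷ distinguished mates distinct)))
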